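{- Let $\varepsilon\in(0,1/2)$ and let $k$ be a positive integer. There is $N_0(\varepsilon)$ such that for every integer $N>N_0(\varepsilon)$ and every real $y$ with $$(\log N)^{1/\varepsilon}\le y\le N,$$ the following holds. For each prime $p\in[y,2y]$ let $R_p^{(1)},\dots,R_p^{(k)}$ be arbitrary prescribed arithmetic progressions in $\mathbb Z_p$, each of length at most $p^{1/2-\varepsilon}$, and let $R_p=\bigcup_{i=1}^kR_p^{(i)}$. Let $A$ be the set of all integers $n\in\{0,1,\dots,N\}$ such that $n\bmod p\in R_p$ for every prime $p\in[y,2y]$. Then $A$ is contained in a union of $k$ arithmetic progressions (in $\mathbb Z$), each of length at most $$\exp\bigl(\exp(O(k\log k/\varepsilon))\bigr)\,y^{1/2-\varepsilon},$$ where the implied constant in $O(\cdot)$ is absolute.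
   Context: $\mathbb Z_p=\mathbb Z/p\mathbb Z$. An arithmetic progression in an abelian group $G$ is a finite set $\{a+jd:0\le j\le k\}$ with $a,d\in G$, $k\ge0$ an integer (the empty set is also allowed); its length is its number of elements. -}

module Defs where

open import Algebra.Bundles using (AbelianGroup; CommutativeRing)
import Algebra.Definitions.RawMonoid as RawMonoidDefs
import Algebra.Definitions.RawSemiring as RawSemiringDefs
import Algebra.Properties.Monoid.Mult as MonoidMult
import Algebra.Properties.Semiring.Exp as SemiringExp
import Algebra.Properties.CommutativeSemiring.Exp as CommutativeSemiringExp
open import Data.Empty using (⊥; ⊥-elim)
open import Data.Fin.Base using (Fin)
open import Data.Integer.Base as ℤ using (ℤ; +_)
open import Data.Integer.Divisibility.Signed as ℤ∣ using (_∣_)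
import Data.Integer.Properties as ℤ
import Data.Integer.Tactic.RingSolver as ℤSolver
open import Data.List.Base as List using (List; []; map; upTo; deduplicate)
import Data.List.Membership.Setoid as SetoidMembership
open import Data.Nat.Base as ℕ using (ℕ; zero; suc)
import Data.Nat.Properties as ℕ
open import Data.Nat.Primality using (Prime)
open import Data.Product.Base using (Σ; ∃; ∃-syntax; ∃₂; _×_; _,_; proj₁; proj₂)
open import Data.Rational.Base using (ℚ; mkℚ; 0ℚ; 1ℚ; ½; _+_; _*_; _-_; -_; _<_; _≤_; 1/_; _/_; ∣_∣; *<*; *≤*; NonZero; toℚᵘ; +-0-rawMonoid; +-*-rawSemiring; positive; nonNegative; nonPositive; >-nonZero)
open import Data.Rational.Properties
import Data.Rational.Unnormalised.Base as ℚᵘ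
import Data.Rational.Unnormalised.Properties as ℚᵘ
open import Data.Sum.Base using (_⊎_; inj₁; inj₂)
open import Level using (Level; 0ℓ)
open import Relation.Binary.Core using (Rel)
open import Relation.Binary.Definitions using (Decidable; tri<; tri≈; tri>)
open import Relation.Binary.PropositionalEquality using (_≡_; refl; sym; trans; cong; cong₂; subst; subst₂)
open import Relation.Nullary.Decidable using (yes; no; dec⇒maybe)
open import Tactic.RingSolver using (solve-∀)
open import Tactic.RingSolver.Core.AlmostCommutativeRing using (AlmostCommutativeRing; fromCommutativeRing)

private
  variable
    c ℓ : Level

------------------------------------------------------------------------
-- Arithmetic progressions in an abelian group

-- `prog a d k` stands for the set {a + j d : 0 ≤ j ≤ k}; different codes
-- may denote the same set.
data AP (G : AbelianGroup c ℓ) : Set c where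
  ∅    : AP G
  prog : (a d : AbelianGroup.Carrier G) (k : ℕ) → AP G

module Progression (G : AbelianGroup c ℓ) where
  open AbelianGroup G
  open RawMonoidDefs rawMonoid using () renaming (_×_ to _·_)

  terms : AP G → List Carrier
  terms ∅            = []
  terms (prog a d k) = map (λ j → a ∙ (j · d)) (upTo (suc k))

  infix 4 _∈_
  _∈_ : Carrier → AP G → Set _
  x ∈ P = SetoidMembership._∈_ setoid x (terms P)

  -- The number of distinct elements: `prog a d k` may have fewer than
  -- k + 1 of them.
  length : Decidable _≈_ → AP G → ℕ
  length _≟_ P = List.length (deduplicate _≟_ (terms P))

-- ℤ/pℤ: the integers, with congruence modulo p as equality.  The class
-- of n is represented by n itself.
module Residues (p : ℕ) where
  infix 4 _≡ₚ_
  _≡ₚ_ : Rel ℤ 0ℓ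
  a ≡ₚ b = + p ∣ (a ℤ.- b)

  _≟ₚ_ : Decidable _≡ₚ_
  a ≟ₚ b = + p ℤ∣.∣? (a ℤ.- b)

  private
    via : ∀ {a b} → a ≡ b → + p ∣ a → + p ∣ b
    via = subst (+ p ∣_)

    reflexive : ∀ {a b} → a ≡ b → a ≡ₚ b
    reflexive {a} refl = ℤ∣.divides (+ 0) (ℤ.+-inverseʳ a)

    sym-eq : ∀ a b → ℤ.- (a ℤ.- b) ≡ b ℤ.- a
    sym-eq = ℤSolver.solve-∀

    trans-eq : ∀ a b d → (a ℤ.- b) ℤ.+ (b ℤ.- d) ≡ a ℤ.- d
    trans-eq = ℤSolver.solve-∀

    +-eq : ∀ a b d e → (a ℤ.- b) ℤ.+ (d ℤ.- e) ≡ (a ℤ.+ d) ℤ.- (b ℤ.+ e)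
    +-eq = ℤSolver.solve-∀

    neg-eq : ∀ a b → ℤ.- (a ℤ.- b) ≡ ℤ.- a ℤ.- ℤ.- b
    neg-eq = ℤSolver.solve-∀

  abelianGroup : AbelianGroup 0ℓ 0ℓ
  abelianGroup = record
    { Carrier = ℤ ; _≈_ = _≡ₚ_ ; _∙_ = ℤ._+_ ; ε = + 0 ; _⁻¹ = ℤ.-_
    ; isAbelianGroup = record
      { isGroup = record
        { isMonoid = record
          { isSemigroup = record
            { isMagma = record
              { isEquivalence = record
                { refl  = λ {a} → reflexive {a} refl
                ; sym   = λ {a} {b} e → via (sym-eq a b) (ℤ∣.∣m⇒∣-m e)
                ; trans = λ {a} {b} {d} e f →
                    via (trans-eq a b d) (ℤ∣.∣m∣n⇒∣m+n e f)
                }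
              ; ∙-cong = λ {a} {b} {d} {e} f g →
                  via (+-eq a b d e) (ℤ∣.∣m∣n⇒∣m+n f g)
              }
            ; assoc = λ a b d → reflexive (ℤ.+-assoc a b d)
            }
          ; identity = (λ a → reflexive (ℤ.+-identityˡ a))
                     , (λ a → reflexive (ℤ.+-identityʳ a))
          }
        ; inverse = (λ a → reflexive (ℤ.+-inverseˡ a))
                  , (λ a → reflexive (ℤ.+-inverseʳ a))
        ; ⁻¹-cong = λ {a} {b} e → via (neg-eq a b) (ℤ∣.∣m⇒∣-m e)
        }
      ; comm = λ a b → reflexive (ℤ.+-comm a b)
      }
    }

ℤ/ : ℕ → AbelianGroup 0ℓ 0ℓ
ℤ/ p = Residues.abelianGroup p

ℤ⁺ : AbelianGroup 0ℓ 0ℓ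
ℤ⁺ = ℤ.+-0-abelianGroup

infix 4 _∈ℤ_ _∈ℤ/[_]_
_∈ℤ_ : ℤ → AP ℤ⁺ → Set
_∈ℤ_ = Progression._∈_ ℤ⁺

_∈ℤ/[_]_ : ℤ → (p : ℕ) → AP (ℤ/ p) → Set
x ∈ℤ/[ p ] P = Progression._∈_ (ℤ/ p) x P

lengthℤ : AP ℤ⁺ → ℕ
lengthℤ = Progression.length ℤ⁺ ℤ._≟_

lengthℤ/ : (p : ℕ) → AP (ℤ/ p) → ℕ
lengthℤ/ p = Progression.length (ℤ/ p) (Residues._≟ₚ_ p)

------------------------------------------------------------------------
-- Rational arithmetic

open RawMonoidDefs +-0-rawMonoid using () renaming (_×_ to _·_)
open RawSemiringDefs +-*-rawSemiring using (_^_)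

-- The order lemmas are abstract so that they do not unfold to computations
-- on numerators and denominators during type checking.
module OrderLemmas where
  infix 4 _<⊎≥_
  abstract
    dense : ∀ {p q} → p < q → ∃[ r ] p < r × r < q
    dense p<q = let r , p<r , r<q = <-dense p<q in r , p<r , r<q

    _<⊎≥_ : ∀ p q → p < q ⊎ q ≤ p
    p <⊎≥ q with p <? q
    ... | yes p<q = inj₁ p<q
    ... | no  p≮q = inj₂ (≮⇒≥ p≮q)

    ≤-or-≥ : ∀ p q → p ≤ q ⊎ q ≤ p
    ≤-or-≥ = ≤-total

open OrderLemmas

module RationalLemmas where
  ringℚ : AlmostCommutativeRing 0ℓ 0ℓ
  ringℚ = fromCommutativeRing +-*-commutativeRing (λ x → dec⇒maybe (0ℚ ≟ x))

  Pos NonNeg : ℚ → Set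
  Pos x = 0ℚ < x
  NonNeg x = 0ℚ ≤ x

  abstract
    0<1 : Pos 1ℚ
    0<1 = *<* (ℤ.+<+ (ℕ.s≤s ℕ.z≤n))

    diff : ∀ x y → x + (y - x) ≡ y
    diff = solve-∀ ringℚ

    self : ∀ x → x - x ≡ 0ℚ
    self = +-inverseʳ

    <-sub : ∀ {x y} → x < y → Pos (y - x)
    <-sub {x} {y} x<y = subst (_< (y - x)) (self x) (+-monoˡ-< (- x) x<y)

    ≤-sub : ∀ {x y} → x ≤ y → NonNeg (y - x)
    ≤-sub {x} {y} x≤y = subst (_≤ (y - x)) (self x) (+-monoˡ-≤ (- x) x≤y)

    <-by : ∀ {x y e} → Pos e → e ≡ y - x → x < y
    <-by {x} {y} 0<e refl =
      subst₂ _<_ (+-identityʳ x) (diff x y) (+-monoʳ-< x 0<e)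

    ≤-by : ∀ {x y e} → NonNeg e → e ≡ y - x → x ≤ y
    ≤-by {x} {y} 0≤e refl =
      subst₂ _≤_ (+-identityʳ x) (diff x y) (+-monoʳ-≤ x 0≤e)

    infixl 6 _⊞_ _⊞≤_ _⊞<≤_
    infixl 7 _⊠_ _⊠≤_
    _⊞_ : ∀ {x y} → Pos x → Pos y → Pos (x + y)
    p ⊞ q = +-mono-< p q

    _⊞<≤_ : ∀ {x y} → Pos x → NonNeg y → Pos (x + y)
    p ⊞<≤ q = +-mono-<-≤ p q

    _⊞≤_ : ∀ {x y} → NonNeg x → NonNeg y → NonNeg (x + y)
    p ⊞≤ q = +-mono-≤ p q

    _⊠_ : ∀ {x y} → Pos x → Pos y → Pos (x * y)
    _⊠_ {x} {y} p q =
      positive⁻¹ (x * y) {{pos*pos⇒pos x {{positive p}} y {{positive q}}}}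

    _⊠≤_ : ∀ {x y} → NonNeg x → NonNeg y → NonNeg (x * y)
    _⊠≤_ {x} {y} p q = nonNegative⁻¹ (x * y)
      {{nonNeg*nonNeg⇒nonNeg x {{nonNegative p}} y {{nonNegative q}}}}

    square : ∀ x → NonNeg (x * x)
    square x with ≤-or-≥ 0ℚ x
    ... | inj₁ 0≤x = 0≤x ⊠≤ 0≤x
    ... | inj₂ x≤0 = nonNegative⁻¹ (x * x)
      {{nonPos*nonPos⇒nonPos x {{nonPositive x≤0}} x {{nonPositive x≤0}}}}

    0<½ : Pos ½
    0<½ = *<* (ℤ.+<+ (ℕ.s≤s ℕ.z≤n))

    Pos-½ : ∀ {x} → Pos x → Pos (½ * x)
    Pos-½ 0<x = 0<½ ⊠ 0<x

    recip : ∀ {x} → Pos x → ∃[ i ] Pos i × i * x ≡ 1ℚ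
    recip {x} 0<x =
      (1/ x) {{nz}} , positive⁻¹ _ {{1/pos⇒pos x {{positive 0<x}}}} , *-inverseˡ x {{nz}}
      where
      nz : NonZero x
      nz = >-nonZero 0<x

    ≤∣∣ : ∀ x → x ≤ ∣ x ∣
    ≤∣∣ x with ≤-or-≥ 0ℚ x
    ... | inj₁ 0≤x = ≤-reflexive (sym (0≤p⇒∣p∣≡p 0≤x))
    ... | inj₂ x≤0 = ≤-trans x≤0 (0≤∣p∣ x)

    -≤∣∣ : ∀ x → - x ≤ ∣ x ∣
    -≤∣∣ x = subst (- x ≤_) (∣-p∣≡∣p∣ x) (≤∣∣ (- x))

    between₂ : ∀ {q w x} → q < w → q < x → ∃[ r ] q < r × r < w × r < x
    between₂ {q} {w} {x} q<w q<x with ≤-or-≥ w x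
    ... | inj₁ w≤x = let r , q<r , r<w = dense q<w in r , q<r , r<w , <-≤-trans r<w w≤x
    ... | inj₂ x≤w = let r , q<r , r<x = dense q<x in r , q<r , <-≤-trans r<x x≤w , r<x

    between²₂ : ∀ {q w x} → w < q → x < q → ∃[ r ] r < q × w < r × x < r
    between²₂ {q} {w} {x} w<q x<q with ≤-or-≥ w x
    ... | inj₁ w≤x = let r , x<r , r<q = dense x<q in r , r<q , ≤-<-trans w≤x x<r , x<r
    ... | inj₂ x≤w = let r , w<r , r<q = dense w<q in r , r<q , w<r , ≤-<-trans x≤w w<r

    toℚᵘ-· : ∀ n → toℚᵘ (n · 1ℚ) ℚᵘ.≃ ℚᵘ.mkℚᵘ (+ n) 0
    toℚᵘ-· zero    = ℚᵘ.≃-refl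
    toℚᵘ-· (suc n) = ℚᵘ.≃-trans (toℚᵘ-homo-+ 1ℚ (n · 1ℚ))
      (ℚᵘ.≃-trans (ℚᵘ.+-congʳ ℚᵘ.1ℚᵘ (toℚᵘ-· n))
        (ℚᵘ.*≡* (cong (λ z → (+ 1 ℤ.+ z) ℤ.* + 1) (ℤ.*-identityʳ (+ n)))))

    ·-*ʳ : ∀ n x y → n · (x * y) ≡ (n · x) * y
    ·-*ʳ zero    x y = sym (*-zeroˡ y)
    ·-*ʳ (suc n) x y = trans (cong (λ w → x * y + w) (·-*ʳ n x y))
      (sym (*-distribʳ-+ y x (n · x)))

    ·-nonNeg : ∀ n {x} → NonNeg x → NonNeg (n · x)
    ·-nonNeg zero    0≤x = ≤-refl
    ·-nonNeg (suc n) 0≤x = 0≤x ⊞≤ ·-nonNeg n 0≤x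

    ·-mono-≤ : ∀ n {x y} → x ≤ y → n · x ≤ n · y
    ·-mono-≤ zero    x≤y = ≤-refl
    ·-mono-≤ (suc n) x≤y = +-mono-≤ x≤y (·-mono-≤ n x≤y)

    ·-cancel-< : ∀ n {x y} → n · x < n · y → x < y
    ·-cancel-< n {x} {y} lt with x <⊎≥ y
    ... | inj₁ x<y = x<y
    ... | inj₂ x≮y = ⊥-elim (<-irrefl refl (<-≤-trans lt (·-mono-≤ n x≮y)))

    below-ℕ : ∀ x → ∃[ n ] x < n · 1ℚ
    below-ℕ x@(mkℚ a d-1 _) = suc ℤ.∣ a ∣ , toℚᵘ-cancel-<
      (ℚᵘ.<-respʳ-≃ (ℚᵘ.≃-sym (toℚᵘ-· (suc ℤ.∣ a ∣))) (ℚᵘ.*<* bound))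
      where
      bound : a ℤ.* + 1 ℤ.< + suc ℤ.∣ a ∣ ℤ.* + suc d-1
      bound = ℤ.≤-<-trans
        (ℤ.≤-trans (ℤ.≤-reflexive (ℤ.*-identityʳ a)) (i≤∣i∣ a))
        (ℤ.<-≤-trans (ℤ.+<+ (ℕ.n<1+n ℤ.∣ a ∣))
          (ℤ.≤-trans (ℤ.+≤+ (ℕ.m≤m*n (suc ℤ.∣ a ∣) (suc d-1)))
            (ℤ.≤-reflexive (ℤ.pos-* (suc ℤ.∣ a ∣) (suc d-1)))))
        where
        i≤∣i∣ : ∀ i → i ℤ.≤ + ℤ.∣ i ∣
        i≤∣i∣ (+ n)        = ℤ.≤-refl
        i≤∣i∣ ℤ.-[1+ n ]   = ℤ.-≤+

    archimedean : ∀ x {δ} → Pos δ → ∃[ n ] x < n · δ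
    archimedean x {δ} 0<δ =
      let i , 0<i , iδ≡1 = recip 0<δ
          n , xi<n = below-ℕ (x * i)
          eq : x * i * δ ≡ x
          eq = trans (*-assoc x i δ) (trans (cong (x *_) iδ≡1) (*-identityʳ x))
          eq′ : n · 1ℚ * δ ≡ n · δ
          eq′ = trans (sym (·-*ʳ n 1ℚ δ)) (cong (n ·_) (*-identityˡ δ))
      in n , subst₂ _<_ eq eq′ (*-monoˡ-<-pos′ xi<n)
      where
      *-monoˡ-<-pos′ : ∀ {u v} → u < v → u * δ < v * δ
      *-monoˡ-<-pos′ = *-monoˡ-<-pos δ {{positive 0<δ}}

    unit-fraction : ∀ n → ∃[ ι ] Pos ι × suc n · ι ≡ 1ℚ × ι ≤ 1ℚ
    unit-fraction n =
      let 0<n = 0<1 ⊞<≤ ·-nonNeg n (<⇒≤ 0<1)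
          ι , 0<ι , ιn≡1 = recip 0<n
          eq = trans (cong (suc n ·_) (sym (*-identityˡ ι)))
                 (trans (·-*ʳ (suc n) 1ℚ ι) (trans (*-comm (suc n · 1ℚ) ι) ιn≡1))
      in ι , 0<ι , eq ,
         ≤-by (·-nonNeg n (<⇒≤ 0<ι))
           (trans (add-sub ι (n · ι)) (cong (_- ι) eq))
      where
      add-sub : ∀ x y → y ≡ (x + y) - x
      add-sub = solve-∀ ringℚ

    -- A multiple of ι exhausting 1, with K ι below a given bound.
    fine : ∀ {K η} → Pos K → Pos η →
           ∃₂ λ n ι → Pos ι × suc n · ι ≡ 1ℚ × ι ≤ 1ℚ × K * ι < η
    fine {K} {η} 0<K 0<η with archimedean K 0<η
    ... | zero  , K<0  = ⊥-elim (<-asym 0<K K<0)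
    ... | suc n , K<nη =
      let ι , 0<ι , nι≡1 , ι≤1 = unit-fraction n
          nηι : (suc n · η) * ι ≡ η
          nηι = trans (sym (·-*ʳ (suc n) η ι))
                  (trans (cong (suc n ·_) (*-comm η ι))
                    (trans (·-*ʳ (suc n) ι η)
                      (trans (cong (_* η) nι≡1) (*-identityˡ η))))
      in n , ι , 0<ι , nι≡1 , ι≤1 ,
         subst (K * ι <_) nηι (*-monoˡ-<-pos ι {{positive 0<ι}} K<nη)

    ·-split : ∀ n {ι} → n · ι ≡ 1ℚ → ∀ x → n · (x * ι) ≡ x
    ·-split n {ι} nι≡1 x = trans (cong (n ·_) (*-comm x ι))
      (trans (·-*ʳ n ι x) (trans (cong (_* x) nι≡1) (*-identityˡ x)))

    small : ∀ {K η} → Pos K → Pos η → ∃[ δ ] Pos δ × δ ≤ 1ℚ × K * δ < η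
    small 0<K 0<η = let _ , ι , 0<ι , _ , ι≤1 , Kι<η = fine 0<K 0<η in ι , 0<ι , ι≤1 , Kι<η

    ×-assocˡ : ∀ x m n → m · (n · x) ≡ (m ℕ.* n) · x
    ×-assocˡ = MonoidMult.×-assocˡ +-0-monoid

    ^-assocʳ : ∀ x m n → (x ^ m) ^ n ≡ x ^ (m ℕ.* n)
    ^-assocʳ = SemiringExp.^-assocʳ (CommutativeRing.semiring +-*-commutativeRing)

    ^-distrib-* : ∀ x y n → (x * y) ^ n ≡ x ^ n * y ^ n
    ^-distrib-* = CommutativeSemiringExp.^-distrib-*
      (CommutativeRing.commutativeSemiring +-*-commutativeRing)

    ^-pos : ∀ n {x} → Pos x → Pos (x ^ n)
    ^-pos zero    0<x = 0<1
    ^-pos (suc n) 0<x = 0<x ⊠ ^-pos n 0<x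

    ^-nonNeg : ∀ n {x} → NonNeg x → NonNeg (x ^ n)
    ^-nonNeg zero    0≤x = <⇒≤ 0<1
    ^-nonNeg (suc n) 0≤x = 0≤x ⊠≤ ^-nonNeg n 0≤x

    *-mono-≤₀ : ∀ {w x y z} → NonNeg w → NonNeg z → w ≤ x → y ≤ z → w * y ≤ x * z
    *-mono-≤₀ {w} {x} {y} {z} 0≤w 0≤z w≤x y≤z = ≤-by
      ((≤-sub w≤x ⊠≤ 0≤z) ⊞≤ (0≤w ⊠≤ ≤-sub y≤z)) (eq w x y z)
      where
      eq : ∀ w x y z → (x - w) * z + w * (z - y) ≡ x * z - w * y
      eq = solve-∀ ringℚ

    ^-mono-≤ : ∀ n {x y} → NonNeg x → x ≤ y → x ^ n ≤ y ^ n
    ^-mono-≤ zero    0≤x x≤y = ≤-refl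
    ^-mono-≤ (suc n) 0≤x x≤y =
      *-mono-≤₀ 0≤x (^-nonNeg n (≤-trans 0≤x x≤y)) x≤y (^-mono-≤ n 0≤x x≤y)

    1^ : ∀ n → 1ℚ ^ n ≡ 1ℚ
    1^ zero    = refl
    1^ (suc n) = trans (*-identityˡ _) (1^ n)

    bernoulli : ∀ n {x} → NonNeg (1ℚ + x) → 1ℚ + n · x ≤ (1ℚ + x) ^ n
    bernoulli zero        _     = ≤-reflexive (+-identityʳ 1ℚ)
    bernoulli (suc n) {x} 0≤1+x = ≤-trans
      (≤-by (·-nonNeg n (square x))
        (trans (·-*ʳ n x x) (eq x (n · x))))
      (*-monoˡ-≤-nonNeg (1ℚ + x) {{nonNegative 0≤1+x}} (bernoulli n 0≤1+x))
      where
      eq : ∀ x y → y * x ≡ (1ℚ + x) * (1ℚ + y) - (1ℚ + (x + y))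
      eq = solve-∀ ringℚ

open RationalLemmas

------------------------------------------------------------------------
-- Real numbers, as two-sided Dedekind cuts of the rationals

-- `Below x q` and `Above x q` mean q < x and x < q respectively.
record ℝ : Set₁ where
  field
    Below Above     : ℚ → Set
    below-inhabited : ∃ Below
    above-inhabited : ∃ Above
    below-open      : ∀ {q} → Below q → ∃[ r ] q < r × Below r
    above-open      : ∀ {q} → Above q → ∃[ r ] r < q × Above r
    below-closed    : ∀ {q r} → q < r → Below r → Below q
    above-closed    : ∀ {q r} → q < r → Above q → Above r
    disjoint        : ∀ {q} → Below q → Above q → ⊥
    located         : ∀ {q r} → q < r → Below q ⊎ Above r

open ℝ public using (Below; Above)
open ℝ hiding (Below; Above)

infix 4 _<ℝ_ _≤ℝ_
_<ℝ_ : ℝ → ℝ → Set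
x <ℝ y = ∃[ q ] Above x q × Below y q

_≤ℝ_ : ℝ → ℝ → Set
x ≤ℝ y = ∀ q → Below x q → Below y q

record ℝ⁺ : Set₁ where
  constructor _,⁺_
  field
    val : ℝ
    pos : Below val 0ℚ

open ℝ⁺ public using (val)
open ℝ⁺ using (pos)

module CutLemmas where
  abstract
    below<above : ∀ x {q r} → Below x q → Above x r → q < r
    below<above x {q} {r} bq ar with <-cmp q r
    ... | tri< q<r _ _  = q<r
    ... | tri≈ _ refl _ = ⊥-elim (disjoint x bq ar)
    ... | tri> _ _ r<q  = ⊥-elim (disjoint x (below-closed x r<q bq) ar)

    max-below : ∀ x {q r} → Below x q → Below x r → ∃[ s ] Below x s × q ≤ s × r ≤ s
    max-below x {q} {r} bq br with ≤-or-≥ q r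
    ... | inj₁ q≤r = r , br , q≤r , ≤-refl
    ... | inj₂ r≤q = q , bq , ≤-refl , r≤q

    walk : ∀ x n l {η} → Pos η → Below x l → Above x (l + n · η) →
           ∃[ a ] Below x a × Above x (a + (η + η))
    walk x zero    l 0<η bl au = ⊥-elim (disjoint x bl (subst (Above x) (+-identityʳ l) au))
    walk x (suc n) l {η} 0<η bl au
      with located x (+-monoʳ-< l (subst (_< η + η) (+-identityʳ η) (+-monoʳ-< η 0<η)))
    ... | inj₁ b = walk x n (l + η) 0<η b (subst (Above x) (sym (+-assoc l η (n · η))) au)
    ... | inj₂ a = l , bl , a

    approx : ∀ x {δ} → Pos δ → ∃[ a ] Below x a × Above x (a + δ)
    approx x {δ} 0<δ =
      let l , bl = below-inhabited x
          u , au = above-inhabited x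
          n , lt = archimedean (u - l) (Pos-½ 0<δ)
          a , ba , ab = walk x n l (Pos-½ 0<δ) bl
            (above-closed x (<-by (<-sub lt) (eq u l (n · (½ * δ)))) au)
      in a , ba , subst (λ z → Above x (a + z)) (halves δ) ab
      where
      halves : ∀ z → ½ * z + ½ * z ≡ z
      halves = solve-∀ ringℚ
      eq : ∀ u l z → z - (u - l) ≡ (l + z) - u
      eq = solve-∀ ringℚ

open CutLemmas

fromℚ : ℚ → ℝ
fromℚ p = record
  { Below = _< p
  ; Above = p <_
  ; below-inhabited = p - 1ℚ , <-by 0<1 (eq₁ p)
  ; above-inhabited = p + 1ℚ , <-by 0<1 (eq₂ p)
  ; below-open      = λ q<p → let r , q<r , r<p = dense q<p in r , q<r , r<p
  ; above-open      = λ p<q → let r , p<r , r<q = dense p<q in r , r<q , p<r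
  ; below-closed    = <-trans
  ; above-closed    = λ q<r p<q → <-trans p<q q<r
  ; disjoint        = <-asym
  ; located         = loc
  }
  where
  eq₁ : ∀ p → 1ℚ ≡ p - (p - 1ℚ)
  eq₁ = solve-∀ ringℚ
  eq₂ : ∀ p → 1ℚ ≡ (p + 1ℚ) - p
  eq₂ = solve-∀ ringℚ
  loc : ∀ {q r} → q < r → q < p ⊎ p < r
  loc {q} q<r with q <⊎≥ p
  ... | inj₁ q<p = inj₁ q<p
  ... | inj₂ q≮p = inj₂ (≤-<-trans q≮p q<r)

fromℕ : ℕ → ℝ
fromℕ n = fromℚ (+ n / 1)

½ℝ : ℝ
½ℝ = fromℚ ½

infixl 6 _+ℝ_ _-ℝ_
_+ℝ_ : ℝ → ℝ → ℝ
x +ℝ y = record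
  { Below = λ q → ∃₂ λ a b → Below x a × Below y b × q < a + b
  ; Above = λ q → ∃₂ λ a b → Above x a × Above y b × a + b < q
  ; below-inhabited =
      let a , ba = below-inhabited x
          b , bb = below-inhabited y
      in (a + b) - 1ℚ , a , b , ba , bb , <-by 0<1 (eq₁ (a + b))
  ; above-inhabited =
      let a , aa = above-inhabited x
          b , ab = above-inhabited y
      in (a + b) + 1ℚ , a , b , aa , ab , <-by 0<1 (eq₂ (a + b))
  ; below-open = λ { (a , b , ba , bb , lt) →
      let r , q<r , r<s = dense lt in r , q<r , a , b , ba , bb , r<s }
  ; above-open = λ { (a , b , aa , ab , lt) →
      let r , s<r , r<q = dense lt in r , r<q , a , b , aa , ab , s<r }
  ; below-closed = λ { q<r (a , b , ba , bb , lt) → a , b , ba , bb , <-trans q<r lt }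
  ; above-closed = λ { q<r (a , b , aa , ab , lt) → a , b , aa , ab , <-trans lt q<r }
  ; disjoint = λ { (a , b , ba , bb , lt) (a′ , b′ , aa , ab , lt′) →
      <-asym (+-mono-< (below<above x ba aa) (below<above y bb ab)) (<-trans lt′ lt) }
  ; located = loc
  }
  where
  eq₁ : ∀ p → 1ℚ ≡ p - (p - 1ℚ)
  eq₁ = solve-∀ ringℚ
  eq₂ : ∀ p → 1ℚ ≡ (p + 1ℚ) - p
  eq₂ = solve-∀ ringℚ
  eq₃ : ∀ q r a b → ½ * (r - q) + (q - (a + b)) ≡
                    r - ((a + ½ * (½ * (r - q))) + (b + ½ * (½ * (r - q))))
  eq₃ = solve-∀ ringℚ
  loc : ∀ {q r} → q < r →
        (∃₂ λ a b → Below x a × Below y b × q < a + b) ⊎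
        (∃₂ λ a b → Above x a × Above y b × a + b < r)
  loc {q} {r} q<r with approx x (Pos-½ (Pos-½ (<-sub q<r))) | approx y (Pos-½ (Pos-½ (<-sub q<r)))
  ... | a , ba , aa | b , bb , ab with q <⊎≥ a + b
  ...   | inj₁ lt = inj₁ (a , b , ba , bb , lt)
  ...   | inj₂ nl = inj₂ (_ , _ , aa , ab ,
            <-by (Pos-½ (<-sub q<r) ⊞<≤ ≤-sub nl) (eq₃ q r a b))

-ℝ_ : ℝ → ℝ
-ℝ x = record
  { Below = λ q → Above x (- q)
  ; Above = λ q → Below x (- q)
  ; below-inhabited = let u , au = above-inhabited x in - u , subst (Above x) (inv u) au
  ; above-inhabited = let l , bl = below-inhabited x in - l , subst (Below x) (inv l) bl
  ; below-open = λ {q} a → let r , lt , ar = above-open x a in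
      - r , subst (_< - r) (sym (inv q)) (neg-antimono-< lt) , subst (Above x) (inv r) ar
  ; above-open = λ {q} b → let r , lt , br = below-open x b in
      - r , subst (- r <_) (sym (inv q)) (neg-antimono-< lt) , subst (Below x) (inv r) br
  ; below-closed = λ q<r → above-closed x (neg-antimono-< q<r)
  ; above-closed = λ q<r → below-closed x (neg-antimono-< q<r)
  ; disjoint = λ a b → disjoint x b a
  ; located = λ q<r → swap (located x (neg-antimono-< q<r))
  }
  where
  inv : ∀ p → p ≡ - (- p)
  inv = solve-∀ ringℚ
  swap : ∀ {A B : Set} → A ⊎ B → B ⊎ A
  swap (inj₁ a) = inj₂ a
  swap (inj₂ b) = inj₁ b

_-ℝ_ : ℝ → ℝ → ℝ
x -ℝ y = x +ℝ (-ℝ y)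

Corners : (ℚ → Set) → (a b c d : ℚ) → Set
Corners P a b c d = P (a * c) × P (a * d) × P (b * c) × P (b * d)

-- A rational rectangle with (x , y) in its interior at whose corners
-- the product satisfies P, hence (P being an interval) everywhere on it.
Box : ℝ → ℝ → (ℚ → Set) → Set
Box x y P = ∃₂ λ a b → ∃₂ λ c d →
  (Below x a × Above x b) × (Below y c × Above y d) × Corners P a b c d

module ProductLemmas where
  abstract
    mapBox : ∀ x y (P Q : ℚ → Set) → (∀ z → P z → Q z) → Box x y P → Box x y Q
    mapBox x y P Q f (a , b , c , d , xab , ycd , p , q , r , s) =
      a , b , c , d , xab , ycd , f (a * c) p , f (a * d) q , f (b * c) r , f (b * d) s

    lin-lower : ∀ {q a b s} c → a ≤ s → s ≤ b → q < a * c → q < b * c → q < s * c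
    lin-lower {a = a} {b} {s} c a≤s s≤b la lb with ≤-or-≥ 0ℚ c
    ... | inj₁ 0≤c = <-≤-trans la (*-monoʳ-≤-nonNeg c {{nonNegative 0≤c}} a≤s)
    ... | inj₂ c≤0 = <-≤-trans lb (*-monoʳ-≤-nonPos c {{nonPositive c≤0}} s≤b)

    lin-upper : ∀ {q a b s} c → a ≤ s → s ≤ b → a * c < q → b * c < q → s * c < q
    lin-upper {a = a} {b} {s} c a≤s s≤b la lb with ≤-or-≥ 0ℚ c
    ... | inj₁ 0≤c = ≤-<-trans (*-monoʳ-≤-nonNeg c {{nonNegative 0≤c}} s≤b) lb
    ... | inj₂ c≤0 = ≤-<-trans (*-monoʳ-≤-nonPos c {{nonPositive c≤0}} a≤s) la

    box-lower : ∀ {q a b c d s t} → a ≤ s → s ≤ b → c ≤ t → t ≤ d →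
                Corners (q <_) a b c d → q < s * t
    box-lower {q} {a} {b} {c} {d} {s} {t} a≤s s≤b c≤t t≤d (ac , ad , bc , bd) =
      subst (q <_) (*-comm t s) (lin-lower s c≤t t≤d
        (subst (q <_) (*-comm s c) (lin-lower c a≤s s≤b ac bc))
        (subst (q <_) (*-comm s d) (lin-lower d a≤s s≤b ad bd)))

    box-upper : ∀ {q a b c d s t} → a ≤ s → s ≤ b → c ≤ t → t ≤ d →
                Corners (_< q) a b c d → s * t < q
    box-upper {q} {a} {b} {c} {d} {s} {t} a≤s s≤b c≤t t≤d (ac , ad , bc , bd) =
      subst (_< q) (*-comm t s) (lin-upper s c≤t t≤d
        (subst (_< q) (*-comm s c) (lin-upper c a≤s s≤b ac bc))
        (subst (_< q) (*-comm s d) (lin-upper d a≤s s≤b ad bd)))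

    mul-disjoint : ∀ x y {q} → Box x y (q <_) → Box x y (_< q) → ⊥
    mul-disjoint x y
      (a , b , c , d , (ba , ab) , (bc , ad) , lo)
      (a′ , b′ , c′ , d′ , (ba′ , ab′) , (bc′ , ad′) , hi) =
      let s , bs , a≤s , a′≤s = max-below x ba ba′
          t , bt , c≤t , c′≤t = max-below y bc bc′
          s≤b  = <⇒≤ (below<above x bs ab)
          s≤b′ = <⇒≤ (below<above x bs ab′)
          t≤d  = <⇒≤ (below<above y bt ad)
          t≤d′ = <⇒≤ (below<above y bt ad′)
      in <-asym (box-lower a≤s s≤b c≤t t≤d lo) (box-upper a′≤s s≤b′ c′≤t t≤d′ hi)

    mul-below-open : ∀ x y {q} → Box x y (q <_) → ∃[ r ] q < r × Box x y (r <_)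
    mul-below-open x y (a , b , c , d , xab , ycd , p₁ , p₂ , p₃ , p₄) =
      let r₁ , q<r₁ , l₁ , l₂ = between₂ p₁ p₂
          r₂ , q<r₂ , l₃ , l₄ = between₂ p₃ p₄
          r , q<r , r<r₁ , r<r₂ = between₂ q<r₁ q<r₂
      in r , q<r , a , b , c , d , xab , ycd ,
         <-trans r<r₁ l₁ , <-trans r<r₁ l₂ , <-trans r<r₂ l₃ , <-trans r<r₂ l₄

    mul-above-open : ∀ x y {q} → Box x y (_< q) → ∃[ r ] r < q × Box x y (_< r)
    mul-above-open x y (a , b , c , d , xab , ycd , p₁ , p₂ , p₃ , p₄) =
      let r₁ , r₁<q , l₁ , l₂ = between²₂ p₁ p₂
          r₂ , r₂<q , l₃ , l₄ = between²₂ p₃ p₄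
          r , r<q , r₁<r , r₂<r = between²₂ r₁<q r₂<q
      in r , r<q , a , b , c , d , xab , ycd ,
         <-trans l₁ r₁<r , <-trans l₂ r₁<r , <-trans l₃ r₂<r , <-trans l₄ r₂<r

    -- A rectangle on which the product lies within (m , m + η).
    mul-approx : ∀ x y {η} → Pos η → ∃[ m ] Box x y (λ z → m < z × z < m + η)
    mul-approx x y {η} 0<η =
      let a₀ , ba₀ , aa₀ = approx x 0<1
          c₀ , bc₀ , ac₀ = approx y 0<1
          A = ∣ a₀ ∣ + 1ℚ
          C = ∣ c₀ ∣ + 1ℚ
          0≤A = 0≤∣p∣ a₀ ⊞≤ <⇒≤ 0<1
          0≤C = 0≤∣p∣ c₀ ⊞≤ <⇒≤ 0<1
          K = 1ℚ + 1ℚ + (A + C)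
          0<K = 0<1 ⊞ 0<1 ⊞<≤ (0≤A ⊞≤ 0≤C)
          δ , 0<δ , δ≤1 , Kδ<η = small 0<K (Pos-½ 0<η)
          a , ba , aa = approx x 0<δ
          c , bc , ac = approx y 0<δ
          a≤A , -A≤a = range x δ≤1 ba₀ aa₀ ba aa
          c≤C , -C≤c = range y δ≤1 bc₀ ac₀ bc ac
          m = a * c - K * δ
          corner : ∀ w → w ≤ 1ℚ + (A + C) → - (1ℚ + (A + C)) ≤ w →
                   m < a * c + w * δ × a * c + w * δ < m + η
          corner w w≤ -≤w =
            <-by ((0<1 ⊞<≤ ≤-sub -≤w) ⊠ 0<δ) (lo-eq (a * c) w δ (A + C)) ,
            <-by ((<-sub Kδ<η ⊞ <-sub Kδ<η) ⊞ ((0<1 ⊞<≤ ≤-sub w≤) ⊠ 0<δ)) (hi-eq (a * c) w δ (A + C) η)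
          P : ℚ → Set
          P z = m < z × z < m + η
          0≤1 = <⇒≤ 0<1
      in m , a , a + δ , c , c + δ , (ba , aa) , (bc , ac) ,
         subst P (c₁ a c δ) (corner 0ℚ
           (≤-by (0≤1 ⊞≤ (0≤A ⊞≤ 0≤C)) (e₁ (1ℚ + (A + C))))
           (≤-by (0≤1 ⊞≤ (0≤A ⊞≤ 0≤C)) (e₂ (1ℚ + (A + C))))) ,
         subst P (c₂ a c δ) (corner a
           (≤-by (≤-sub a≤A ⊞≤ (0≤1 ⊞≤ 0≤C)) (e₃ a A C))
           (≤-by (≤-sub -A≤a ⊞≤ (0≤1 ⊞≤ 0≤C)) (e₄ a A C))) ,
         subst P (c₃ a c δ) (corner c
           (≤-by (≤-sub c≤C ⊞≤ (0≤1 ⊞≤ 0≤A)) (e₅ c A C))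
           (≤-by (≤-sub -C≤c ⊞≤ (0≤1 ⊞≤ 0≤A)) (e₆ c A C))) ,
         subst P (c₄ a c δ) (corner (a + c + δ)
           (≤-by (≤-sub a≤A ⊞≤ ≤-sub c≤C ⊞≤ ≤-sub δ≤1) (e₇ a c δ A C))
           (≤-by (≤-sub -A≤a ⊞≤ ≤-sub -C≤c ⊞≤ (0≤1 ⊞≤ <⇒≤ 0<δ)) (e₈ a c δ A C)))
      where
      range : ∀ x {a₀ a δ} → δ ≤ 1ℚ → Below x a₀ → Above x (a₀ + 1ℚ) →
              Below x a → Above x (a + δ) → a ≤ ∣ a₀ ∣ + 1ℚ × - (∣ a₀ ∣ + 1ℚ) ≤ a
      range x {a₀} {a} {δ} δ≤1 ba₀ aa₀ ba aa =
        ≤-trans (<⇒≤ (below<above x ba aa₀)) (+-monoˡ-≤ 1ℚ (≤∣∣ a₀)) ,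
        ≤-by (≤-sub (<⇒≤ (below<above x ba₀ aa)) ⊞≤ ≤-sub δ≤1 ⊞≤ ≤-sub (-≤∣∣ a₀))
          (eq a₀ a δ ∣ a₀ ∣)
        where
        eq : ∀ a₀ a δ w → ((a + δ) - a₀) + (1ℚ - δ) + (w - (- a₀)) ≡ a - (- (w + 1ℚ))
        eq = solve-∀ ringℚ
      lo-eq : ∀ m w δ S → (1ℚ + (w - (- (1ℚ + S)))) * δ ≡
                          (m + w * δ) - (m - (1ℚ + 1ℚ + S) * δ)
      lo-eq = solve-∀ ringℚ
      hi-eq : ∀ m w δ S η →
        ((½ * η - (1ℚ + 1ℚ + S) * δ) + (½ * η - (1ℚ + 1ℚ + S) * δ)) + (1ℚ + ((1ℚ + S) - w)) * δ
        ≡ ((m - (1ℚ + 1ℚ + S) * δ) + η) - (m + w * δ)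
      hi-eq = solve-∀ ringℚ
      c₁ : ∀ a c δ → a * c + 0ℚ * δ ≡ a * c
      c₁ = solve-∀ ringℚ
      c₂ : ∀ a c δ → a * c + a * δ ≡ a * (c + δ)
      c₂ = solve-∀ ringℚ
      c₃ : ∀ a c δ → a * c + c * δ ≡ (a + δ) * c
      c₃ = solve-∀ ringℚ
      c₄ : ∀ a c δ → a * c + (a + c + δ) * δ ≡ (a + δ) * (c + δ)
      c₄ = solve-∀ ringℚ
      e₁ : ∀ s → s ≡ s - 0ℚ
      e₁ = solve-∀ ringℚ
      e₂ : ∀ s → s ≡ 0ℚ - (- s)
      e₂ = solve-∀ ringℚ
      e₃ : ∀ a A C → (A - a) + (1ℚ + C) ≡ (1ℚ + (A + C)) - a
      e₃ = solve-∀ ringℚ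
      e₄ : ∀ a A C → (a - (- A)) + (1ℚ + C) ≡ a - (- (1ℚ + (A + C)))
      e₄ = solve-∀ ringℚ
      e₅ : ∀ c A C → (C - c) + (1ℚ + A) ≡ (1ℚ + (A + C)) - c
      e₅ = solve-∀ ringℚ
      e₆ : ∀ c A C → (c - (- C)) + (1ℚ + A) ≡ c - (- (1ℚ + (A + C)))
      e₆ = solve-∀ ringℚ
      e₇ : ∀ a c δ A C → (A - a) + (C - c) + (1ℚ - δ) ≡ (1ℚ + (A + C)) - (a + c + δ)
      e₇ = solve-∀ ringℚ
      e₈ : ∀ a c δ A C → (a - (- A)) + (c - (- C)) + (1ℚ + δ) ≡ (a + c + δ) - (- (1ℚ + (A + C)))
      e₈ = solve-∀ ringℚ

open ProductLemmas

module ProductLocated where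
  abstract
    mul-located : ∀ x y {q r} → q < r → Box x y (q <_) ⊎ Box x y (_< r)
    mul-located x y {q} {r} q<r with mul-approx x y (<-sub q<r)
    ... | m , box with q <⊎≥ m
    ...   | inj₁ q<m = inj₁ (mapBox x y Near (q <_) (λ z p → <-trans q<m (proj₁ p)) box)
      where
      Near : ℚ → Set
      Near z = m < z × z < m + (r - q)
    ...   | inj₂ m≤q = inj₂ (mapBox x y Near (_< r) (λ z p → <-≤-trans (proj₂ p) m+r-q≤r) box)
      where
      Near : ℚ → Set
      Near z = m < z × z < m + (r - q)
      m+r-q≤r : m + (r - q) ≤ r
      m+r-q≤r = subst (m + (r - q) ≤_) (diff q r) (+-monoˡ-≤ (r - q) m≤q)

open ProductLocated

infixl 7 _*ℝ_
_*ℝ_ : ℝ → ℝ → ℝ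
x *ℝ y = record
  { Below = λ q → Box x y (q <_)
  ; Above = λ q → Box x y (_< q)
  ; below-inhabited = let m , box = mul-approx x y 0<1 in m , mapBox x y (λ z → m < z × z < m + 1ℚ) (m <_) (λ z → proj₁) box
  ; above-inhabited = let m , box = mul-approx x y 0<1 in m + 1ℚ , 
      mapBox x y (λ z → m < z × z < m + 1ℚ) (_< m + 1ℚ) (λ z → proj₂) box
  ; below-open   = mul-below-open x y
  ; above-open   = mul-above-open x y
  ; below-closed = λ {q} {r} q<r → mapBox x y (r <_) (q <_) (λ z → <-trans q<r)
  ; above-closed = λ {q} {r} q<r → mapBox x y (_< q) (_< r) (λ z p → <-trans p q<r)
  ; disjoint     = mul-disjoint x y
  ; located      = mul-located x y
  }

module InverseLemmas where
  abstract
    above-pos : (x : ℝ⁺) → ∀ {r} → Above (val x) r → Pos r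
    above-pos x = below<above (val x) (pos x)

    lower-q : ∀ {q r} → Pos r → 1ℚ < q * r → ∃[ s ] s < q × 1ℚ < s * r
    lower-q {q} {r} 0<r lt =
      let η , 0<η , _ , rη<e = small 0<r (<-sub lt)
      in q - η , <-by 0<η (eq₁ q η) , <-by (<-sub rη<e) (eq₂ q r η)
      where
      eq₁ : ∀ q η → η ≡ q - (q - η)
      eq₁ = solve-∀ ringℚ
      eq₂ : ∀ q r η → (q * r - 1ℚ) - r * η ≡ (q - η) * r - 1ℚ
      eq₂ = solve-∀ ringℚ

    raise-q : ∀ {q r} → Pos r → q * r < 1ℚ → ∃[ s ] q < s × s * r < 1ℚ
    raise-q {q} {r} 0<r lt =
      let η , 0<η , _ , rη<e = small 0<r (<-sub lt)
      in q + η , <-by 0<η (eq₁ q η) , <-by (<-sub rη<e) (eq₂ q r η)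
      where
      eq₁ : ∀ q η → η ≡ (q + η) - q
      eq₁ = solve-∀ ringℚ
      eq₂ : ∀ q r η → (1ℚ - q * r) - r * η ≡ 1ℚ - (q + η) * r
      eq₂ = solve-∀ ringℚ

    *-monoʳ : ∀ {q s r} → Pos r → q < s → q * r < s * r
    *-monoʳ {r = r} 0<r = *-monoˡ-<-pos r {{positive 0<r}}

    1<-twice : ∀ i r → i * r ≡ 1ℚ → 1ℚ < (i + i) * r
    1<-twice i r e = <-by 0<1
      (trans (sym (cong (λ z → z + z - 1ℚ) e)) (cong (_- 1ℚ) (sym (*-distribʳ-+ r i i))))

InvBelow InvAbove : ℝ⁺ → ℚ → Set
InvBelow x q = ∃[ r ] Above (val x) r × q * r < 1ℚ
InvAbove x q = ∃[ r ] Below (val x) r × Pos r × 1ℚ < q * r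

open InverseLemmas

module InverseLocated where
  abstract
    recip-anti : ∀ {q q′ i i′} → Pos i → Pos i′ → q < q′ → i * q ≡ 1ℚ → i′ * q′ ≡ 1ℚ → i′ < i
    recip-anti {q} {q′} {i} {i′} 0<i 0<i′ q<q′ iq iq′ =
      <-by ((0<i ⊠ 0<i′) ⊠ <-sub q<q′) (trans (eq i i′ q q′)
        (trans (cong₂ (λ u v → i * u - i′ * v) iq′ iq) (eq′ i i′)))
      where
      eq : ∀ i i′ q q′ → (i * i′) * (q′ - q) ≡ i * (i′ * q′) - i′ * (i * q)
      eq = solve-∀ ringℚ
      eq′ : ∀ i i′ → i * 1ℚ - i′ * 1ℚ ≡ i - i′
      eq′ = solve-∀ ringℚ

    split : ∀ x {q q′ i i′ s t} → Pos q → Pos q′ → i * q ≡ 1ℚ → i′ * q′ ≡ 1ℚ →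
            Pos i′ → i′ < s → t < i →
            Below (val x) s ⊎ Above (val x) t → InvBelow x q ⊎ InvAbove x q′
    split x {q} {q′} {s = s} 0<q 0<q′ iq iq′ 0<i′ i′<s t<i (inj₁ bs) =
      inj₂ (s , bs , <-trans 0<i′ i′<s ,
        subst₂ _<_ iq′ (*-comm s q′) (*-monoʳ 0<q′ i′<s))
    split x {q} {t = t} 0<q 0<q′ iq iq′ 0<i′ i′<s t<i (inj₂ at) =
      inj₁ (t , at , subst₂ _<_ (*-comm t q) iq (*-monoʳ 0<q t<i))

    inv-located : ∀ x {q q′} → q < q′ → InvBelow x q ⊎ InvAbove x q′
    inv-located x {q} {q′} q<q′ with 0ℚ <⊎≥ q
    ... | inj₂ q≤0 =
      let u , au = above-inhabited (val x)
          qu≤0 = subst (q * u ≤_) (*-zeroˡ u)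
            (*-monoʳ-≤-nonNeg u {{nonNegative (<⇒≤ (above-pos x au))}} q≤0)
      in inj₁ (u , au , ≤-<-trans qu≤0 0<1)
    ... | inj₁ 0<q =
      let 0<q′ = <-trans 0<q q<q′
          i , 0<i , iq = recip 0<q
          i′ , 0<i′ , iq′ = recip 0<q′
          s , i′<s , s<i = dense (recip-anti 0<i 0<i′ q<q′ iq iq′)
          t , s<t , t<i = dense s<i
      in split x 0<q 0<q′ iq iq′ 0<i′ i′<s t<i (located (val x) s<t)

open InverseLocated

infix 8 _⁻¹
_⁻¹ : ℝ⁺ → ℝ
x ⁻¹ = record
  { Below = InvBelow x
  ; Above = InvAbove x
  ; below-inhabited =
      let u , au = above-inhabited (val x)
      in 0ℚ , u , au , subst (_< 1ℚ) (sym (*-zeroˡ u)) 0<1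
  ; above-inhabited =
      let s , 0<s , bs = below-open (val x) (pos x)
          i , 0<i , e = recip 0<s
      in i + i , s , bs , 0<s , 1<-twice i s e
  ; below-open = λ { (r , ar , lt) →
      let s , q<s , lt′ = raise-q (above-pos x ar) lt in s , q<s , r , ar , lt′ }
  ; above-open = λ { (r , br , 0<r , lt) →
      let s , s<q , lt′ = lower-q 0<r lt in s , s<q , r , br , 0<r , lt′ }
  ; below-closed = λ { q<s (r , ar , lt) → r , ar , <-trans (*-monoʳ (above-pos x ar) q<s) lt }
  ; above-closed = λ { q<s (r , br , 0<r , lt) → r , br , 0<r , <-trans lt (*-monoʳ 0<r q<s) }
  ; disjoint = λ {q} → disj {q}
  ; located = inv-located x
  }
  where
  disj : ∀ {q} → InvBelow x q → InvAbove x q → ⊥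
  disj {q} (r , ar , lt) (s , bs , 0<s , lt′) with ≤-or-≥ q 0ℚ
  ... | inj₁ q≤0 = <-irrefl refl (<-trans 0<1 (<-≤-trans lt′
          (subst (q * s ≤_) (*-zeroˡ s)
            (*-monoʳ-≤-nonNeg s {{nonNegative (<⇒≤ 0<s)}} q≤0))))
  ... | inj₂ 0≤q = <-irrefl refl (<-trans lt′ (≤-<-trans
          (*-monoˡ-≤-nonNeg q {{nonNegative 0≤q}} (<⇒≤ (below<above (val x) bs ar))) lt))

------------------------------------------------------------------------
-- Exponential and logarithm

ExpBelow ExpAbove : ℝ → ℚ → Set
ExpBelow x q = ∃₂ λ n h → - 1ℚ < h × Below x (suc n · h) × q < (1ℚ + h) ^ suc n
ExpAbove x q = ∃₂ λ n h → h < 1ℚ × Above x (suc n · h) × 1ℚ < q * (1ℚ - h) ^ suc n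

module MeshLemma where
  abstract
    -- For large n, both 1 + a/n and 1 - b/n are positive and w/n is small.
    mesh : ∀ a b w {η} → Pos η → ∃₂ λ n ι → Pos ι × suc n · ι ≡ 1ℚ ×
           - 1ℚ < a * ι × b * ι < 1ℚ × w * ι < η
    mesh a b w {η} 0<η =
      let ζ , 0<ζ , ζ<1 , ζ<η = between₂ 0<1 0<η
          A = ∣ a ∣ ; B = ∣ b ∣ ; W = ∣ w ∣
          0<K = 0<1 ⊞<≤ (0≤∣p∣ a ⊞≤ 0≤∣p∣ b ⊞≤ 0≤∣p∣ w)
          n , ι , 0<ι , nι , _ , Kι<ζ = fine 0<K 0<ζ
          rest : ∀ {u v} → NonNeg u → NonNeg v → NonNeg ((1ℚ + u + v) * ι)
          rest 0≤u 0≤v = (<⇒≤ 0<1 ⊞≤ 0≤u ⊞≤ 0≤v) ⊠≤ <⇒≤ 0<ι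
          Kι<1 = <-trans Kι<ζ ζ<1
          Kι<η = <-trans Kι<ζ ζ<η
      in n , ι , 0<ι , nι ,
         <-by (<-sub Kι<1 ⊞<≤ (≤-sub (-≤∣∣ a) ⊠≤ <⇒≤ 0<ι ⊞≤ rest (0≤∣p∣ b) (0≤∣p∣ w)))
           (eq₁ a A B W ι) ,
         <-by (<-sub Kι<1 ⊞<≤ (≤-sub (≤∣∣ b) ⊠≤ <⇒≤ 0<ι ⊞≤ rest (0≤∣p∣ a) (0≤∣p∣ w)))
           (eq₂ b A B W ι) ,
         <-by (<-sub Kι<η ⊞<≤ (≤-sub (≤∣∣ w) ⊠≤ <⇒≤ 0<ι ⊞≤ rest (0≤∣p∣ a) (0≤∣p∣ b)))
           (eq₃ w A B W ι η)
      where
      eq₁ : ∀ a A B W ι → (1ℚ - (1ℚ + (A + B + W)) * ι) + ((A - (- a)) * ι + (1ℚ + B + W) * ι)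
            ≡ a * ι - (- 1ℚ)
      eq₁ = solve-∀ ringℚ
      eq₂ : ∀ b A B W ι → (1ℚ - (1ℚ + (A + B + W)) * ι) + ((B - b) * ι + (1ℚ + A + W) * ι)
            ≡ 1ℚ - b * ι
      eq₂ = solve-∀ ringℚ
      eq₃ : ∀ w A B W ι η → (η - (1ℚ + (A + B + W)) * ι) + ((W - w) * ι + (1ℚ + A + B) * ι)
            ≡ η - w * ι
      eq₃ = solve-∀ ringℚ

open MeshLemma

module PowerLemmas where
  abstract
    shrink : ∀ h ι → Pos (1ℚ + h) → Pos ι → ι ≤ 1ℚ → Pos (1ℚ + h * ι)
    shrink h ι 0<1+h 0<ι ι≤1 = subst Pos (eq h ι) (0<1+h ⊠ 0<ι ⊞<≤ ≤-sub ι≤1)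
      where
      eq : ∀ h ι → (1ℚ + h) * ι + (1ℚ - ι) ≡ 1ℚ + h * ι
      eq = solve-∀ ringℚ

    refine : ∀ n m h ι → m · ι ≡ 1ℚ → Pos (1ℚ + h) → Pos (1ℚ + h * ι) →
             (1ℚ + h) ^ n ≤ (1ℚ + h * ι) ^ (m ℕ.* n)
    refine n m h ι mι 0<1+h 0<1+hι = ≤-trans
      (^-mono-≤ n (<⇒≤ 0<1+h)
        (subst (λ z → 1ℚ + z ≤ (1ℚ + h * ι) ^ m) (·-split m mι h)
          (bernoulli m (<⇒≤ 0<1+hι))))
      (≤-reflexive (^-assocʳ (1ℚ + h * ι) m n))

    power≤1 : ∀ n u v → Pos (1ℚ + u) → Pos (1ℚ + v) → u < - v →
              (1ℚ + u) ^ n * (1ℚ + v) ^ n ≤ 1ℚ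
    power≤1 n u v 0<1+u 0<1+v u<-v = ≤-trans
      (≤-reflexive (sym (^-distrib-* (1ℚ + u) (1ℚ + v) n)))
      (≤-trans (^-mono-≤ n (<⇒≤ (0<1+u ⊠ 0<1+v))
          (≤-by (<⇒≤ (<-sub u<-v ⊠ 0<1+v) ⊞≤ square v) (eq u v)))
        (≤-reflexive (1^ n)))
      where
      eq : ∀ u v → (- v - u) * (1ℚ + v) + v * v ≡ 1ℚ - (1ℚ + u) * (1ℚ + v)
      eq = solve-∀ ringℚ

    step-< : ∀ n m h g ι κ → m · ι ≡ 1ℚ → n · κ ≡ 1ℚ → n · h < m · g → h * ι < g * κ
    step-< n m h g ι κ mι nκ lt = ·-cancel-< (n ℕ.* m) (subst₂ _<_
      (trans (cong (n ·_) (sym (·-split m mι h))) (×-assocˡ (h * ι) n m))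
      (trans (trans (cong (m ·_) (sym (·-split n nκ g))) (×-assocˡ (g * κ) m n))
        (cong (_· (g * κ)) (ℕ.*-comm m n)))
      lt)

    -- (1 + h)^n ≤ e^(n h) and (1 - g)^m ≤ e^(- m g), in rational terms.
    power-bound′ : ∀ n m h g ι κ → m · ι ≡ 1ℚ → n · κ ≡ 1ℚ → Pos ι → Pos κ → ι ≤ 1ℚ → κ ≤ 1ℚ →
      Pos (1ℚ + h) → Pos (1ℚ - g) → n · h < m · g → (1ℚ + h) ^ n * (1ℚ - g) ^ m ≤ 1ℚ
    power-bound′ n m h g ι κ mι nκ 0<ι 0<κ ι≤1 κ≤1 0<1+h 0<1-g lt = ≤-trans
      (*-mono-≤₀ (<⇒≤ (^-pos n 0<1+h)) (<⇒≤ (^-pos (m ℕ.* n) 0<1+v)) P≤ Q≤)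
      (power≤1 (m ℕ.* n) (h * ι) (- g * κ) 0<1+u 0<1+v
        (subst (h * ι <_) (eq g κ) (step-< n m h g ι κ mι nκ lt)))
      where
      0<1+u : Pos (1ℚ + h * ι)
      0<1+u = shrink h ι 0<1+h 0<ι ι≤1
      0<1+v : Pos (1ℚ + - g * κ)
      0<1+v = shrink (- g) κ 0<1-g 0<κ κ≤1
      P≤ : (1ℚ + h) ^ n ≤ (1ℚ + h * ι) ^ (m ℕ.* n)
      P≤ = refine n m h ι mι 0<1+h 0<1+u
      Q≤ : (1ℚ - g) ^ m ≤ (1ℚ + - g * κ) ^ (m ℕ.* n)
      Q≤ = subst (λ N → (1ℚ - g) ^ m ≤ (1ℚ + - g * κ) ^ N) (ℕ.*-comm n m)
        (refine m n (- g) κ nκ 0<1-g 0<1+v)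
      eq : ∀ g κ → g * κ ≡ - (- g * κ)
      eq = solve-∀ ringℚ

    power-bound : ∀ n m h g → Pos (1ℚ + h) → Pos (1ℚ - g) → suc n · h < suc m · g →
      (1ℚ + h) ^ suc n * (1ℚ - g) ^ suc m ≤ 1ℚ
    power-bound n m h g 0<1+h 0<1-g lt with unit-fraction m | unit-fraction n
    ... | ι , 0<ι , mι , ι≤1 | κ , 0<κ , nκ , κ≤1 =
      power-bound′ (suc n) (suc m) h g ι κ mι nκ 0<ι 0<κ ι≤1 κ≤1 0<1+h 0<1-g lt

open PowerLemmas

module ExpLemmas where
  abstract
    0<1+ : ∀ {h} → - 1ℚ < h → Pos (1ℚ + h)
    0<1+ {h} lt = subst Pos (eq h) (<-sub lt)
      where
      eq : ∀ h → h - (- 1ℚ) ≡ 1ℚ + h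
      eq = solve-∀ ringℚ

    exp-disjoint : ∀ x {q} → ExpBelow x q → ExpAbove x q → ⊥
    exp-disjoint x {q} (n , h , -1<h , bh , q<P) (m , g , g<1 , ag , 1<qQ) =
      <-irrefl refl (<-≤-trans (<-trans 1<qQ (*-monoʳ (^-pos (suc m) (<-sub g<1)) q<P))
        (power-bound n m h g (0<1+ -1<h) (<-sub g<1) (below<above x bh ag)))

    exp-pos : ∀ x → ExpBelow x 0ℚ
    exp-pos x with below-inhabited x
    ... | l , bl with mesh l l l 0<1
    ...   | n , ι , _ , nι , -1<h , _ =
      n , l * ι , -1<h , subst (Below x) (sym (·-split (suc n) nι l)) bl ,
      ^-pos (suc n) (0<1+ -1<h)

    exp-above-inhabited : ∀ x → ∃ (ExpAbove x)
    exp-above-inhabited x with above-inhabited x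
    ... | u , au with mesh u u u 0<1
    ...   | n , ι , _ , nι , _ , h<1 , _ with recip (^-pos (suc n) (<-sub h<1))
    ...     | i , _ , e =
      i + i , n , u * ι , h<1 , subst (Above x) (sym (·-split (suc n) nι u)) au , 1<-twice i _ e

    overshoot′ : ∀ n {q r} h g z → Pos q → Pos r → Pos (1ℚ + h) → Pos (1ℚ - g) →
      1ℚ + z ≡ (1ℚ + h) * (1ℚ - g) → q < r * (1ℚ + n · z) → (1ℚ + h) ^ n ≤ q →
      1ℚ < r * (1ℚ - g) ^ n
    overshoot′ n {q} {r} h g z 0<q 0<r 0<1+h 0<1-g 1+z q<rw P≤q =
      *-cancelˡ-<-nonNeg q {{nonNegative (<⇒≤ 0<q)}}
        (subst₂ _<_ (sym (*-identityʳ q)) (eq r q ((1ℚ - g) ^ n)) q<rqQ)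
      where
      eq : ∀ r q Q → r * (q * Q) ≡ q * (r * Q)
      eq = solve-∀ ringℚ
      power : (1ℚ + z) ^ n ≡ (1ℚ + h) ^ n * (1ℚ - g) ^ n
      power = trans (cong (_^ n) 1+z) (^-distrib-* (1ℚ + h) (1ℚ - g) n)
      low : 1ℚ + n · z ≤ q * (1ℚ - g) ^ n
      low = ≤-trans (bernoulli n (subst NonNeg (sym 1+z) (<⇒≤ (0<1+h ⊠ 0<1-g))))
        (≤-trans (≤-reflexive power)
          (*-monoʳ-≤-nonNeg ((1ℚ - g) ^ n) {{nonNegative (<⇒≤ (^-pos n 0<1-g))}} P≤q))
      q<rqQ : q < r * (q * (1ℚ - g) ^ n)
      q<rqQ = <-≤-trans q<rw (*-monoˡ-≤-nonNeg r {{nonNegative (<⇒≤ 0<r)}} low)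

    overshoot : ∀ n q r a δ ι → Pos q → q < r → n · ι ≡ 1ℚ →
      - 1ℚ < a * ι → (a + δ) * ι < 1ℚ → r * δ < ½ * (r - q) →
      r * (a * (a + δ)) * ι < ½ * (r - q) → (1ℚ + a * ι) ^ n ≤ q →
      1ℚ < r * (1ℚ - (a + δ) * ι) ^ n
    overshoot n q r a δ ι 0<q q<r nι -1<h h′<1 rδ<η small-w P≤q =
      overshoot′ n (a * ι) ((a + δ) * ι) ((- δ - a * (a + δ) * ι) * ι)
        0<q (<-trans 0<q q<r) (0<1+ -1<h) (<-sub h′<1) (eq₁ a δ ι)
        (subst (λ z → q < r * (1ℚ + z)) (sym (·-split n nι (- δ - a * (a + δ) * ι)))
          (<-by (<-sub rδ<η ⊞ <-sub small-w) (eq₂ q r δ a ι)))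
        P≤q
      where
      eq₁ : ∀ a δ ι → 1ℚ + (- δ - a * (a + δ) * ι) * ι ≡ (1ℚ + a * ι) * (1ℚ - (a + δ) * ι)
      eq₁ = solve-∀ ringℚ
      eq₂ : ∀ q r δ a ι → (½ * (r - q) - r * δ) + (½ * (r - q) - r * (a * (a + δ)) * ι)
           ≡ r * (1ℚ + (- δ - a * (a + δ) * ι)) - q
      eq₂ = solve-∀ ringℚ

    decide : ∀ x {q r a δ n ι} → Pos q → q < r → suc n · ι ≡ 1ℚ →
      - 1ℚ < a * ι → (a + δ) * ι < 1ℚ → r * δ < ½ * (r - q) →
      r * (a * (a + δ)) * ι < ½ * (r - q) → Below x a → Above x (a + δ) →
      q < (1ℚ + a * ι) ^ suc n ⊎ (1ℚ + a * ι) ^ suc n ≤ q →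
      ExpBelow x q ⊎ ExpAbove x r
    decide x {a = a} {n = n} {ι} _ _ nι -1<h _ _ _ ba _ (inj₁ q<P) =
      inj₁ (n , a * ι , -1<h , subst (Below x) (sym (·-split (suc n) nι a)) ba , q<P)
    decide x {q} {r} {a} {δ} {n} {ι} 0<q q<r nι -1<h h′<1 rδ<η small-w _ aa (inj₂ P≤q) =
      inj₂ (n , (a + δ) * ι , h′<1 ,
        subst (Above x) (sym (·-split (suc n) nι (a + δ))) aa ,
        overshoot (suc n) q r a δ ι 0<q q<r nι -1<h h′<1 rδ<η small-w P≤q)

module ExpLocated where
  open ExpLemmas
  abstract
    exp-located : ∀ x {q r} → q < r → ExpBelow x q ⊎ ExpAbove x r
    exp-located x {q} {r} q<r with 0ℚ <⊎≥ q
    ... | inj₂ q≤0 with exp-pos x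
    ...   | n , h , l , b , 0<P = inj₁ (n , h , l , b , ≤-<-trans q≤0 0<P)
    exp-located x {q} {r} q<r | inj₁ 0<q with small (<-trans 0<q q<r) (Pos-½ (<-sub q<r))
    ... | δ , 0<δ , _ , rδ<η with approx x 0<δ
    ...   | a , ba , aa with mesh a (a + δ) (r * (a * (a + δ))) (Pos-½ (<-sub q<r))
    ...     | n , ι , 0<ι , nι , -1<h , h′<1 , small-w =
      decide x {n = n} 0<q q<r nι -1<h h′<1 rδ<η small-w ba aa (q <⊎≥ (1ℚ + a * ι) ^ suc n)

open ExpLocated
open ExpLemmas

-- e ^ x is the supremum of (1 + h) ^ n over n ≥ 1, h > -1 with n h < x, and
-- the infimum of (1 - h) ^ (- n) over n ≥ 1, h < 1 with n h > x.
exp : ℝ → ℝ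
exp x = record
  { Below = ExpBelow x
  ; Above = ExpAbove x
  ; below-inhabited = 0ℚ , exp-pos x
  ; above-inhabited = exp-above-inhabited x
  ; below-open = λ { (n , h , l , b , q<P) →
      let r , q<r , r<P = dense q<P in r , q<r , n , h , l , b , r<P }
  ; above-open = λ { (n , h , l , a , 1<qQ) →
      let s , s<q , lt = lower-q (^-pos (suc n) (<-sub l)) 1<qQ in s , s<q , n , h , l , a , lt }
  ; below-closed = λ { q<r (n , h , l , b , r<P) → n , h , l , b , <-trans q<r r<P }
  ; above-closed = λ { q<r (n , h , l , a , lt) → n , h , l , a ,
      <-trans lt (*-monoʳ (^-pos (suc n) (<-sub l)) q<r) }
  ; disjoint = λ {q} → exp-disjoint x {q}
  ; located = exp-located x
  }

module ExpMonoLemmas where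
  abstract
    1<PQ : ∀ n q r ι → n · ι ≡ 1ℚ → q * r * ι < r - q → Pos (1ℚ + r * ι) → Pos (1ℚ - q * ι) →
      1ℚ < (1ℚ + r * ι) ^ n * (1ℚ - q * ι) ^ n
    1<PQ n q r ι nι w 0<1+g 0<1-h = <-≤-trans 1<1+nz (≤-trans nz≤ (≤-reflexive power))
      where
      eq₁ : ∀ w → w ≡ (1ℚ + w) - 1ℚ
      eq₁ = solve-∀ ringℚ
      eq₂ : ∀ q r ι → 1ℚ + ((r - q) - q * r * ι) * ι ≡ (1ℚ + r * ι) * (1ℚ - q * ι)
      eq₂ = solve-∀ ringℚ
      nz : n · (((r - q) - q * r * ι) * ι) ≡ (r - q) - q * r * ι
      nz = ·-split n nι ((r - q) - q * r * ι)
      1<1+nz : 1ℚ < 1ℚ + n · (((r - q) - q * r * ι) * ι)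
      1<1+nz = <-by (subst Pos (sym nz) (<-sub w)) (eq₁ (n · (((r - q) - q * r * ι) * ι)))
      nz≤ : 1ℚ + n · (((r - q) - q * r * ι) * ι) ≤ (1ℚ + ((r - q) - q * r * ι) * ι) ^ n
      nz≤ = bernoulli n (subst NonNeg (sym (eq₂ q r ι)) (<⇒≤ (0<1+g ⊠ 0<1-h)))
      power : (1ℚ + ((r - q) - q * r * ι) * ι) ^ n ≡ (1ℚ + r * ι) ^ n * (1ℚ - q * ι) ^ n
      power = trans (cong (_^ n) (eq₂ q r ι)) (^-distrib-* (1ℚ + r * ι) (1ℚ - q * ι) n)

    separate : ∀ P Q → Pos Q → 1ℚ < P * Q → ∃[ s ] 1ℚ < s * Q × s < P
    separate P Q 0<Q 1<PQ with recip 0<Q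
    ... | i , _ , iQ with dense (*-cancelʳ-<-nonNeg Q {{nonNegative (<⇒≤ 0<Q)}} {i} {P}
                                  (subst (_< P * Q) (sym iQ) 1<PQ))
    ...   | s , i<s , s<P = s , subst (_< s * Q) iQ (*-monoʳ {i} {s} 0<Q i<s) , s<P

module ExpMono where
  open ExpMonoLemmas
  abstract
    exp-mono-< : ∀ {q r} → q < r → exp (fromℚ q) <ℝ exp (fromℚ r)
    exp-mono-< {q} {r} q<r with dense q<r
    ... | q′ , q<q′ , q′<r with dense q′<r
    ...   | r′ , q′<r′ , r′<r with mesh r′ q′ (q′ * r′) (<-sub q′<r′)
    ...     | n , ι , 0<ι , nι , -1<g , h<1 , w with
                separate ((1ℚ + r′ * ι) ^ suc n) ((1ℚ - q′ * ι) ^ suc n)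
                  (^-pos (suc n) (<-sub h<1))
                  (1<PQ (suc n) q′ r′ ι nι w (0<1+ -1<g) (<-sub h<1))
    ...       | s , 1<sQ , s<P =
      s , (n , q′ * ι , h<1 , subst (q <_) (sym (·-split (suc n) nι q′)) q<q′ , 1<sQ) ,
          (n , r′ * ι , -1<g , subst (_< r) (sym (·-split (suc n) nι r′)) r′<r , s<P)

open ExpMono

-- The inverse function of exp: q < log x if and only if exp q < x.
log : ℝ⁺ → ℝ
log x = record
  { Below = λ q → exp (fromℚ q) <ℝ val x
  ; Above = λ q → val x <ℝ exp (fromℚ q)
  ; below-inhabited =
      let s , 0<s , bs = below-open (val x) (pos x)
          i , 0<i , e = recip 0<s
          h = 1ℚ - (i + i)
      in h - 1ℚ , s , (0 , h , <-by (0<i ⊞ 0<i) (eq₁ i) , <-by 0<1 (eq₂ h) ,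
           subst (1ℚ <_) (eq₃ i s) (1<-twice i s e)) , bs
  ; above-inhabited =
      let u , au = above-inhabited (val x)
          0<u = above-pos x au
      in u + 1ℚ , u , au , (0 , u , <-by (0<u ⊞ 0<1) (eq₄ u) , <-by 0<1 (eq₅ u) , <-by 0<1 (eq₆ u))
  ; below-open = λ { (s , (n , h , l , a , lt) , bs) →
      let r , q<r , r<nh = dense a in r , q<r , s , (n , h , l , r<nh , lt) , bs }
  ; above-open = λ { (s , as , (n , h , l , b , lt)) →
      let r , nh<r , r<q = dense b in r , r<q , s , as , (n , h , l , nh<r , lt) }
  ; below-closed = λ { q<r (s , (n , h , l , a , lt) , bs) →
      s , (n , h , l , <-trans q<r a , lt) , bs }
  ; above-closed = λ { q<r (s , as , (n , h , l , b , lt)) →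
      s , as , (n , h , l , <-trans b q<r , lt) }
  ; disjoint = λ { {q} (s , es , bs) (t , at , et) →
      disjoint (exp (fromℚ q)) et
        (above-closed (exp (fromℚ q)) (below<above (val x) bs at) es) }
  ; located = loc
  }
  where
  eq₁ : ∀ i → i + i ≡ 1ℚ - (1ℚ - (i + i))
  eq₁ = solve-∀ ringℚ
  eq₂ : ∀ h → 1ℚ ≡ (h + 0ℚ) - (h - 1ℚ)
  eq₂ = solve-∀ ringℚ
  eq₃ : ∀ i s → (i + i) * s ≡ s * ((1ℚ - (1ℚ - (i + i))) * 1ℚ)
  eq₃ = solve-∀ ringℚ
  eq₄ : ∀ u → u + 1ℚ ≡ u - (- 1ℚ)
  eq₄ = solve-∀ ringℚ
  eq₅ : ∀ u → 1ℚ ≡ (u + 1ℚ) - (u + 0ℚ)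
  eq₅ = solve-∀ ringℚ
  eq₆ : ∀ u → 1ℚ ≡ (1ℚ + u) * 1ℚ - u
  eq₆ = solve-∀ ringℚ
  loc : ∀ {q r} → q < r → exp (fromℚ q) <ℝ val x ⊎ val x <ℝ exp (fromℚ r)
  loc {q} {r} q<r with exp-mono-< q<r
  ... | s , es , et with below-open (exp (fromℚ r)) et
  ...   | t , s<t , et′ with located (val x) s<t
  ...     | inj₁ bs = inj₁ (s , es , bs)
  ...     | inj₂ at = inj₂ (t , at , et′)

infixr 8 _^ℝ_
_^ℝ_ : ℝ⁺ → ℝ → ℝ
x ^ℝ t = exp (t *ℝ log x)

module NaturalLemmas where
  abstract
    toℚᵘ-/1 : ∀ n → toℚᵘ (+ n / 1) ℚᵘ.≃ ℚᵘ.mkℚᵘ (+ n) 0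
    toℚᵘ-/1 n = toℚᵘ-fromℚᵘ (ℚᵘ.mkℚᵘ (+ n) 0)

    <fromℕ : ∀ {q n} → toℚᵘ q ℚᵘ.< ℚᵘ.mkℚᵘ (+ n) 0 → Below (fromℕ n) q
    <fromℕ {q} {n} lt = toℚᵘ-cancel-< (ℚᵘ.<-respʳ-≃ (ℚᵘ.≃-sym (toℚᵘ-/1 n)) lt)

    ℕ-pos : ∀ n → .{{ℕ.NonZero n}} → Below (fromℕ n) 0ℚ
    ℕ-pos n@(suc _) = <fromℕ {n = n} (ℚᵘ.*<* (ℤ.+<+ (ℕ.s≤s ℕ.z≤n)))

    log-pos : ∀ n → .{{_ : ℕ.NonTrivial n}} →
              Below (log (fromℕ n ,⁺ ℕ-pos n {{ℕ.nonTrivial⇒nonZero n}})) 0ℚ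
    log-pos n@(suc (suc m)) =
      + 3 / 2 ,
      (0 , + 1 / 4 , *<* (ℤ.+<+ (ℕ.s≤s (ℕ.s≤s ℕ.z≤n))) , *<* (ℤ.+<+ (ℕ.s≤s ℕ.z≤n)) ,
        *<* (ℤ.+<+ (ℕ.n<1+n 8))) ,
      <fromℕ {n = n} (ℚᵘ.*<* (ℤ.+<+ (ℕ.s≤s (ℕ.s≤s (ℕ.s≤s (ℕ.s≤s ℕ.z≤n))))))

open NaturalLemmas

fromℕ⁺ : (n : ℕ) → .{{ℕ.NonZero n}} → ℝ⁺
fromℕ⁺ n = fromℕ n ,⁺ ℕ-pos n

log⁺ : (n : ℕ) → .{{ℕ.NonTrivial n}} → ℝ⁺
log⁺ n = log (fromℕ⁺ n {{ℕ.nonTrivial⇒nonZero n}}) ,⁺ log-pos n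

------------------------------------------------------------------------
-- Sieving

infix 4 _∈[_,2×]
_∈[_,2×] : ℕ → ℝ → Set
p ∈[ y ,2×] = y ≤ℝ fromℕ p × fromℕ p ≤ℝ fromℕ 2 *ℝ y

-- n belongs to the sifted set A.
Sifted : (N : ℕ) (y : ℝ) {k : ℕ} → ((p : ℕ) → Fin k → AP (ℤ/ p)) → ℕ → Set
Sifted N y R n = n ℕ.≤ N ×
  (∀ p → Prime p → p ∈[ y ,2×] → ∃[ i ] + n ∈ℤ/[ p ] R p i)

{-# OPTIONS --safe #-}
-- A class of points of A which lie in one progression modulo p is described
-- by a base point s, a gap g and a width w such that g ≡ c d (mod p), where d is
-- the difference of the progression and 0 < |c| w < L, L bounding the lengths.
-- When a further point a joins the class, a − s ≡ j d with |j| < L, so that p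
-- divides c (a − s) − j g.  Unless this number is zero, it has few prime
-- factors in [y, 2y], and there are fewer than 4 L² < y^(1 − ε) pairs (c , j);
-- hence c (a − s) = j g for all but few p, and g may be replaced by
-- gcd (g , a − s), with a correspondingly larger w, still less than L.
--
-- Fix B.  As long as some point of A is not covered by the classes, allowing
-- for gaps g / d with d < B and for widths enlarged by the factor B, insert it
-- into the class to which it belongs for the largest number of primes.  Each
-- insertion costs a factor k in the number of primes and multiplies some w by
-- at least B, so that there are at most k (2 + log L / log B) of them.  With
-- log B of order k log k / ε the primes are not used up, by Chebyshev's
-- estimate, and A is covered by k progressions of length at most 2 B · B! · L.
--
-- If k log k / ε exceeds log log N the bound is trivial.  For k = 1 the bound
-- leaves no room for enlargement; there one starts with the least and the
-- greatest element of A, after which only the gap can change.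
module Submission where

-- All size conditions become inequalities between natural numbers through one integer `M` with 3 <
-- M ε < 4. Raised to the power 2 M, L ≤ p^(1/2 - ε) yields L^(2M) ≤ p^(M - 6), and the lower bound
-- on y yields (log N)^M ≤ y^4. So (L² log N)^M is about y^(M - 2) at most, and the missing y² pays,
-- to the power M, for the number of insertions and the factors k. A real y cannot be rounded. It is
-- only caught in i < y < i + 2, so the primes are taken from (n, 2n - 2] with n = i + 1, and
-- Chebyshev's estimate is proved for this range by Erdős' method. Comparing lengths with y^(1/2 -
-- ε) instead of p^(1/2 - ε) loses a factor 2; for k = 1, where the double exponential is just e,
-- this still fits. With log₂ B = 6 P and P = k ⌊log₂ k⌋ M, the enlargement 4 B · B! is below
-- 2^(2^(20 P)). Since log k ≥ ⌊log₂ k⌋ / 2 and 1/ε > M/4, the exponent C k log k / ε exceeds 20 P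
-- once C > 160, whence C = 161.

module RealAnalysis where
  import Algebra.Definitions.RawMonoid as RawMonoidDefs
  import Algebra.Definitions.RawSemiring as RawSemiringDefs
  open import Data.Empty using (⊥-elim; ⊥)
  open import Data.Integer.Base as ℤ using (+_)
  open import Data.Nat.Base as ℕ using (ℕ; zero; suc)
  import Data.Nat.Properties as ℕ
  open import Data.Product.Base using (∃; ∃-syntax; ∃₂; _×_; _,_; proj₁; proj₂)
  open import Data.Rational.Base
  open import Data.Rational.Properties
  import Data.Rational.Unnormalised.Base as ℚᵘ
  import Data.Rational.Unnormalised.Properties as ℚᵘ
  open import Data.Sum.Base using (_⊎_; inj₁; inj₂)
  open import Defs
  open import Relation.Binary.PropositionalEquality
  open import Tactic.RingSolver using (solve-∀)
  open OrderLemmas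
  open RationalLemmas
  open CutLemmas
  open PowerLemmas
  open ExpLemmas using (0<1+)
  open ExpMono
  open NaturalLemmas
  open RawMonoidDefs +-0-rawMonoid using () renaming (_×_ to _·_)
  open RawSemiringDefs +-*-rawSemiring using (_^_)
  open InverseLemmas using (above-pos)
  open ExpLemmas using (0<1+; exp-pos)

  -- Natural numbers and their powers inside the rationals.

  ⟦_⟧ : ℕ → ℚ
  ⟦ n ⟧ = n · 1ℚ

  abstract
    /1≡⟦⟧ : ∀ n → + n / 1 ≡ ⟦ n ⟧
    /1≡⟦⟧ n = toℚᵘ-injective (ℚᵘ.≃-trans (toℚᵘ-/1 n) (ℚᵘ.≃-sym (toℚᵘ-· n)))

    ⟦⟧-+ : ∀ m n → ⟦ m ℕ.+ n ⟧ ≡ ⟦ m ⟧ + ⟦ n ⟧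
    ⟦⟧-+ zero    n = sym (+-identityˡ ⟦ n ⟧)
    ⟦⟧-+ (suc m) n = trans (cong (λ z → 1ℚ + z) (⟦⟧-+ m n)) (sym (+-assoc 1ℚ ⟦ m ⟧ ⟦ n ⟧))

    ⟦⟧-· : ∀ n x → n · x ≡ ⟦ n ⟧ * x
    ⟦⟧-· n x = trans (cong (n ·_) (sym (*-identityˡ x))) (·-*ʳ n 1ℚ x)

    ⟦⟧-* : ∀ m n → ⟦ m ℕ.* n ⟧ ≡ ⟦ m ⟧ * ⟦ n ⟧
    ⟦⟧-* m n = trans (sym (×-assocˡ 1ℚ m n)) (⟦⟧-· m ⟦ n ⟧)

    ⟦⟧-^ : ∀ m n → ⟦ m ℕ.^ n ⟧ ≡ ⟦ m ⟧ ^ n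
    ⟦⟧-^ m zero    = refl
    ⟦⟧-^ m (suc n) = trans (⟦⟧-* m (m ℕ.^ n)) (cong (⟦ m ⟧ *_) (⟦⟧-^ m n))

    ⟦⟧-nonNeg : ∀ n → NonNeg ⟦ n ⟧
    ⟦⟧-nonNeg n = ·-nonNeg n (<⇒≤ 0<1)

    ⟦⟧-pos : ∀ n → Pos ⟦ suc n ⟧
    ⟦⟧-pos n = 0<1 ⊞<≤ ⟦⟧-nonNeg n

    ⟦⟧-mono-≤ : ∀ {m n} → m ℕ.≤ n → ⟦ m ⟧ ≤ ⟦ n ⟧
    ⟦⟧-mono-≤ {n = n} ℕ.z≤n = ⟦⟧-nonNeg n
    ⟦⟧-mono-≤ (ℕ.s≤s m≤n) = +-monoʳ-≤ 1ℚ (⟦⟧-mono-≤ m≤n)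

    ⟦⟧-mono-< : ∀ {m n} → m ℕ.< n → ⟦ m ⟧ < ⟦ n ⟧
    ⟦⟧-mono-< {m} (ℕ.s≤s m≤n) = <-≤-trans
      (<-by 0<1 (eq ⟦ m ⟧)) (+-monoʳ-≤ 1ℚ (⟦⟧-mono-≤ m≤n))
      where
      eq : ∀ x → 1ℚ ≡ (1ℚ + x) - x
      eq = solve-∀ ringℚ

    ⟦⟧-cancel-≤ : ∀ {m n} → ⟦ m ⟧ ≤ ⟦ n ⟧ → m ℕ.≤ n
    ⟦⟧-cancel-≤ le = ℕ.≮⇒≥ λ n<m → <-irrefl refl (<-≤-trans (⟦⟧-mono-< n<m) le)

    ⟦⟧-cancel-< : ∀ {m n} → ⟦ m ⟧ < ⟦ n ⟧ → m ℕ.< n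
    ⟦⟧-cancel-< lt = ℕ.≰⇒> λ n≤m → <-irrefl refl (<-≤-trans lt (⟦⟧-mono-≤ n≤m))

    fraction : ∀ {a} → Pos a → ∃₂ λ A B → suc B · a ≡ ⟦ suc A ⟧
    fraction {a@(mkℚ (+ suc A) B c)} 0<a = A , B , toℚᵘ-injective
      (ℚᵘ.≃-trans (ℚᵘ.≃-trans (ℚᵘ.≃-reflexive (cong toℚᵘ (⟦⟧-· (suc B) a))) (toℚᵘ-homo-* ⟦ suc B ⟧ a))
        (ℚᵘ.≃-trans (ℚᵘ.*-congʳ (toℚᵘ-· (suc B)))
          (ℚᵘ.≃-trans (ℚᵘ.*≡* eq) (ℚᵘ.≃-sym (toℚᵘ-· (suc A))))))
      where
      eq : + suc B ℤ.* + suc A ℤ.* + 1 ≡ + suc A ℤ.* + (suc 0 ℕ.* suc B)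
      eq = cong +_ (trans (ℕ.*-identityʳ (suc B ℕ.* suc A))
        (trans (ℕ.*-comm (suc B) (suc A)) (cong (suc A ℕ.*_) (sym (ℕ.*-identityˡ (suc B))))))
    fraction {mkℚ (+ zero) B c} (*<* (ℤ.+<+ ()))
    fraction {mkℚ ℤ.-[1+ n ] B c} (*<* ())

    ^-≤1 : ∀ n {x} → NonNeg x → x ≤ 1ℚ → x ^ n ≤ 1ℚ
    ^-≤1 n 0≤x x≤1 = ≤-trans (^-mono-≤ n 0≤x x≤1) (≤-reflexive (1^ n))

    1≤^ : ∀ n {x} → 1ℚ ≤ x → 1ℚ ≤ x ^ n
    1≤^ n 1≤x = ≤-trans (≤-reflexive (sym (1^ n))) (^-mono-≤ n (<⇒≤ 0<1) 1≤x)

    -- Continuity of the n-th power from below: for r = (1 - δ) x, Bernoulli gives r^n ≥ (1 - n δ)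
    -- x^n, which would exceed c for small δ if x^n did.
    ^-sup : ∀ n {x c} → Pos x → (∀ r → Pos r → r < x → r ^ n ≤ c) → x ^ n ≤ c
    ^-sup n {x} {c} 0<x below with c <⊎≥ (x ^ n)
    ... | inj₂ x^n≤c = x^n≤c
    ... | inj₁ c<x^n with between₂ (<-sub c<x^n) 0<1
    ...   | ζ , 0<ζ , ζ<d , ζ<1 with small {1ℚ + ⟦ n ⟧ * x ^ n} (0<1 ⊞<≤ (⟦⟧-nonNeg n ⊠≤ ^-nonNeg n (<⇒≤ 0<x))) 0<ζ
    ...     | δ , 0<δ , _ , Kδ<ζ = ⊥-elim (<-irrefl refl (<-≤-trans c<low (≤-trans low (below r (0<1-δ ⊠ 0<x) (<-by (0<δ ⊠ 0<x) (eq₂ δ x))))))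
      where
      eq₀ : ∀ δ → 1ℚ - δ ≡ 1ℚ + - δ
      eq₀ = solve-∀ ringℚ
      eq₁ : ∀ w δ → w * δ ≡ (1ℚ + w) * δ - δ
      eq₁ = solve-∀ ringℚ
      eq₂ : ∀ δ x → δ * x ≡ x - (1ℚ + - δ) * x
      eq₂ = solve-∀ ringℚ
      eq₃ : ∀ n X δ c → ((X - c) - (1ℚ + n * X) * δ) + δ ≡ (1ℚ + n * (- δ)) * X - c
      eq₃ = solve-∀ ringℚ
      0≤nX : NonNeg (⟦ n ⟧ * x ^ n)
      0≤nX = ⟦⟧-nonNeg n ⊠≤ ^-nonNeg n (<⇒≤ 0<x)
      δ<1 : δ < 1ℚ
      δ<1 = <-trans (≤-<-trans (≤-by (0≤nX ⊠≤ <⇒≤ 0<δ) (eq₁ (⟦ n ⟧ * x ^ n) δ)) Kδ<ζ) ζ<1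
      r : ℚ
      r = (1ℚ + - δ) * x
      0<1-δ : Pos (1ℚ + - δ)
      0<1-δ = subst Pos (eq₀ δ) (<-sub δ<1)
      low : (1ℚ + n · (- δ)) * x ^ n ≤ r ^ n
      low = ≤-trans (*-monoʳ-≤-nonNeg (x ^ n) {{nonNegative (^-nonNeg n (<⇒≤ 0<x))}} (bernoulli n (<⇒≤ 0<1-δ)))
            (≤-reflexive (sym (^-distrib-* (1ℚ + - δ) x n)))
      c<low : c < (1ℚ + n · (- δ)) * x ^ n
      c<low = subst (λ z → c < (1ℚ + z) * x ^ n) (sym (⟦⟧-· n (- δ)))
        (<-by (<-sub (<-trans Kδ<ζ ζ<d) ⊞ 0<δ) (eq₃ ⟦ n ⟧ (x ^ n) δ c))

    chain : ∀ {R S P Q} → NonNeg S → NonNeg P → R ≤ P → 1ℚ ≤ S * Q → P * Q ≤ 1ℚ → R ≤ S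
    chain {R} {S} {P} {Q} 0≤S 0≤P R≤P 1≤SQ PQ≤1 = begin
      R ≤⟨ R≤P ⟩
      P ≡⟨ *-identityʳ P ⟨
      P * 1ℚ ≤⟨ *-monoˡ-≤-nonNeg P {{nonNegative 0≤P}} 1≤SQ ⟩
      P * (S * Q) ≡⟨ eq P S Q ⟩
      S * (P * Q) ≤⟨ *-monoˡ-≤-nonNeg S {{nonNegative 0≤S}} PQ≤1 ⟩
      S * 1ℚ ≡⟨ *-identityʳ S ⟩
      S ∎
      where
      open ≤-Reasoning
      eq : ∀ P s Q → P * (s * Q) ≡ s * (P * Q)
      eq = solve-∀ ringℚ

    ^-of-^ : ∀ x n b → (x ^ n) ^ b ≡ x ^ (b ℕ.* n)
    ^-of-^ x n b = trans (^-assocʳ x n b) (cong (x ^_) (ℕ.*-comm n b))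

    -- r ≤ e ^ u and e ^ v ≤ s in rational terms; if B u < A v then r ^ B ≤ s ^ A.
    compare : ∀ A B n m {h g r s} → NonNeg r → NonNeg s → - 1ℚ < h → g < 1ℚ →
      r ≤ (1ℚ + h) ^ suc n → 1ℚ ≤ s * (1ℚ - g) ^ suc m →
      suc B · (suc n · h) < suc A · (suc m · g) → r ^ suc B ≤ s ^ suc A
    compare A B n m {h} {g} {r} {s} 0≤r 0≤s -1<h g<1 r≤ 1≤ lt =
      chain {r ^ suc B} {s ^ suc A} {(1ℚ + h) ^ (suc B ℕ.* suc n)} {(1ℚ - g) ^ (suc A ℕ.* suc m)}
        (^-nonNeg (suc A) 0≤s) (^-nonNeg (suc B ℕ.* suc n) (<⇒≤ (0<1+ -1<h)))
        (subst (r ^ suc B ≤_) (^-of-^ (1ℚ + h) (suc n) (suc B)) (^-mono-≤ (suc B) 0≤r r≤))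
        (subst (1ℚ ≤_) (trans (^-distrib-* s ((1ℚ - g) ^ suc m) (suc A)) (cong (s ^ suc A *_) (^-of-^ (1ℚ - g) (suc m) (suc A))))
          (1≤^ (suc A) 1≤))
        (power-bound (n ℕ.+ B ℕ.* suc n) (m ℕ.+ A ℕ.* suc m) h g (0<1+ -1<h) (<-sub g<1)
          (subst₂ _<_ (×-assocˡ h (suc B) (suc n)) (×-assocˡ g (suc A) (suc m)) lt))

  -- Rational lower bounds for real numbers.

  infix 4 _≼_
  -- Unfolds to the same condition as `fromℚ u ≤ℝ x`. Being non-strict, it covers bounds that are
  -- attained, such as 1 ≤ e^0, where `Below` fails.
  _≼_ : ℚ → ℝ → Set
  u ≼ x = ∀ q → q < u → Below x q

  abstract
    ≼-from-below : ∀ {x q} → Below x q → q ≼ x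
    ≼-from-below {x} b r r<q = ℝ.below-closed x r<q b

    shrink-factor : ∀ {q u v} → Pos u → Pos v → q < u * v → ∃[ a ] a < u × Pos a × q < a * v
    shrink-factor {q} {u} {v} 0<u 0<v q<uv with recip 0<v
    ... | i , _ , iv with between²₂ {u} {q * i} {0ℚ}
        (*-cancelʳ-<-nonNeg v {{nonNegative (<⇒≤ 0<v)}} {q * i} {u} (subst (_< u * v) (sym qiv) q<uv)) 0<u
      where
      qiv : q * i * v ≡ q
      qiv = trans (*-assoc q i v) (trans (cong (q *_) iv) (*-identityʳ q))
    ...   | a , a<u , qi<a , 0<a = a , a<u , 0<a ,
      subst (_< a * v) (trans (*-assoc q i v) (trans (cong (q *_) iv) (*-identityʳ q))) (*-monoˡ-<-pos v {{positive 0<v}} qi<a)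

    shrink-factors : ∀ {q u v} → Pos u → Pos v → q < u * v → ∃₂ λ a c → a < u × Pos a × c < v × Pos c × q < a * c
    shrink-factors {q} {u} {v} 0<u 0<v q<uv with shrink-factor 0<u 0<v q<uv
    ... | a , a<u , 0<a , q<av with shrink-factor {q} 0<v 0<a (subst (q <_) (*-comm a v) q<av)
    ...   | c , c<v , 0<c , q<ca = a , c , a<u , 0<a , c<v , 0<c , subst (q <_) (*-comm c a) q<ca

    positive-corners : ∀ {q a b c d} → Pos a → Pos c → a ≤ b → c ≤ d → q < a * c → Corners (q <_) a b c d
    positive-corners 0<a 0<c a≤b c≤d q<ac =
      q<ac ,
      <-≤-trans q<ac (*-mono-≤₀ (<⇒≤ 0<a) (≤-trans (<⇒≤ 0<c) c≤d) ≤-refl c≤d) ,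
      <-≤-trans q<ac (*-mono-≤₀ (<⇒≤ 0<a) (<⇒≤ 0<c) a≤b ≤-refl) ,
      <-≤-trans q<ac (*-mono-≤₀ (<⇒≤ 0<a) (≤-trans (<⇒≤ 0<c) c≤d) a≤b c≤d)

    below-* : ∀ {x y q a b c d} → Below x a → Above x b → Below y c → Above y d → Corners (q <_) a b c d → Below (x *ℝ y) q
    below-* {x} {y} {q} {a} {b} {c} {d} xa xb yc yd corners = a , b , c , d , (xa , xb) , (yc , yd) , corners

    ≼-*-pos : ∀ {x y u v} → Pos u → Pos v → u ≼ x → v ≼ y → u * v ≼ x *ℝ y
    ≼-*-pos {x} {y} {u} {v} 0<u 0<v u≼x v≼y q q<uv = go (shrink-factors {q} {u} {v} 0<u 0<v q<uv) (ℝ.above-inhabited x) (ℝ.above-inhabited y)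
      where
      go : (∃₂ λ a c → a < u × Pos a × c < v × Pos c × q < a * c) → ∃ (Above x) → ∃ (Above y) → Below (x *ℝ y) q
      go (a , c , a<u , 0<a , c<v , 0<c , q<ac) (b , ab) (d , ad) =
        below-* {x} {y} {q} {a} {b} {c} {d} (u≼x a a<u) ab (v≼y c c<v) ad
          (positive-corners {q} {a} {b} {c} {d} 0<a 0<c (<⇒≤ (below<above x (u≼x a a<u) ab)) (<⇒≤ (below<above y (v≼y c c<v) ad)) q<ac)

    ≼-nonNeg : ∀ x {b} → 0ℚ ≼ x → Above x b → NonNeg b
    ≼-nonNeg x {b} 0≼x ab with b <⊎≥ 0ℚ
    ... | inj₂ 0≤b = 0≤b
    ... | inj₁ b<0 = ⊥-elim (ℝ.disjoint x (0≼x b b<0) ab)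

    nonNeg-corners : ∀ {q b d δ} → q < 0ℚ → NonNeg b → NonNeg d → Pos δ → (1ℚ + (b + d)) * δ < - q →
                     Corners (q <_) (- δ) b (- δ) d
    nonNeg-corners {q} {b} {d} {δ} q<0 0≤b 0≤d 0<δ lt =
      <-≤-trans q<0 (subst NonNeg (eq₂ δ) (<⇒≤ 0<δ ⊠≤ <⇒≤ 0<δ)) ,
      <-by (<-sub lt ⊞<≤ ((<⇒≤ 0<1 ⊞≤ 0≤b) ⊠≤ <⇒≤ 0<δ)) (eq₃ q b d δ) ,
      <-by (<-sub lt ⊞<≤ ((<⇒≤ 0<1 ⊞≤ 0≤d) ⊠≤ <⇒≤ 0<δ)) (eq₄ q b d δ) ,
      <-≤-trans q<0 (0≤b ⊠≤ 0≤d)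
      where
      eq₂ : ∀ δ → δ * δ ≡ - δ * - δ
      eq₂ = solve-∀ ringℚ
      eq₃ : ∀ q b d δ → (- q - (1ℚ + (b + d)) * δ) + (1ℚ + b) * δ ≡ (- δ) * d - q
      eq₃ = solve-∀ ringℚ
      eq₄ : ∀ q b d δ → (- q - (1ℚ + (b + d)) * δ) + (1ℚ + d) * δ ≡ b * (- δ) - q
      eq₄ = solve-∀ ringℚ

    -- When a factor vanishes there is no box with positive corners, so the lower edges are put at -
    -- δ; the mixed corners - δ d and - δ b stay above q < 0 once δ is small.
    0≼-* : ∀ {x y} → 0ℚ ≼ x → 0ℚ ≼ y → 0ℚ ≼ x *ℝ y
    0≼-* {x} {y} 0≼x 0≼y q q<0 = go (ℝ.above-inhabited x) (ℝ.above-inhabited y)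
      where
      eq₀ : ∀ q → 0ℚ - q ≡ - q
      eq₀ = solve-∀ ringℚ
      eq₁ : ∀ δ → δ ≡ 0ℚ - (- δ)
      eq₁ = solve-∀ ringℚ
      -δ<0 : ∀ {δ} → Pos δ → - δ < 0ℚ
      -δ<0 {δ} 0<δ = <-by 0<δ (eq₁ δ)
      go : ∃ (Above x) → ∃ (Above y) → Below (x *ℝ y) q
      go (b , ab) (d , ad) = go′ (small {1ℚ + (b + d)} {(- q)}
          (0<1 ⊞<≤ (≼-nonNeg x 0≼x ab ⊞≤ ≼-nonNeg y 0≼y ad)) (subst Pos (eq₀ q) (<-sub q<0)))
        where
        go′ : (∃[ δ ] Pos δ × δ ≤ 1ℚ × (1ℚ + (b + d)) * δ < - q) → Below (x *ℝ y) q
        go′ (δ , 0<δ , _ , lt) = below-* {x} {y} {q} {(- δ)} {b} {(- δ)} {d}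
          (0≼x (- δ) (-δ<0 0<δ)) ab (0≼y (- δ) (-δ<0 0<δ)) ad
          (nonNeg-corners {q} {b} {d} {δ} q<0 (≼-nonNeg x 0≼x ab) (≼-nonNeg y 0≼y ad) 0<δ lt)

    ≼-fromℕ : ∀ n → ⟦ n ⟧ ≼ fromℕ n
    ≼-fromℕ n q q< = subst (q <_) (sym (/1≡⟦⟧ n)) q<

    fromℕ≤ : ∀ {n x} → ⟦ n ⟧ ≼ x → fromℕ n ≤ℝ x
    fromℕ≤ {n} le q q< = le q (subst (q <_) (/1≡⟦⟧ n) q<)

    -- Bounds for exponentials, logarithms and real powers.

    log-positive : ∀ (x : ℝ⁺) {r} → Below (val x) r → 1ℚ < r → Below (log x) 0ℚ
    log-positive x {r} br 1<r = go (small {r} {r - 1ℚ} 0<r (<-sub 1<r))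
      where
      0<r : Pos r
      0<r = <-trans 0<1 1<r
      eq₀ : ∀ r → 1ℚ ≡ r * 1ℚ - (r - 1ℚ)
      eq₀ = solve-∀ ringℚ
      eq₁ : ∀ r g → (r - 1ℚ) - r * g ≡ r * ((1ℚ - g) * 1ℚ) - 1ℚ
      eq₁ = solve-∀ ringℚ
      go : (∃[ g ] Pos g × g ≤ 1ℚ × r * g < r - 1ℚ) → Below (log x) 0ℚ
      go (g , 0<g , _ , rg<) =
        r , (0 , g , g<1 , subst (0ℚ <_) (sym (+-identityʳ g)) 0<g , <-by (<-sub rg<) (eq₁ r g)) , br
        where
        g<1 : g < 1ℚ
        g<1 = *-cancelˡ-<-nonNeg r {{nonNegative (<⇒≤ 0<r)}} {g} {1ℚ} (<-trans rg< (<-by 0<1 (eq₀ r)))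

    1≼exp : ∀ {x} → 0ℚ ≼ x → 1ℚ ≼ exp x
    1≼exp {x} 0≼x q q<1 = go (between²₂ q<1 0<1)
      where
      eq₁ : ∀ r → r ≡ (r - 1ℚ) - (- 1ℚ)
      eq₁ = solve-∀ ringℚ
      eq₂ : ∀ r → 1ℚ - r ≡ 0ℚ - ((r - 1ℚ) + 0ℚ)
      eq₂ = solve-∀ ringℚ
      eq₃ : ∀ r → r ≡ (1ℚ + (r - 1ℚ)) * 1ℚ
      eq₃ = solve-∀ ringℚ
      go : (∃[ r ] r < 1ℚ × q < r × 0ℚ < r) → Below (exp x) q
      go (r , r<1 , q<r , 0<r) =
        0 , r - 1ℚ , <-by 0<r (eq₁ r) , 0≼x ((r - 1ℚ) + 0ℚ) (<-by (<-sub r<1) (eq₂ r)) , subst (q <_) (eq₃ r) q<r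

    2^≼exp : ∀ {x} n → Below x ⟦ suc n ⟧ → ⟦ 2 ℕ.^ suc n ⟧ ≼ exp x
    2^≼exp {x} n b q q< = n , 1ℚ , *<* ℤ.-<+ , b , subst (q <_) (⟦⟧-^ 2 (suc n)) q<

    -- e ^ (4/7) ≤ (7/5)² < 2, so that log 2 > 1/2.
    exp-½-≤ : ∀ l m h → - 1ℚ < h → suc m · h < ½ * ⟦ l ⟧ → (1ℚ + h) ^ suc m ≤ ⟦ 2 ℕ.^ l ⟧
    exp-½-≤ zero m h -1<h lt with ≤-or-≥ h 0ℚ
    ... | inj₁ h≤0 = ^-≤1 (suc m) (<⇒≤ (0<1+ -1<h)) (≤-by (≤-sub h≤0) (eq h))
      where
      eq : ∀ h → 0ℚ - h ≡ 1ℚ - (1ℚ + h)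
      eq = solve-∀ ringℚ
    ... | inj₂ 0≤h = ⊥-elim (<-irrefl refl (≤-<-trans (·-nonNeg (suc m) 0≤h) (subst (suc m · h <_) (*-zeroʳ ½) lt)))
    exp-½-≤ (suc l) m h -1<h lt = subst₂ _≤_ (*-identityʳ ((1ℚ + h) ^ suc m)) (*-identityʳ ⟦ 2 ℕ.^ suc l ⟧)
      (compare 0 0 m (l ℕ.+ (suc l ℕ.+ 0)) (^-nonNeg (suc m) (<⇒≤ (0<1+ -1<h))) (⟦⟧-nonNeg (2 ℕ.^ suc l)) -1<h g<1 ≤-refl 1≤ lt′)
      where
      g : ℚ
      g = + 2 / 7
      g<1 : g < 1ℚ
      g<1 = *<* (ℤ.+<+ (ℕ.<ᵇ⇒< 2 7 _))
      1≤base : 1ℚ ≤ ⟦ 2 ⟧ * (1ℚ - g) ^ 2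
      1≤base = *≤* (ℤ.+≤+ (ℕ.≤ᵇ⇒≤ 49 50 _))
      1≤ : 1ℚ ≤ ⟦ 2 ℕ.^ suc l ⟧ * (1ℚ - g) ^ (2 ℕ.* suc l)
      1≤ = subst (1ℚ ≤_) (trans (^-distrib-* ⟦ 2 ⟧ ((1ℚ - g) ^ 2) (suc l))
        (cong₂ _*_ (sym (⟦⟧-^ 2 (suc l))) (^-assocʳ (1ℚ - g) 2 (suc l)))) (1≤^ (suc l) 1≤base)
      lt′ : 1 · (suc m · h) < 1 · ((2 ℕ.* suc l) · g)
      lt′ = subst₂ _<_ (sym (+-identityʳ (suc m · h))) (sym (+-identityʳ ((2 ℕ.* suc l) · g)))
        (<-≤-trans lt (≤-trans (*-monoʳ-≤-nonNeg ⟦ suc l ⟧ {{nonNegative (⟦⟧-nonNeg (suc l))}} ½≤)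
          (≤-reflexive (trans (eq ⟦ 2 ⟧ g ⟦ suc l ⟧) (trans (cong (_* g) (sym (⟦⟧-* 2 (suc l)))) (sym (⟦⟧-· (2 ℕ.* suc l) g)))))))
        where
        ½≤ : ½ ≤ ⟦ 2 ⟧ * g
        ½≤ = *≤* (ℤ.+≤+ (ℕ.≤ᵇ⇒≤ 7 8 _))
        eq : ∀ a g b → a * g * b ≡ a * b * g
        eq = solve-∀ ringℚ

    ½≼log : ∀ l n → .{{_ : ℕ.NonZero n}} → 2 ℕ.^ l ℕ.≤ n → ½ * ⟦ l ⟧ ≼ log (fromℕ⁺ n)
    ½≼log l n 2^l≤n q q< = go (exp-mono-< q<)
      where
      go : exp (fromℚ q) <ℝ exp (fromℚ (½ * ⟦ l ⟧)) → Below (log (fromℕ⁺ n)) q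
      go (s , above , (m , h , -1<h , mh< , s<)) =
        s , above , subst (s <_) (sym (/1≡⟦⟧ n)) (<-≤-trans s< (≤-trans (exp-½-≤ l m h -1<h mh<) (⟦⟧-mono-≤ 2^l≤n)))

    -- As r ≥ 1, the witness h is nonnegative, and the upper bound d of `log x` is positive. So a d
    -- > n h ≥ 0 forces a > 0, and then a c > n h ≥ 0 forces c > 0; the signs allow the product to
    -- be compared factor by factor afterwards.
    exp-below-split : ∀ {t} (x : ℝ⁺) {r} → Below (log x) 0ℚ → Below (exp (t *ℝ log x)) r → 1ℚ ≤ r →
      ∃₂ λ a c → ∃₂ λ n h → Below t a × Pos a × Pos c × Below (log x) c × - 1ℚ < h × r < (1ℚ + h) ^ suc n × suc n · h < a * c
    exp-below-split {t} x {r} 0<log (n , h , -1<h , (a , b , c , d , (ta , tb) , (xc , xd) , ac , ad , _ , _) , r<) 1≤r =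
      a , c , n , h , ta , 0<a , 0<c , xc , -1<h , r< , ac
      where
      0≤h : NonNeg h
      0≤h with ≤-or-≥ 0ℚ h
      ... | inj₁ 0≤h = 0≤h
      ... | inj₂ h≤0 = ⊥-elim (<-irrefl refl (≤-<-trans 1≤r (<-≤-trans r<
              (^-≤1 (suc n) (<⇒≤ (0<1+ -1<h)) (≤-by (≤-sub h≤0) (eq h))))))
        where
        eq : ∀ h → 0ℚ - h ≡ 1ℚ - (1ℚ + h)
        eq = solve-∀ ringℚ
      0<d : Pos d
      0<d = below<above (log x) 0<log xd
      0<a : Pos a
      0<a = *-cancelʳ-<-nonNeg d {{nonNegative (<⇒≤ 0<d)}}
        (subst (_< a * d) (sym (*-zeroˡ d)) (≤-<-trans (·-nonNeg (suc n) 0≤h) ad))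

      0<c : Pos c
      0<c = *-cancelˡ-<-nonNeg a {{nonNegative (<⇒≤ 0<a)}}
        (subst (_< a * c) (sym (*-zeroʳ a)) (≤-<-trans (·-nonNeg (suc n) 0≤h) ac))

    exp-above-split : ∀ {t} x {r} → Above (exp (t *ℝ log x)) r →
      ∃₂ λ b d → ∃₂ λ n g → Above t b × Above (log x) d × g < 1ℚ × 1ℚ < r * (1ℚ - g) ^ suc n × b * d < suc n · g
    exp-above-split x (n , g , g<1 , (a , b , c , d , (_ , tb) , (_ , xd) , _ , _ , _ , bd) , 1<) =
      b , d , n , g , tb , xd , g<1 , 1< , bd

    scale-< : ∀ {A B a u v w} → suc B · a ≤ ⟦ suc A ⟧ → Pos a → Pos v → u < a * v → v ≤ w → suc B · u < suc A · w
    scale-< {A} {B} {a} {u} {v} {w} Ba≤ 0<a 0<v u<av v≤w = begin-strict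
      suc B · u ≡⟨ ⟦⟧-· (suc B) u ⟩
      ⟦ suc B ⟧ * u <⟨ *-monoʳ-<-pos ⟦ suc B ⟧ {{positive (⟦⟧-pos B)}} u<av ⟩
      ⟦ suc B ⟧ * (a * v) ≡⟨ *-assoc ⟦ suc B ⟧ a v ⟨
      ⟦ suc B ⟧ * a * v ≡⟨ cong (_* v) (⟦⟧-· (suc B) a) ⟨
      suc B · a * v ≤⟨ *-mono-≤₀ 0≤Ba 0≤w Ba≤ v≤w ⟩
      ⟦ suc A ⟧ * w ≡⟨ ⟦⟧-· (suc A) w ⟨
      suc A · w ∎
      where
      open ≤-Reasoning
      0≤w : NonNeg w
      0≤w = ≤-trans (<⇒≤ 0<v) v≤w
      0≤Ba : NonNeg (suc B · a)
      0≤Ba = ·-nonNeg (suc B) (<⇒≤ 0<a)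

  abstract
    -- Trades the real exponent t for fractions A / B: any fraction not below the approximation a <
    -- t will do. The base s < x is found by unfolding c < log x into e^c < s < x.
    exp-below-power : ∀ {t} (x : ℝ⁺) {r} → Below (log x) 0ℚ → Below (exp (t *ℝ log x)) r → 1ℚ ≤ r →
      ∃[ a ] Below t a × Pos a × (∀ A B → suc B · a ≤ ⟦ suc A ⟧ →
        ∃[ s ] Below (val x) s × Pos s × r ^ suc B ≤ s ^ suc A)
    exp-below-power {t} x {r} 0<log br 1≤r = go (exp-below-split {t} x {r} 0<log br 1≤r)
      where
      go : (∃₂ λ a c → ∃₂ λ n h → Below t a × Pos a × Pos c × Below (log x) c × - 1ℚ < h × r < (1ℚ + h) ^ suc n × suc n · h < a * c) →
           ∃[ a ] Below t a × Pos a × (∀ A B → suc B · a ≤ ⟦ suc A ⟧ →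
             ∃[ s ] Below (val x) s × Pos s × r ^ suc B ≤ s ^ suc A)
      go (a , c , n , h , ta , 0<a , 0<c , (s , above-s@(m , g , g<1 , c<mg , 1<) , below-s) , -1<h , r< , nh<ac) =
        a , ta , 0<a , λ A B Ba≤ → s , below-s , 0<s ,
          compare A B n m {h} {g} {r} {s} (≤-trans (<⇒≤ 0<1) 1≤r) (<⇒≤ 0<s) -1<h g<1 (<⇒≤ r<) (<⇒≤ 1<)
            (scale-< {A} {B} {a} {suc n · h} {c} {suc m · g} Ba≤ 0<a 0<c nh<ac (<⇒≤ c<mg))
        where
        0<s : Pos s
        0<s = above-pos (exp (fromℚ c) ,⁺ exp-pos (fromℚ c)) above-s

    exp-above-power : ∀ {t} (x : ℝ⁺) {r} → Below (log x) 0ℚ → Above (exp (t *ℝ log x)) r →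
      ∀ A B → (∀ b → Above t b → ⟦ suc A ⟧ ≤ suc B · b) →
      ∃[ s ] Above (val x) s × s ^ suc A ≤ r ^ suc B
    exp-above-power {t} x {r} 0<log ar A B A≤Bb = go (exp-above-split {t} x {r} ar)
      where
      go : (∃₂ λ b d → ∃₂ λ n g → Above t b × Above (log x) d × g < 1ℚ × 1ℚ < r * (1ℚ - g) ^ suc n × b * d < suc n · g) →
           ∃[ s ] Above (val x) s × s ^ suc A ≤ r ^ suc B
      go (b , d , n , g , tb , log-d@(s , above-s , (m , h , -1<h , mh<d , s<)) , g<1 , 1< , bd<ng) =
        s , above-s , compare B A m n {h} {g} {s} {r} (<⇒≤ (above-pos x above-s))
          (<⇒≤ (above-pos (exp (t *ℝ log x) ,⁺ exp-pos (t *ℝ log x)) ar)) -1<h g<1 (<⇒≤ s<) (<⇒≤ 1<) lt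
        where
        open ≤-Reasoning
        0<d : Pos d
        0<d = below<above (log x) 0<log log-d
        lt : suc A · (suc m · h) < suc B · (suc n · g)
        lt = begin-strict
          suc A · (suc m · h) ≡⟨ ⟦⟧-· (suc A) (suc m · h) ⟩
          ⟦ suc A ⟧ * (suc m · h) <⟨ *-monoʳ-<-pos ⟦ suc A ⟧ {{positive (⟦⟧-pos A)}} mh<d ⟩
          ⟦ suc A ⟧ * d ≤⟨ *-monoʳ-≤-nonNeg d {{nonNegative (<⇒≤ 0<d)}} (A≤Bb b tb) ⟩
          (suc B · b) * d ≡⟨ ·-*ʳ (suc B) b d ⟨
          suc B · (b * d) ≡⟨ ⟦⟧-· (suc B) (b * d) ⟩
          ⟦ suc B ⟧ * (b * d) <⟨ *-monoʳ-<-pos ⟦ suc B ⟧ {{positive (⟦⟧-pos B)}} bd<ng ⟩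
          ⟦ suc B ⟧ * (suc n · g) ≡⟨ ⟦⟧-· (suc B) (suc n · g) ⟨
          suc B · (suc n · g) ∎

    fromℕ-log-positive : ∀ p .{{_ : ℕ.NonZero p}} → 2 ℕ.≤ p → Below (log (fromℕ⁺ p)) 0ℚ
    fromℕ-log-positive p 2≤p = ½≼log 1 p 2≤p 0ℚ (*<* (ℤ.+<+ (ℕ.s≤s ℕ.z≤n)))

    power-upper : ∀ {t q} A B p .{{_ : ℕ.NonZero p}} → 2 ℕ.≤ p → Above t q → suc B · q ≤ ⟦ suc A ⟧ →
      ∀ L → fromℕ L ≤ℝ fromℕ⁺ p ^ℝ t → L ℕ.^ suc B ℕ.≤ p ℕ.^ suc A
    power-upper {t} {q} A B p 2≤p tq Bq≤ zero _ = ℕ.z≤n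
    power-upper {t} {q} A B p 2≤p tq Bq≤ L@(suc L-1) L≤ =
      ⟦⟧-cancel-≤ (subst₂ _≤_ (sym (⟦⟧-^ L (suc B))) (sym (⟦⟧-^ p (suc A))) (^-sup (suc B) {⟦ L ⟧} {⟦ p ⟧ ^ suc A} (⟦⟧-pos L-1) bound))
      where
      1≤p : 1ℚ ≤ ⟦ p ⟧
      1≤p = ≤-trans (≤-reflexive (sym (+-identityʳ 1ℚ))) (⟦⟧-mono-≤ (ℕ.≤-trans (ℕ.s≤s ℕ.z≤n) 2≤p))
      bound : ∀ r → Pos r → r < ⟦ L ⟧ → r ^ suc B ≤ ⟦ p ⟧ ^ suc A
      bound r 0<r r<L with ≤-or-≥ r 1ℚ
      ... | inj₁ r≤1 = ≤-trans (^-≤1 (suc B) (<⇒≤ 0<r) r≤1) (1≤^ (suc A) 1≤p)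
      ... | inj₂ 1≤r = finish (exp-below-power {t} (fromℕ⁺ p) {r} (fromℕ-log-positive p 2≤p) (L≤ r (≼-fromℕ L r r<L)) 1≤r)
        where
        finish : (∃[ a ] Below t a × Pos a × (∀ A B → suc B · a ≤ ⟦ suc A ⟧ →
          ∃[ s ] Below (fromℕ p) s × Pos s × r ^ suc B ≤ s ^ suc A)) → r ^ suc B ≤ ⟦ p ⟧ ^ suc A
        finish (a , ta , 0<a , f) = finish′ (f A B (≤-trans (·-mono-≤ (suc B) (<⇒≤ (below<above t ta tq))) Bq≤))
          where
          finish′ : (∃[ s ] Below (fromℕ p) s × Pos s × r ^ suc B ≤ s ^ suc A) → r ^ suc B ≤ ⟦ p ⟧ ^ suc A
          finish′ (s , s<p , 0<s , le) = ≤-trans le (^-mono-≤ (suc A) (<⇒≤ 0<s) (<⇒≤ (subst (s <_) (/1≡⟦⟧ p) s<p)))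

    -- Three approximations enter: log N ≥ l / 2, 1/ε ≥ (m + 1) / 4 and y < 2 + i.
    log-power-lower : ∀ (ε y : ℝ⁺) {b} m → Above (val ε) b → suc m · b ≤ ⟦ 4 ⟧ →
      ∀ N .{{_ : ℕ.NonTrivial N}} l → 2 ℕ.^ l ℕ.≤ N → log⁺ N ^ℝ (ε ⁻¹) ≤ℝ val y →
      ∀ i → Above (val y) ⟦ 2 ℕ.+ i ⟧ → l ℕ.^ suc m ℕ.≤ 2 ℕ.^ suc m ℕ.* (3 ℕ.+ i) ℕ.^ 4
    log-power-lower ε y {b} m εb mb≤4 N zero 2^l≤N le i yi = ℕ.z≤n
    log-power-lower ε y {b} m εb mb≤4 N l@(suc l-1) 2^l≤N le i yi =
      ⟦⟧-cancel-≤ (subst₂ _≤_ (trans (sym (^-distrib-* ⟦ 2 ⟧ (½ * ⟦ l ⟧) (suc m))) (trans (cong (_^ suc m) (twice ⟦ l ⟧)) (sym (⟦⟧-^ l (suc m)))))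
        (sym (trans (⟦⟧-* (2 ℕ.^ suc m) ((3 ℕ.+ i) ℕ.^ 4)) (cong₂ _*_ (⟦⟧-^ 2 (suc m)) (⟦⟧-^ (3 ℕ.+ i) 4))))
        (*-monoˡ-≤-nonNeg (⟦ 2 ⟧ ^ suc m) {{nonNegative (^-nonNeg (suc m) (⟦⟧-nonNeg 2))}}
          (^-sup (suc m) {½ * ⟦ l ⟧} {⟦ 3 ℕ.+ i ⟧ ^ 4} (_⊠_ {½} {⟦ l ⟧} 0<½ (⟦⟧-pos l-1)) bound)))
      where
      twice : ∀ x → ⟦ 2 ⟧ * (½ * x) ≡ x
      twice x = trans (sym (*-assoc ⟦ 2 ⟧ ½ x)) (*-identityˡ x)
      nonzero : ℕ.NonZero N
      nonzero = ℕ.nonTrivial⇒nonZero N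
      -- y < 2 + i bounds the power by 2 + i only non-strictly; locating it between 2 + i and 3 + i
      -- gives a strict upper bound at the price of 1.
      above : Above (log⁺ N ^ℝ (ε ⁻¹)) ⟦ 3 ℕ.+ i ⟧
      above = pick (ℝ.located (log⁺ N ^ℝ (ε ⁻¹)) (⟦⟧-mono-< (ℕ.n<1+n (2 ℕ.+ i))))
        where
        pick : Below (log⁺ N ^ℝ (ε ⁻¹)) ⟦ 2 ℕ.+ i ⟧ ⊎ Above (log⁺ N ^ℝ (ε ⁻¹)) ⟦ 3 ℕ.+ i ⟧ → Above (log⁺ N ^ℝ (ε ⁻¹)) ⟦ 3 ℕ.+ i ⟧
        pick (inj₁ bl) = ⊥-elim (ℝ.disjoint (val y) (le _ bl) yi)
        pick (inj₂ ab) = ab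
      inverse-bound : ∀ b′ → Above (ε ⁻¹) b′ → ⟦ suc m ⟧ ≤ 4 · b′
      inverse-bound b′ (r , εr , 0<r , 1<b′r) = <⇒≤ (*-cancelʳ-<-nonNeg r {{nonNegative (<⇒≤ 0<r)}} {⟦ suc m ⟧} {4 · b′} (begin-strict
        ⟦ suc m ⟧ * r ≤⟨ *-monoˡ-≤-nonNeg ⟦ suc m ⟧ {{nonNegative (⟦⟧-nonNeg (suc m))}} (<⇒≤ (below<above (val ε) εr εb)) ⟩
        ⟦ suc m ⟧ * b ≡⟨ ⟦⟧-· (suc m) b ⟨
        suc m · b ≤⟨ mb≤4 ⟩
        ⟦ 4 ⟧ ≡⟨ *-identityʳ ⟦ 4 ⟧ ⟨
        ⟦ 4 ⟧ * 1ℚ <⟨ *-monoʳ-<-pos ⟦ 4 ⟧ {{positive (⟦⟧-pos 3)}} 1<b′r ⟩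
        ⟦ 4 ⟧ * (b′ * r) ≡⟨ ⟦⟧-· 4 (b′ * r) ⟨
        4 · (b′ * r) ≡⟨ ·-*ʳ 4 b′ r ⟩
        (4 · b′) * r ∎))
        where open ≤-Reasoning
      bound : ∀ r → Pos r → r < ½ * ⟦ l ⟧ → r ^ suc m ≤ ⟦ 3 ℕ.+ i ⟧ ^ 4
      bound r 0<r r<l with 1ℚ <⊎≥ r
      ... | inj₂ r≤1 = ≤-trans (^-≤1 (suc m) (<⇒≤ 0<r) r≤1) (1≤^ 4 1≤3+i)
        where
        1≤3+i : 1ℚ ≤ ⟦ 3 ℕ.+ i ⟧
        1≤3+i = ≤-trans (≤-reflexive (sym (+-identityʳ 1ℚ))) (⟦⟧-mono-≤ {1} {3 ℕ.+ i} (ℕ.s≤s ℕ.z≤n))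
      ... | inj₁ 1<r = finish (exp-above-power {ε ⁻¹} (log⁺ N) {⟦ 3 ℕ.+ i ⟧} (log-positive (log⁺ N) x>r 1<r) above m 3 inverse-bound)
        where
        x>r : Below (val (log⁺ N)) r
        x>r = ½≼log l N {{nonzero}} 2^l≤N r r<l
        finish : (∃[ s ] Above (val (log⁺ N)) s × s ^ suc m ≤ ⟦ 3 ℕ.+ i ⟧ ^ 4) → r ^ suc m ≤ ⟦ 3 ℕ.+ i ⟧ ^ 4
        finish (s , x<s , le) = ≤-trans (^-mono-≤ (suc m) (<⇒≤ 0<r) (<⇒≤ (below<above (val (log⁺ N)) x>r x<s))) le

    -- Because p ≤ 2 y and t < 1, p^t ≤ 2^t y^t ≤ 2 y^t. In rational terms: if y^t < q′ < L / 2, a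
    -- fraction A / B < t below 1 yields (2 q′)^B ≤ 2^A q′^B, although A < B.
    power-double : ∀ {t} p .{{_ : ℕ.NonZero p}} (y : ℝ⁺) → 2 ℕ.≤ p → Below t 0ℚ → Above t 1ℚ → Below (log y) 0ℚ →
      (∀ s → Above (val y) s → ⟦ p ⟧ ≤ ⟦ 2 ⟧ * s) → ∀ L → fromℕ L ≤ℝ fromℕ⁺ p ^ℝ t → ½ * ⟦ L ⟧ ≼ y ^ℝ t
    power-double {t} p y 2≤p 0<t t<1 0<log p≤2y L L≤ q q< = go (dense q<)
      where
      go : (∃[ q′ ] q < q′ × q′ < ½ * ⟦ L ⟧) → Below (y ^ℝ t) q
      go (q′ , q<q′ , q′<) = pick (ℝ.located (y ^ℝ t) q<q′)
        where
        pick : Below (y ^ℝ t) q ⊎ Above (y ^ℝ t) q′ → Below (y ^ℝ t) q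
        pick (inj₁ b) = b
        pick (inj₂ above) = ⊥-elim (contra (exp-below-power {t} (fromℕ⁺ p) {r} (fromℕ-log-positive p 2≤p) (L≤ r (≼-fromℕ L r r<L)) 1≤r))
          where
          r : ℚ
          r = ⟦ 2 ⟧ * q′
          1≤q′ : 1ℚ ≤ q′
          1≤q′ with q′ <⊎≥ 1ℚ
          ... | inj₂ 1≤q′ = 1≤q′
          ... | inj₁ q′<1 = ⊥-elim (ℝ.disjoint (y ^ℝ t) (1≼exp {t *ℝ log y}
                (0≼-* {t} {log y} (≼-from-below {t} 0<t) (≼-from-below {log y} 0<log)) q′ q′<1) above)
          0≤q′ : NonNeg q′
          0≤q′ = ≤-trans (<⇒≤ 0<1) 1≤q′
          1≤r : 1ℚ ≤ r
          1≤r = *-mono-≤₀ {1ℚ} {⟦ 2 ⟧} {1ℚ} {q′} (<⇒≤ 0<1) 0≤q′ (≤-trans (≤-reflexive (sym (+-identityʳ 1ℚ))) (⟦⟧-mono-≤ {1} {2} (ℕ.s≤s ℕ.z≤n))) 1≤q′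
          r<L : r < ⟦ L ⟧
          r<L = subst (r <_) (trans (sym (*-assoc ⟦ 2 ⟧ ½ ⟦ L ⟧)) (*-identityˡ ⟦ L ⟧)) (*-monoʳ-<-pos ⟦ 2 ⟧ {{positive (⟦⟧-pos 1)}} q′<)
          contra : (∃[ a ] Below t a × Pos a × (∀ A B → suc B · a ≤ ⟦ suc A ⟧ →
            ∃[ s ] Below (fromℕ p) s × Pos s × r ^ suc B ≤ s ^ suc A)) → ⊥
          contra (a , ta , 0<a , f) = contra₁ (fraction 0<a)
            where
            contra₁ : (∃₂ λ A B → suc B · a ≡ ⟦ suc A ⟧) → ⊥
            contra₁ (A , B , Ba≡) = contra₂ (f A B (≤-reflexive Ba≡))
                (exp-above-power {t} y {q′} 0<log above A B λ b tb →
                  ≤-trans (≤-reflexive (sym Ba≡)) (·-mono-≤ (suc B) (<⇒≤ (below<above t ta tb))))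
              where
              A<B : suc A ℕ.< suc B
              A<B = ⟦⟧-cancel-< (begin-strict
                ⟦ suc A ⟧ ≡⟨ Ba≡ ⟨
                suc B · a ≡⟨ ⟦⟧-· (suc B) a ⟩
                ⟦ suc B ⟧ * a <⟨ *-monoʳ-<-pos ⟦ suc B ⟧ {{positive (⟦⟧-pos B)}} (below<above t ta t<1) ⟩
                ⟦ suc B ⟧ * 1ℚ ≡⟨ *-identityʳ ⟦ suc B ⟧ ⟩
                ⟦ suc B ⟧ ∎)
                where open ≤-Reasoning
              contra₂ : (∃[ s ] Below (fromℕ p) s × Pos s × r ^ suc B ≤ s ^ suc A) →
                        (∃[ s ] Above (val y) s × s ^ suc A ≤ q′ ^ suc B) → ⊥
              contra₂ (s , s<p , 0<s , le₁) (s₂ , y<s₂ , le₂) = <-irrefl refl (<-≤-trans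
                (⟦⟧-mono-< (ℕ.^-monoʳ-< 2 (ℕ.s≤s (ℕ.s≤s ℕ.z≤n)) A<B))
                (*-cancelʳ-≤-pos {⟦ 2 ℕ.^ suc B ⟧} {⟦ 2 ℕ.^ suc A ⟧} (q′ ^ suc B) {{positive (^-pos (suc B) (<-≤-trans 0<1 1≤q′))}} chain₂))
                where
                open ≤-Reasoning
                chain₂ : ⟦ 2 ℕ.^ suc B ⟧ * q′ ^ suc B ≤ ⟦ 2 ℕ.^ suc A ⟧ * q′ ^ suc B
                chain₂ = begin
                  ⟦ 2 ℕ.^ suc B ⟧ * q′ ^ suc B ≡⟨ cong (_* q′ ^ suc B) (⟦⟧-^ 2 (suc B)) ⟩
                  ⟦ 2 ⟧ ^ suc B * q′ ^ suc B ≡⟨ ^-distrib-* ⟦ 2 ⟧ q′ (suc B) ⟨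
                  r ^ suc B ≤⟨ le₁ ⟩
                  s ^ suc A ≤⟨ ^-mono-≤ (suc A) (<⇒≤ 0<s) (≤-trans (<⇒≤ (subst (s <_) (/1≡⟦⟧ p) s<p)) (p≤2y s₂ y<s₂)) ⟩
                  (⟦ 2 ⟧ * s₂) ^ suc A ≡⟨ ^-distrib-* ⟦ 2 ⟧ s₂ (suc A) ⟩
                  ⟦ 2 ⟧ ^ suc A * s₂ ^ suc A ≤⟨ *-monoˡ-≤-nonNeg (⟦ 2 ⟧ ^ suc A) {{nonNegative (^-nonNeg (suc A) (⟦⟧-nonNeg 2))}} le₂ ⟩
                  ⟦ 2 ⟧ ^ suc A * q′ ^ suc B ≡⟨ cong (_* q′ ^ suc B) (⟦⟧-^ 2 (suc A)) ⟨
                  ⟦ 2 ℕ.^ suc A ⟧ * q′ ^ suc B ∎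

    -- Whether i ≤ y is undecidable for a cut, but `located` decides between overlapping
    -- alternatives; hence brackets of width 2.
    between-naturals : ∀ (y : ℝ⁺) → ∃[ i ] Below (val y) ⟦ i ⟧ × Above (val y) ⟦ 2 ℕ.+ i ⟧
    between-naturals y = start (ℝ.above-inhabited (val y))
      where
      Goal : Set
      Goal = ∃[ i ] Below (val y) ⟦ i ⟧ × Above (val y) ⟦ 2 ℕ.+ i ⟧
      search : ∀ f i → Below (val y) ⟦ i ⟧ → Above (val y) ⟦ f ℕ.+ i ⟧ → Goal
      search zero i b a = ⊥-elim (ℝ.disjoint (val y) b a)
      search (suc f) i b a = next (ℝ.located (val y) (⟦⟧-mono-< (ℕ.n<1+n (suc i))))
        where
        next : Below (val y) ⟦ suc i ⟧ ⊎ Above (val y) ⟦ 2 ℕ.+ i ⟧ → Goal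
        next (inj₁ b′) = search f (suc i) b′ (subst (λ z → Above (val y) ⟦ z ⟧) (sym (ℕ.+-suc f i)) a)
        next (inj₂ a′) = i , b , a′
      start : ∃ (Above (val y)) → Goal
      start (u , yu) = start′ (below-ℕ u)
        where
        start′ : (∃[ M ] u < ⟦ M ⟧) → Goal
        start′ (M , u<M) = search M 0 (ℝ⁺.pos y) (subst (λ z → Above (val y) ⟦ z ⟧) (sym (ℕ.+-identityʳ M)) (ℝ.above-closed (val y) u<M yu))

    -- Rational approximation of the exponents and of the final factor.

    least-multiple : ∀ {a c} → Pos a → Pos c → ∀ n → c < n · a → ∃[ m ] c ≤ m · a × m · a < c + a
    least-multiple _ 0<c zero c<0 = ⊥-elim (<-asym 0<c c<0)
    least-multiple {a} {c} 0<a 0<c (suc n) c<a+na with n · a <⊎≥ c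
    ... | inj₁ na<c = suc n , <⇒≤ c<a+na , subst (_< c + a) (+-comm (n · a) a) (+-monoˡ-< a na<c)
    ... | inj₂ c≤na with c <⊎≥ (n · a)
    ...   | inj₁ c<na = least-multiple 0<a 0<c n c<na
    ...   | inj₂ na≤c = n , c≤na , ≤-<-trans na≤c (subst (_< c + a) (+-identityʳ c) (+-monoʳ-< c 0<a))

  abstract
    -- From a + δ > a₁ = 13 δ follows a > 12 δ, so b = a + δ is below 13/12 of a. The least multiple
    -- M a ≥ 3 is below 3 + a < 7/2, hence M b ≤ 7/2 · 13/12 < 4. Since 6 a < 3, M is at least 7.
    approximate-ε : ∀ (ε : ℝ⁺) → val ε <ℝ ½ℝ → ∃[ m ] ∃₂ λ a b →
      Below (val ε) a × Above (val ε) b × ⟦ 3 ⟧ ≤ (7 ℕ.+ m) · a × (7 ℕ.+ m) · b ≤ ⟦ 4 ⟧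
    approximate-ε ε (e , ε<e , e<½) = go (ℝ.below-open (val ε) (ℝ⁺.pos ε))
      where
      Goal : Set
      Goal = ∃[ m ] ∃₂ λ a b → Below (val ε) a × Above (val ε) b × ⟦ 3 ⟧ ≤ (7 ℕ.+ m) · a × (7 ℕ.+ m) · b ≤ ⟦ 4 ⟧
      go : (∃[ a₁ ] 0ℚ < a₁ × Below (val ε) a₁) → Goal
      go (a₁ , 0<a₁ , εa₁) = go₁ (approx (val ε) 0<δ)
        where
        δ : ℚ
        δ = + 1 / 13 * a₁
        0<δ : Pos δ
        0<δ = _⊠_ {+ 1 / 13} {a₁} (*<* (ℤ.+<+ (ℕ.s≤s ℕ.z≤n))) 0<a₁
        go₁ : (∃[ a ] Below (val ε) a × Above (val ε) (a + δ)) → Goal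
        go₁ (a , εa , εb) = go₂ (archimedean ⟦ 3 ⟧ 0<a)
          where
          12δ<a : + 12 / 1 * δ < a
          12δ<a = <-by (<-sub (below<above (val ε) εa₁ εb)) (eq a a₁)
            where
            eq : ∀ a a₁ → (a + + 1 / 13 * a₁) - a₁ ≡ a - + 12 / 1 * (+ 1 / 13 * a₁)
            eq = solve-∀ ringℚ
          0<a : Pos a
          0<a = <-trans (_⊠_ {+ 12 / 1} {δ} (*<* (ℤ.+<+ (ℕ.s≤s ℕ.z≤n))) 0<δ) 12δ<a
          a<½ : a < ½
          a<½ = <-trans (below<above (val ε) εa ε<e) e<½
          go₂ : (∃[ n ] ⟦ 3 ⟧ < n · a) → Goal
          go₂ (n , 3<na) = go₃ (least-multiple 0<a (⟦⟧-pos 2) n 3<na)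
            where
            go₃ : (∃[ m ] ⟦ 3 ⟧ ≤ m · a × m · a < ⟦ 3 ⟧ + a) → Goal
            go₃ (m , 3≤ma , ma<3+a) = m ℕ.∸ 7 , a , a + δ , εa , εb ,
              subst (λ k → ⟦ 3 ⟧ ≤ k · a) m≡ 3≤ma , subst (λ k → k · (a + δ) ≤ ⟦ 4 ⟧) m≡ mb≤4
              where
              open ≤-Reasoning
              7≤m : 7 ℕ.≤ m
              7≤m = ℕ.≮⇒≥ λ { (ℕ.s≤s m≤6) → <-irrefl refl (begin-strict
                ⟦ 3 ⟧ ≤⟨ 3≤ma ⟩
                m · a ≡⟨ ⟦⟧-· m a ⟩
                ⟦ m ⟧ * a ≤⟨ *-monoʳ-≤-nonNeg a {{nonNegative (<⇒≤ 0<a)}} (⟦⟧-mono-≤ m≤6) ⟩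
                ⟦ 6 ⟧ * a <⟨ *-monoʳ-<-pos ⟦ 6 ⟧ {{positive (⟦⟧-pos 5)}} a<½ ⟩
                ⟦ 6 ⟧ * ½ ≡⟨⟩
                ⟦ 3 ⟧ ∎) }
              m≡ : m ≡ 7 ℕ.+ (m ℕ.∸ 7)
              m≡ = sym (ℕ.m+[n∸m]≡n 7≤m)
              mb≤4 : m · (a + δ) ≤ ⟦ 4 ⟧
              mb≤4 = begin
                m · (a + δ) ≤⟨ ·-mono-≤ m {a + δ} {+ 13 / 12 * a} (≤-by (⟦⟧*≤ (≤-sub (<⇒≤ 12δ<a))) (eq₁ a a₁)) ⟩
                m · (+ 13 / 12 * a) ≡⟨ cong (m ·_) (*-comm (+ 13 / 12) a) ⟩
                m · (a * (+ 13 / 12)) ≡⟨ ·-*ʳ m a (+ 13 / 12) ⟩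
                (m · a) * (+ 13 / 12) ≤⟨ *-monoʳ-≤-nonNeg (+ 13 / 12) (<⇒≤ ma<3+a) ⟩
                (⟦ 3 ⟧ + a) * (+ 13 / 12) ≤⟨ *-monoʳ-≤-nonNeg (+ 13 / 12) (+-monoʳ-≤ ⟦ 3 ⟧ (<⇒≤ a<½)) ⟩
                (⟦ 3 ⟧ + ½) * (+ 13 / 12) ≤⟨ *≤* (ℤ.+≤+ (ℕ.≤ᵇ⇒≤ 91 96 _)) ⟩
                ⟦ 4 ⟧ ∎
                where
                ⟦⟧*≤ : ∀ {x} → NonNeg x → NonNeg (+ 1 / 12 * x)
                ⟦⟧*≤ {x} 0≤x = _⊠≤_ {+ 1 / 12} {x} (*≤* (ℤ.+≤+ ℕ.z≤n)) 0≤x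
                eq₁ : ∀ a a₁ → + 1 / 12 * (a - + 12 / 1 * (+ 1 / 13 * a₁)) ≡ + 13 / 12 * a - (a + + 1 / 13 * a₁)
                eq₁ = solve-∀ ringℚ

    exponent-positive : ∀ (ε : ℝ⁺) → val ε <ℝ ½ℝ → Below (½ℝ -ℝ val ε) 0ℚ
    exponent-positive ε (e , ε<e , e<½) = go (dense e<½)
      where
      inv : ∀ e → e ≡ - (- e)
      inv = solve-∀ ringℚ
      eq : ∀ r e → r - e ≡ (r + (- e)) - 0ℚ
      eq = solve-∀ ringℚ
      go : (∃[ r ] e < r × r < ½) → Below (½ℝ -ℝ val ε) 0ℚ
      go (r , e<r , r<½) = r , - e , r<½ , subst (Above (val ε)) (inv e) ε<e , <-by (<-sub e<r) (eq r e)

    exponent-above : ∀ (ε : ℝ⁺) {a} → Below (val ε) a → Above (½ℝ -ℝ val ε) (½ - a)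
    exponent-above ε {a} εa = go (ℝ.below-open (val ε) εa)
      where
      inv : ∀ e → e ≡ - (- e)
      inv = solve-∀ ringℚ
      eq₁ : ∀ r a → ½ * (r - a) ≡ (½ + ½ * (r - a)) - ½
      eq₁ = solve-∀ ringℚ
      eq₂ : ∀ r a → ½ * (r - a) ≡ (½ - a) - ((½ + ½ * (r - a)) + (- r))
      eq₂ = solve-∀ ringℚ
      go : (∃[ r ] a < r × Below (val ε) r) → Above (½ℝ -ℝ val ε) (½ - a)
      go (r , a<r , εr) = ½ + ½ * (r - a) , - r , <-by (Pos-½ (<-sub a<r)) (eq₁ r a) ,
        subst (Below (val ε)) (inv r) εr , <-by (Pos-½ (<-sub a<r)) (eq₂ r a)

    exponent-below-1 : ∀ (ε : ℝ⁺) → Above (½ℝ -ℝ val ε) 1ℚ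
    exponent-below-1 ε = ℝ.above-closed (½ℝ -ℝ val ε) {½ - 0ℚ} {1ℚ} (*<* (ℤ.+<+ (ℕ.<ᵇ⇒< 1 2 _))) (exponent-above ε (ℝ⁺.pos ε))

    -- With M = 7 + m the exponent is 2 M (1/2 - a) = M - 2 M a ≤ M - 6 = m + 1.
    length-power : ∀ (ε : ℝ⁺) {a} m → Below (val ε) a → ⟦ 3 ⟧ ≤ (7 ℕ.+ m) · a →
      ∀ p .{{_ : ℕ.NonZero p}} → 2 ℕ.≤ p → ∀ L → fromℕ L ≤ℝ fromℕ⁺ p ^ℝ (½ℝ -ℝ val ε) →
      L ℕ.^ (2 ℕ.* (7 ℕ.+ m)) ℕ.≤ p ℕ.^ suc m
    length-power ε {a} m εa 3≤ p 2≤p L L≤ =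
      power-upper {½ℝ -ℝ val ε} {½ - a} m (6 ℕ.+ m ℕ.+ (7 ℕ.+ m ℕ.+ 0)) p 2≤p (exponent-above ε εa) B≤A L L≤
      where
      B≤A : (2 ℕ.* (7 ℕ.+ m)) · (½ - a) ≤ ⟦ suc m ⟧
      B≤A = ≤-trans (≤-reflexive (trans (⟦⟧-· (2 ℕ.* (7 ℕ.+ m)) (½ - a)) (cong (_* (½ - a)) (⟦⟧-* 2 (7 ℕ.+ m)))))
        (≤-by (_⊠≤_ {⟦ 2 ⟧} {⟦ 7 ℕ.+ m ⟧ * a - ⟦ 3 ⟧} (⟦⟧-nonNeg 2) (≤-sub (subst (⟦ 3 ⟧ ≤_) (⟦⟧-· (7 ℕ.+ m) a) 3≤)))
          (trans (cong (λ z → ⟦ 2 ⟧ * (z * a - ⟦ 3 ⟧)) (⟦⟧-+ 6 (suc m)))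
            (trans (eq ⟦ suc m ⟧ a) (cong (λ z → ⟦ suc m ⟧ - ⟦ 2 ⟧ * z * (½ - a)) (sym (⟦⟧-+ 6 (suc m)))))))
        where
        eq : ∀ M a → ⟦ 2 ⟧ * ((⟦ 6 ⟧ + M) * a - ⟦ 3 ⟧) ≡ M - ⟦ 2 ⟧ * (⟦ 6 ⟧ + M) * (½ - a)
        eq = solve-∀ ringℚ

    inverse-lower : ∀ (ε : ℝ⁺) {b} m → Above (val ε) b → m · b ≤ ⟦ 4 ⟧ → ∃[ v ] Pos v × v ≼ ε ⁻¹ × ⟦ m ⟧ ≤ ⟦ 4 ⟧ * v
    inverse-lower ε {b} m εb mb≤4 = go (recip 0<b)
      where
      0<b : Pos b
      0<b = above-pos ε εb
      go : (∃[ v ] Pos v × v * b ≡ 1ℚ) → ∃[ v ] Pos v × v ≼ ε ⁻¹ × ⟦ m ⟧ ≤ ⟦ 4 ⟧ * v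
      go (v , 0<v , vb) = v , 0<v , (λ q q<v → b , εb , subst (q * b <_) vb (*-monoˡ-<-pos b {{positive 0<b}} q<v)) ,
        *-cancelʳ-≤-pos {⟦ m ⟧} {⟦ 4 ⟧ * v} b {{positive 0<b}} (≤-trans (≤-reflexive (sym (⟦⟧-· m b)))
          (≤-trans mb≤4 (≤-reflexive (sym (trans (*-assoc ⟦ 4 ⟧ v b) (trans (cong (⟦ 4 ⟧ *_) vb) (*-identityʳ ⟦ 4 ⟧)))))))

    -- log k ≥ κ / 2 and 1/ε ≥ m / 4 bring the inner exponent above U + 1, and then e ≥ 2 is used
    -- twice. The exponent loses 1 because `2^≼exp` consumes a strict bound, while e^z ≥ 2^(U + 1)
    -- is non-strict.
    double-exp-lower : ∀ (ε : ℝ⁺) {b} m → Above (val ε) b → m · b ≤ ⟦ 4 ⟧ → ∀ c k κ U .{{_ : ℕ.NonZero k}} .{{_ : ℕ.NonZero (suc c)}} →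
      1 ℕ.≤ κ → 2 ℕ.^ κ ℕ.≤ k → 8 ℕ.* suc U ℕ.< suc c ℕ.* k ℕ.* κ ℕ.* m →
      ⟦ 2 ℕ.^ (2 ℕ.^ suc U ℕ.∸ 1) ⟧ ≼ exp (exp (val (fromℕ⁺ (suc c)) *ℝ (fromℕ k *ℝ log (fromℕ⁺ k)) *ℝ ε ⁻¹))
    double-exp-lower ε {b} m εb mb≤4 c k@(suc k-1) κ@(suc κ-1) U 1≤κ 2^κ≤k lt = go (inverse-lower ε m εb mb≤4)
      where
      z : ℝ
      z = val (fromℕ⁺ (suc c)) *ℝ (fromℕ k *ℝ log (fromℕ⁺ k)) *ℝ ε ⁻¹
      2^U-1 : ∃[ u ] 2 ℕ.^ suc U ℕ.∸ 1 ≡ suc u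
      2^U-1 = 2 ℕ.^ suc U ℕ.∸ 2 , ℕ.+-∸-assoc 1 {2 ℕ.^ suc U} {2} (ℕ.*-monoʳ-≤ 2 (ℕ.m^n>0 2 U))
      finish : Below z ⟦ suc U ⟧ → (∃[ u ] 2 ℕ.^ suc U ℕ.∸ 1 ≡ suc u) → ⟦ 2 ℕ.^ (2 ℕ.^ suc U ℕ.∸ 1) ⟧ ≼ exp (exp z)
      finish bz (u , e) = subst (λ w → ⟦ 2 ℕ.^ w ⟧ ≼ exp (exp z)) (sym e) (2^≼exp {exp z} u
        (2^≼exp {z} U bz ⟦ suc u ⟧ (⟦⟧-mono-< (ℕ.≤-reflexive (trans (cong suc (sym e)) (ℕ.m+[n∸m]≡n (ℕ.m^n>0 2 (suc U))))))))
      go : (∃[ v ] Pos v × v ≼ ε ⁻¹ × ⟦ m ⟧ ≤ ⟦ 4 ⟧ * v) → ⟦ 2 ℕ.^ (2 ℕ.^ suc U ℕ.∸ 1) ⟧ ≼ exp (exp z)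
      go (v , 0<v , v≼ , m≤4v) = finish (lower ⟦ suc U ⟧ U<) 2^U-1
        where
        w₁ : ℚ
        w₁ = ½ * ⟦ κ ⟧
        0<w₁ : Pos w₁
        0<w₁ = _⊠_ {½} {⟦ κ ⟧} 0<½ (⟦⟧-pos κ-1)
        lower : ⟦ suc c ⟧ * (⟦ k ⟧ * w₁) * v ≼ z
        lower = ≼-*-pos {val (fromℕ⁺ (suc c)) *ℝ (fromℕ k *ℝ log (fromℕ⁺ k))} {ε ⁻¹}
          (_⊠_ {⟦ suc c ⟧} {⟦ k ⟧ * w₁} (⟦⟧-pos c) (_⊠_ {⟦ k ⟧} {w₁} (⟦⟧-pos k-1) 0<w₁)) 0<v
          (≼-*-pos {fromℕ (suc c)} {fromℕ k *ℝ log (fromℕ⁺ k)} (⟦⟧-pos c) (_⊠_ {⟦ k ⟧} {w₁} (⟦⟧-pos k-1) 0<w₁) (≼-fromℕ (suc c))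
            (≼-*-pos {fromℕ k} {log (fromℕ⁺ k)} (⟦⟧-pos k-1) 0<w₁ (≼-fromℕ k) (½≼log κ k 2^κ≤k))) v≼
        open ≤-Reasoning
        U< : ⟦ suc U ⟧ < ⟦ suc c ⟧ * (⟦ k ⟧ * w₁) * v
        U< = *-cancelˡ-<-nonNeg ⟦ 8 ⟧ {{nonNegative (⟦⟧-nonNeg 8)}} (begin-strict
          ⟦ 8 ⟧ * ⟦ suc U ⟧ ≡⟨ ⟦⟧-* 8 (suc U) ⟨
          ⟦ 8 ℕ.* suc U ⟧ <⟨ ⟦⟧-mono-< lt ⟩
          ⟦ suc c ℕ.* k ℕ.* κ ℕ.* m ⟧ ≡⟨ ⟦⟧-* (suc c ℕ.* k ℕ.* κ) m ⟩
          ⟦ suc c ℕ.* k ℕ.* κ ⟧ * ⟦ m ⟧ ≤⟨ *-monoˡ-≤-nonNeg ⟦ suc c ℕ.* k ℕ.* κ ⟧ {{nonNegative (⟦⟧-nonNeg (suc c ℕ.* k ℕ.* κ))}} m≤4v ⟩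
          ⟦ suc c ℕ.* k ℕ.* κ ⟧ * (⟦ 4 ⟧ * v) ≡⟨ cong (_* (⟦ 4 ⟧ * v)) (trans (⟦⟧-* (suc c ℕ.* k) κ) (cong (_* ⟦ κ ⟧) (⟦⟧-* (suc c) k))) ⟩
          ⟦ suc c ⟧ * ⟦ k ⟧ * ⟦ κ ⟧ * (⟦ 4 ⟧ * v) ≡⟨ eq ⟦ suc c ⟧ ⟦ k ⟧ ⟦ κ ⟧ v ⟩
          ⟦ 8 ⟧ * (⟦ suc c ⟧ * (⟦ k ⟧ * w₁) * v) ∎)
          where
          eq : ∀ c k κ v → c * k * κ * (⟦ 4 ⟧ * v) ≡ ⟦ 8 ⟧ * (c * (k * (½ * κ)) * v)
          eq = solve-∀ ringℚ

    -- Meant for k = 1, where log k = 0 and the factor is e^(e^0) = e.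
    double-exp-≥2 : ∀ (ε : ℝ⁺) c k .{{_ : ℕ.NonZero k}} →
      ⟦ 2 ⟧ ≼ exp (exp (val (fromℕ⁺ (suc c)) *ℝ (fromℕ k *ℝ log (fromℕ⁺ k)) *ℝ ε ⁻¹))
    double-exp-≥2 ε c k q q<2 =
      -- (1 + 9/20)² = 841/400 > 2, so it is enough that e^z > 9/10; this follows from z > - 1/20
      -- and 1 - 1/20 = 19/20.
      1 , + 9 / 20 , *<* ℤ.-<+ ,
        (0 , - (+ 1 / 20) , *<* (ℤ.-<- (ℕ.<ᵇ⇒< 0 19 _)) , 0≼z _ (*<* ℤ.-<+) , *<* (ℤ.+<+ (ℕ.<ᵇ⇒< 180 190 _))) ,
        <-trans q<2 (*<* (ℤ.+<+ (ℕ.<ᵇ⇒< 800 841 _)))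
      where
      0≼fromℕ : ∀ n → 0ℚ ≼ fromℕ n
      0≼fromℕ n q q<0 = ≼-fromℕ n q (<-≤-trans q<0 (⟦⟧-nonNeg n))
      0≼log : 0ℚ ≼ log (fromℕ⁺ k)
      0≼log q q<0 = ½≼log 0 k (ℕ.>-nonZero⁻¹ k) q q<0
      0≼inverse : 0ℚ ≼ ε ⁻¹
      0≼inverse q q<0 = go (ℝ.above-inhabited (val ε))
        where
        go : ∃ (Above (val ε)) → Below (ε ⁻¹) q
        go (u , εu) = u , εu , <-trans (subst (q * u <_) (*-zeroˡ u) (*-monoˡ-<-pos u {{positive (above-pos ε εu)}} q<0)) 0<1
      z : ℝ
      z = val (fromℕ⁺ (suc c)) *ℝ (fromℕ k *ℝ log (fromℕ⁺ k)) *ℝ ε ⁻¹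
      0≼z : 0ℚ ≼ z
      0≼z = 0≼-* {val (fromℕ⁺ (suc c)) *ℝ (fromℕ k *ℝ log (fromℕ⁺ k))} {ε ⁻¹}
        (0≼-* {fromℕ (suc c)} {fromℕ k *ℝ log (fromℕ⁺ k)} (0≼fromℕ (suc c)) (0≼-* {fromℕ k} {log (fromℕ⁺ k)} (0≼fromℕ k) 0≼log)) 0≼inverse

    -- The 2 in `2 * F` compensates for the half in `½ * ⟦ L ⟧`, which is the loss of
    -- `power-double`.
    product-bound : ∀ {E Y} {l F L} → 1 ℕ.≤ F → 1 ℕ.≤ L → l ℕ.≤ F ℕ.* L → ⟦ 2 ℕ.* F ⟧ ≼ E → ½ * ⟦ L ⟧ ≼ Y → fromℕ l ≤ℝ E *ℝ Y
    product-bound {E} {Y} {l} {suc F-1} {suc L-1} _ _ l≤FL F≼E L≼Y =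
      fromℕ≤ {l} {E *ℝ Y} λ q q<l → ≼-*-pos {E} {Y} (⟦⟧-pos (F-1 ℕ.+ (F ℕ.+ 0))) (_⊠_ {½} {⟦ L ⟧} 0<½ (⟦⟧-pos L-1)) F≼E L≼Y q
        (<-≤-trans q<l (≤-trans (⟦⟧-mono-≤ l≤FL) (≤-reflexive FL≡)))
      where
      F L : ℕ
      F = suc F-1
      L = suc L-1
      eq : ∀ F L → F * L ≡ (⟦ 2 ⟧ * F) * (½ * L)
      eq = solve-∀ ringℚ
      FL≡ : ⟦ F ℕ.* L ⟧ ≡ ⟦ 2 ℕ.* F ⟧ * (½ * ⟦ L ⟧)
      FL≡ = trans (⟦⟧-* F L) (trans (eq ⟦ F ⟧ ⟦ L ⟧) (cong (_* (½ * ⟦ L ⟧)) (sym (⟦⟧-* 2 F))))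

    ≤-natural : ∀ {y i p} → Above y ⟦ i ⟧ → i ℕ.≤ p → y ≤ℝ fromℕ p
    ≤-natural {y} {i} {p} yi i≤p q yq = subst (q <_) (sym (/1≡⟦⟧ p)) (<-≤-trans (below<above y yq yi) (⟦⟧-mono-≤ i≤p))

    natural-≤-2* : ∀ {y i p} → 1 ℕ.≤ i → Below y ⟦ i ⟧ → p ℕ.≤ 2 ℕ.* i → fromℕ p ≤ℝ fromℕ 2 *ℝ y
    natural-≤-2* {y} {suc i} {p} _ yi p≤ = fromℕ≤ {p} {fromℕ 2 *ℝ y} λ q q<p →
      ≼-*-pos {fromℕ 2} {y} (⟦⟧-pos 1) (⟦⟧-pos i) (≼-fromℕ 2) (≼-from-below {y} yi) q
        (<-≤-trans q<p (≤-trans (⟦⟧-mono-≤ p≤) (≤-reflexive (⟦⟧-* 2 (suc i)))))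

    natural-≤-2*-above : ∀ {y i p} → Below y ⟦ i ⟧ → p ℕ.≤ 2 ℕ.* i → ∀ s → Above y s → ⟦ p ⟧ ≤ ⟦ 2 ⟧ * s
    natural-≤-2*-above {y} {i} {p} yi p≤ s ys = ≤-trans (⟦⟧-mono-≤ p≤) (≤-trans (≤-reflexive (⟦⟧-* 2 i))
      (*-monoˡ-≤-nonNeg ⟦ 2 ⟧ {{nonNegative (⟦⟧-nonNeg 2)}} (<⇒≤ (below<above y yi ys))))

    natural-log-positive : ∀ (y : ℝ⁺) {i} → 2 ℕ.≤ i → Below (val y) ⟦ i ⟧ → Below (log y) 0ℚ
    natural-log-positive y {i} 2≤i yi = log-positive y yi (⟦⟧-mono-< {1} 2≤i)

    1≼power : ∀ {t} (y : ℝ⁺) → Below t 0ℚ → Below (log y) 0ℚ → ⟦ 1 ⟧ ≼ y ^ℝ t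
    1≼power {t} y 0<t 0<log = 1≼exp {t *ℝ log y} (0≼-* {t} {log y} (≼-from-below {t} 0<t) (≼-from-below {log y} 0<log))

    ≼-mono : ∀ {x u v} → u ≤ v → v ≼ x → u ≼ x
    ≼-mono u≤v v≼x q q<u = v≼x q (<-≤-trans q<u u≤v)

    ⟦⟧≼-mono : ∀ {x m n} → m ℕ.≤ n → ⟦ n ⟧ ≼ x → ⟦ m ⟧ ≼ x
    ⟦⟧≼-mono {x} m≤n = ≼-mono {x} (⟦⟧-mono-≤ m≤n)

    natural-<-fromℕ : ∀ {y i N} → Below y ⟦ i ⟧ → y ≤ℝ fromℕ N → i ℕ.< N
    natural-<-fromℕ {y} {i} {N} yi y≤N = ⟦⟧-cancel-< (subst (⟦ i ⟧ <_) (/1≡⟦⟧ N) (y≤N ⟦ i ⟧ yi))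

module Arithmetic where
  open import Data.Empty using (⊥-elim; ⊥)
  open import Data.Fin.Base as Fin using (Fin; zero; suc)
  open import Data.List.Base using (List; []; _∷_; length; filter; downFrom)
  open import Data.List.Membership.Propositional.Properties using (∈-filter⁻; ∈-downFrom⁻)
  open import Data.List.Properties using (filter-accept; filter-reject)
  open import Data.List.Relation.Unary.All as All using (All; []; _∷_)
  import Data.List.Relation.Unary.All.Properties as All
  open import Data.List.Relation.Unary.AllPairs using ([]; _∷_)
  open import Data.List.Relation.Unary.Any using (here; there; any?)
  open import Data.List.Relation.Unary.Unique.Propositional using (Unique)
  open import Data.List.Relation.Unary.Unique.Propositional.Properties using (filter⁺; downFrom⁺)
  open import Data.Nat.Base
  open import Data.Nat.Combinatorics using (_C_; nCk≡n!/k![n-k]!; k![n∸k]!∣n!)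
  open import Data.Nat.DivMod using (m≡m%n+[m/n]*n; m%n<n; m/n*n≡m; m/n<m; m/n*n≤m)
  open import Data.Nat.Divisibility
  open import Data.Nat.Induction using (<-wellFounded)
  open import Data.Nat.ListAction using (product)
  open import Data.Nat.Primality
  open import Data.Nat.Primality.Factorisation using (factorise)
  open import Data.Nat.Properties
  open import Data.Nat.Tactic.RingSolver using (solve-∀)
  open import Data.Product.Base using (∃; _×_; _,_; proj₁; proj₂; ∃₂)
  open import Data.Sum.Base using (inj₁; inj₂; _⊎_)
  open import Induction.WellFounded using (Acc; acc)
  open import Level using (0ℓ)
  open import Relation.Binary.PropositionalEquality
  open import Relation.Nullary.Decidable using (Dec; yes; no; ¬?; _×-dec_)
  open import Relation.Nullary.Negation using (¬_; contradiction)
  open import Relation.Unary using (Pred; Decidable; _⊆_)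

  -- Counting in lists.

  module _ {A : Set} where

    count : {P : Pred A 0ℓ} → Decidable P → List A → ℕ
    count P? xs = length (filter P? xs)

    module _ {P : Pred A 0ℓ} (P? : Decidable P) where

      count+count¬≡length : ∀ xs → count P? xs + count (λ x → ¬? (P? x)) xs ≡ length xs
      count+count¬≡length [] = refl
      count+count¬≡length (x ∷ xs) with P? x
      ... | yes _ = cong suc (count+count¬≡length xs)
      ... | no  _ = trans (+-suc _ _) (cong suc (count+count¬≡length xs))

      count-none : (∀ x → ¬ P x) → ∀ xs → count P? xs ≡ 0
      count-none ¬P [] = refl
      count-none ¬P (x ∷ xs) with P? x
      ... | yes p = ⊥-elim (¬P x p)
      ... | no  _ = count-none ¬P xs

      count-filter-≤ : {R : Pred A 0ℓ} (R? : Decidable R) → ∀ xs → count P? (filter R? xs) ≤ count P? xs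
      count-filter-≤ R? [] = z≤n
      count-filter-≤ R? (x ∷ xs) with R? x
      ... | yes _ with P? x
      ...   | yes _ = s≤s (count-filter-≤ R? xs)
      ...   | no  _ = count-filter-≤ R? xs
      count-filter-≤ R? (x ∷ xs) | no _ with P? x
      ...   | yes _ = m≤n⇒m≤1+n (count-filter-≤ R? xs)
      ...   | no  _ = count-filter-≤ R? xs

      count-mono : {R : Pred A 0ℓ} (R? : Decidable R) → P ⊆ R → ∀ xs → count P? xs ≤ count R? xs
      count-mono R? P⊆R [] = z≤n
      count-mono R? P⊆R (x ∷ xs) with P? x | R? x
      ... | yes p | yes _ = s≤s (count-mono R? P⊆R xs)
      ... | yes p | no ¬r = ⊥-elim (¬r (P⊆R p))
      ... | no  _ | yes _ = m≤n⇒m≤1+n (count-mono R? P⊆R xs)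
      ... | no  _ | no  _ = count-mono R? P⊆R xs

    count¬-> : {P : Pred A 0ℓ} (P? : Decidable P) → ∀ xs {b c} → count P? xs ≤ b → c + b < length xs →
               c < count (λ x → ¬? (P? x)) xs
    count¬-> P? xs {b} {c} P≤b lt = +-cancelˡ-< (count P? xs) c _ (begin-strict
      count P? xs + c ≤⟨ +-monoˡ-≤ c P≤b ⟩
      b + c ≡⟨ +-comm b c ⟩
      c + b <⟨ lt ⟩
      length xs ≡⟨ count+count¬≡length P? xs ⟨
      _ ∎)
      where open ≤-Reasoning

    count-any-≤ : {B : Set} {R : B → A → Set} (R? : ∀ b a → Dec (R b a)) (bs : List B) (xs : List A) {r : ℕ} →
      (∀ b → count (R? b) xs ≤ r) → count (λ x → any? (λ b → R? b x) bs) xs ≤ length bs * r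
    count-any-≤ {R = R} R? [] xs each = none xs
      where
      none : ∀ xs → count (λ x → any? (λ b → R? b x) []) xs ≤ 0
      none [] = z≤n
      none (x ∷ xs) = none xs
    count-any-≤ {R = R} R? (b ∷ bs) xs {r} each =
      ≤-trans (union xs) (+-mono-≤ (each b) (count-any-≤ R? bs xs each))
      where
      union : ∀ xs → count (λ x → any? (λ b → R? b x) (b ∷ bs)) xs ≤
                     count (R? b) xs + count (λ x → any? (λ b → R? b x) bs) xs
      union [] = z≤n
      union (x ∷ xs) with any? (λ b → R? b x) (b ∷ bs) | R? b x | any? (λ b → R? b x) bs
      ... | yes _ | yes _ | yes _ = s≤s (≤-trans (union xs) (+-monoʳ-≤ (count (R? b) xs) (n≤1+n _)))
      ... | yes _ | yes _ | no _  = s≤s (union xs)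
      ... | yes _ | no _  | yes _ = ≤-trans (s≤s (union xs)) (≤-reflexive (sym (+-suc _ _)))
      ... | yes (here r)  | no ¬r | no _  = ⊥-elim (¬r r)
      ... | yes (there a) | no _  | no ¬a = ⊥-elim (¬a a)
      ... | no ¬a | yes r | _     = ⊥-elim (¬a (here r))
      ... | no ¬a | no _ | yes a  = ⊥-elim (¬a (there a))
      ... | no _ | no _ | no _    = union xs

    pigeonhole-cover : ∀ k {P : Fin k → A → Set} (P? : ∀ i → Decidable (P i)) c xs →
      All (λ x → ∃ λ i → P i x) xs → k * c < length xs → ∃ λ i → c < count (P? i) xs
    pigeonhole-cover zero P? c (x ∷ xs) ((() , _) ∷ _) lt
    pigeonhole-cover (suc k) {P} P? c xs covered lt with c <? count (P? zero) xs
    ... | yes c< = zero , c<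
    ... | no c≮ =
      let ys = filter (λ x → ¬? (P? zero x)) xs
          i , c<i = pigeonhole-cover k (λ i → P? (suc i)) c ys
            (All.zipWith others (All.all-filter (λ x → ¬? (P? zero x)) xs , All.filter⁺ (λ x → ¬? (P? zero x)) covered))
            (count¬-> (P? zero) xs (≮⇒≥ c≮) (subst (_< length xs) (+-comm c (k * c)) lt))
      in suc i , <-≤-trans c<i (count-filter-≤ (P? (suc i)) (λ x → ¬? (P? zero x)) xs)
      where
      others : ∀ {x} → ¬ P zero x × (∃ λ i → P i x) → ∃ λ i → P (suc i) x
      others (¬p , zero , p)  = ⊥-elim (¬p p)
      others (¬p , suc i , p) = i , p

  -- Prime divisors and the valuation of factorials.

  prime∤1 : ∀ {p} → Prime p → ¬ p ∣ 1
  prime∤1 p-prime p∣1 = ¬prime[1] (subst Prime (∣1⇒≡1 p∣1) p-prime)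

  prime∣prime⇒≡ : ∀ {p q} → Prime p → Prime q → p ∣ q → p ≡ q
  prime∣prime⇒≡ pp pq p∣q with prime⇒irreducible pq p∣q
  ... | inj₁ refl = ⊥-elim (¬prime[1] pp)
  ... | inj₂ e = e

  product-primes-∣ : ∀ {ps} → Unique ps → All Prime ps → ∀ {X} → All (_∣ X) ps → product ps ∣ X
  product-primes-∣ [] [] [] = 1∣ _
  product-primes-∣ {p ∷ ps} (p∉ ∷ u) (pp ∷ pps) {X} (divides Y refl ∷ rest) =
    subst (p * product ps ∣_) (*-comm p Y) (*-monoʳ-∣ p (product-primes-∣ u pps (cancel p∉ pps rest)))
    where
    cancel : ∀ {qs} → All (p ≢_) qs → All Prime qs → All (_∣ Y * p) qs → All (_∣ Y) qs
    cancel [] [] [] = []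
    cancel (p≢q ∷ p≢) (pq ∷ pqs) (q∣ ∷ qs∣) with euclidsLemma Y p pq q∣
    ... | inj₁ q∣Y = q∣Y ∷ cancel p≢ pqs qs∣
    ... | inj₂ q∣p = ⊥-elim (p≢q (sym (prime∣prime⇒≡ pq pp q∣p)))

  ^-length≤product : ∀ {n ps} → All (n ≤_) ps → n ^ length ps ≤ product ps
  ^-length≤product [] = s≤s z≤n
  ^-length≤product (n≤p ∷ n≤) = *-mono-≤ n≤p (^-length≤product n≤)

  -- The product of distinct prime divisors divides X, and r + 1 of them, each at least n, would
  -- already have a product exceeding X.
  count-primes-∣ : ∀ {n ps r} X → Unique ps → All Prime ps → All (n ≤_) ps → .{{_ : NonZero X}} →
    X < n ^ suc r → count (_∣? X) ps ≤ r
  count-primes-∣ {n} {ps} {r} X u pps n≤ X< = ≮⇒≥ λ r<c → <-irrefl refl (begin-strict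
    X <⟨ X< ⟩
    n ^ suc r ≤⟨ ^-monoʳ-≤ n {{n≢0}} r<c ⟩
    n ^ count (_∣? X) ps ≤⟨ ^-length≤product (All.filter⁺ (_∣? X) n≤) ⟩
    product (filter (_∣? X) ps) ≤⟨ ∣⇒≤ (product-primes-∣ (filter⁺ (_∣? X) u) (All.filter⁺ (_∣? X) pps) (All.all-filter (_∣? X) ps)) ⟩
    X ∎)
    where
    open ≤-Reasoning
    n≢0 : NonZero n
    n≢0 = ≢-nonZero λ { refl → contradiction X< λ () }

  ^-cancelʳ-≤ : ∀ m {a b} → 1 < m → m ^ a ≤ m ^ b → a ≤ b
  ^-cancelʳ-≤ m 1<m le = ≮⇒≥ λ b<a → <⇒≱ (^-monoʳ-< m 1<m b<a) le

  ^-cancelʳ-< : ∀ m {a b} .{{_ : NonZero m}} → m ^ a < m ^ b → a < b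
  ^-cancelʳ-< m lt = ≰⇒> λ b≤a → <⇒≱ lt (^-monoʳ-≤ m b≤a)

  prime≥2 : ∀ {p} → Prime p → 2 ≤ p
  prime≥2 p-prime = nonTrivial⇒n>1 _ {{prime⇒nonTrivial p-prime}}

  prime∣!⇒≤ : ∀ {p} → Prime p → ∀ n → p ∣ n ! → p ≤ n
  prime∣!⇒≤ p-prime zero    p∣ = ⊥-elim (prime∤1 p-prime p∣)
  prime∣!⇒≤ p-prime (suc n) p∣ with euclidsLemma (suc n) (n !) p-prime p∣
  ... | inj₁ p∣s = ∣⇒≤ p∣s
  ... | inj₂ p∣n = m≤n⇒m≤1+n (prime∣!⇒≤ p-prime n p∣n)

  m∣m! : ∀ {m} → 1 ≤ m → ∀ {n} → m ≤ n → m ∣ n !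
  m∣m! {suc m} _ {n} m≤n = ∣-trans (∣m⇒∣m*n (m !) ∣-refl) (m≤n⇒m!∣n! m≤n)

  module Valuation {p : ℕ} (p-prime : Prime p) where
    instance
      p≢0 : NonZero p
      p≢0 = prime⇒nonZero p-prime

    -- p ^ v is the exact power of p in x.
    record V (x v : ℕ) : Set where
      constructor exactly
      field
        cofactor      : ℕ
        factorisation : x ≡ p ^ v * cofactor
        p∤cofactor    : ¬ p ∣ cofactor

    V-unit : ∀ {x} → ¬ p ∣ x → V x 0
    V-unit {x} p∤x = exactly x (sym (*-identityˡ x)) p∤x

    V-p* : ∀ {x v} → V x v → V (x * p) (suc v)
    V-p* {x} {v} (exactly u refl p∤u) = exactly u (eq p (p ^ v) u) p∤u
      where
      eq : ∀ p w u → w * u * p ≡ p * w * u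
      eq = solve-∀

    V-* : ∀ {x y v w} → V x v → V y w → V (x * y) (v + w)
    V-* {v = v} {w} (exactly s refl p∤s) (exactly t refl p∤t) = exactly (s * t)
      (trans (eq (p ^ v) s (p ^ w) t) (cong (_* (s * t)) (sym (^-distribˡ-+-* p v w))))
      λ p∣ → helper (euclidsLemma s t p-prime p∣)
      where
      eq : ∀ a s b t → a * s * (b * t) ≡ a * b * (s * t)
      eq = solve-∀
      helper : p ∣ s ⊎ p ∣ t → ⊥
      helper (inj₁ e) = p∤s e
      helper (inj₂ e) = p∤t e

    V-exists : ∀ x → 1 ≤ x → ∃ (V x)
    V-exists x = go x (<-wellFounded x)
      where
      go : ∀ x → Acc _<_ x → 1 ≤ x → ∃ (V x)
      go x (acc rs) 1≤x with p ∣? x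
      ... | no p∤x = 0 , V-unit p∤x
      ... | yes (divides y refl) = let v , Vy = go y (rs (m<m*n y p {{nz}} (prime≥2 p-prime))) 1≤y in suc v , V-p* Vy
        where
        1≤y : 1 ≤ y
        1≤y = n≢0⇒n>0 λ { refl → contradiction 1≤x λ () }
        nz : NonZero y
        nz = >-nonZero 1≤y

    V-max : ∀ {x v e} → V x v → p ^ e ∣ x → e ≤ v
    V-max {e = zero} _ _ = z≤n
    V-max {v = zero} {suc e} (exactly u refl p∤u) p^e∣ =
      ⊥-elim (p∤u (subst (p ∣_) (*-identityˡ u) (∣-trans (∣m⇒∣m*n (p ^ e) ∣-refl) p^e∣)))
    V-max {v = suc v} {suc e} (exactly u refl p∤u) p^e∣ = s≤s (V-max {e = e} (exactly u refl p∤u)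
      (*-cancelˡ-∣ p (subst (p * p ^ e ∣_) (*-assoc p (p ^ v) u) p^e∣)))

    V-∣ : ∀ {x v} → V x v → p ^ v ∣ x
    V-∣ {v = v} (exactly u refl _) = ∣m⇒∣m*n u ∣-refl

    V-unique : ∀ {x v w} → V x v → V x w → v ≡ w
    V-unique {x} {v} {w} a b = ≤-antisym (V-max {x} {w} {v} b (V-∣ a)) (V-max {x} {v} {w} a (V-∣ b))

    -- Legendre's recursion: among the factors of (q p + r)! only p, 2p, ..., q p matter, and their
    -- product is p^q · q!.
    V-! : ∀ q r w → r < p → V (q !) w → V ((q * p + r) !) (q + w)
    V-! zero r w r<p V1 = subst (V (r !)) (V-unique {1} (V-unit (prime∤1 p-prime)) V1)
      (V-unit λ p∣ → <⇒≱ r<p (prime∣!⇒≤ p-prime r p∣))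
    V-! (suc q) (suc r) w r<p Vq = subst (λ z → V (z !) (suc q + w)) (sym (+-suc (suc q * p) r))
      (V-* (V-unit p∤) (V-! (suc q) r w (<⇒≤ r<p) Vq))
      where
      p∤ : ¬ p ∣ suc (suc q * p + r)
      p∤ p∣ = <⇒≱ r<p (∣⇒≤ (∣m+n∣m⇒∣n (subst (p ∣_) (sym (+-suc (suc q * p) r)) p∣) (n∣m*n (suc q))))
    -- The factor (q + 1) p is split off; what remains is (q p + (p - 1))!, so r restarts at p - 1.
    -- The valuation of (q + 1)! is recovered as the sum of those of q + 1 and q!.
    V-! (suc q) zero w r<p Vq with V-exists (q !) (1≤n! q) | V-exists (suc q) (s≤s z≤n)
    ... | w′ , Vq! | v , Vsq = subst₂ (λ x e → V x e) eqn
      (trans (arith v q w′) (cong (λ z → suc q + z) (V-unique (V-* Vsq Vq!) Vq)))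
      (V-* (V-p* Vsq) (V-! q (pred p) w′ (≤-reflexive (suc-pred p)) Vq!))
      where
      arith : ∀ v q w → suc v + (q + w) ≡ suc q + (v + w)
      arith = solve-∀
      top : suc (q * p + pred p) ≡ suc q * p
      top = trans (sym (+-suc (q * p) (pred p))) (trans (cong (q * p +_) (suc-pred p)) (+-comm (q * p) p))
      eqn : suc q * p * (q * p + pred p) ! ≡ (suc q * p + 0) !
      eqn = begin
        suc q * p * (q * p + pred p) ! ≡⟨ cong (_* (q * p + pred p) !) (sym top) ⟩
        (suc (q * p + pred p)) ! ≡⟨ cong _! top ⟩
        (suc q * p) ! ≡⟨ cong _! (+-identityʳ (suc q * p)) ⟨
        (suc q * p + 0) ! ∎
        where open ≡-Reasoning

    V-!′ : ∀ n w → V ((n / p) !) w → V (n !) (n / p + w)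
    V-!′ n w Vq = subst (λ z → V (z !) (n / p + w)) (trans (+-comm _ (n % p)) (sym (m≡m%n+[m/n]*n n p)))
      (V-! (n / p) (n % p) w (m%n<n n p) Vq)

    -- Division by p keeps a within {2b, 2b + 1} but can change which of the two it is; so the
    -- recursion of `central` has to treat both.
    /-halves : ∀ {a b} → 2 * b ≤ a → a ≤ suc (2 * b) → 2 * (b / p) ≤ a / p × a / p ≤ suc (2 * (b / p))
    /-halves {a} {b} lo hi = lo′ , hi′
      where
      open ≤-Reasoning
      a≡ = m≡m%n+[m/n]*n a p
      b≡ = m≡m%n+[m/n]*n b p
      lo′ : 2 * (b / p) ≤ a / p
      lo′ = ≮⇒≥ λ lt → <⇒≱ (begin-strict
        a ≡⟨ a≡ ⟩
        a % p + a / p * p <⟨ +-monoˡ-< (a / p * p) (m%n<n a p) ⟩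
        suc (a / p) * p ≤⟨ *-monoˡ-≤ p lt ⟩
        2 * (b / p) * p ≡⟨ *-assoc 2 (b / p) p ⟩
        2 * (b / p * p) ≤⟨ *-monoʳ-≤ 2 (≤-trans (m≤n+m _ (b % p)) (≤-reflexive (sym b≡))) ⟩
        2 * b ∎) lo
      hi′ : a / p ≤ suc (2 * (b / p))
      hi′ = ≮⇒≥ λ lt → <⇒≱ (begin-strict
        a ≤⟨ hi ⟩
        suc (2 * b) <⟨ n<1+n _ ⟩
        2 + 2 * b ≡⟨ *-suc 2 b ⟨
        2 * suc b ≤⟨ *-monoʳ-≤ 2 (subst (_< p + b / p * p) (sym b≡) (+-monoˡ-< (b / p * p) (m%n<n b p))) ⟩
        2 * (p + b / p * p) ≡⟨ arith p (b / p) ⟩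
        (2 + 2 * (b / p)) * p ≤⟨ *-monoˡ-≤ p lt ⟩
        a / p * p ∎) (≤-trans (m≤n+m _ (a % p)) (≤-reflexive (sym a≡)))
        where
        arith : ∀ p q → 2 * (p + q * p) ≡ (2 + 2 * q) * p
        arith = solve-∀

    -- The exponent of p in a! / (b!)² when a is 2b or 2b + 1.
    central : ∀ a b → 2 * b ≤ a → a ≤ suc (2 * b) → ∃₂ λ β v → V (b !) β × V (a !) (2 * β + v) × p ^ v ≤ a ⊔ 1
    central a = go a (<-wellFounded a)
      where
      go : ∀ a → Acc _<_ a → ∀ b → 2 * b ≤ a → a ≤ suc (2 * b) →
           ∃₂ λ β v → V (b !) β × V (a !) (2 * β + v) × p ^ v ≤ a ⊔ 1
      step : ∀ a b → p ≤ a → 2 * (b / p) ≤ a / p → a / p ≤ suc (2 * (b / p)) →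
        (∃₂ λ β v → V ((b / p) !) β × V ((a / p) !) (2 * β + v) × p ^ v ≤ a / p ⊔ 1) →
        ∃₂ λ β v → V (b !) β × V (a !) (2 * β + v) × p ^ v ≤ a ⊔ 1
      go a (acc rs) b lo hi with p ≤? a
      ... | no p≰a = 0 , 0 , V-unit (λ p∣ → p≰a (≤-trans (prime∣!⇒≤ p-prime b p∣) (≤-trans (m≤m+n b _) lo))) ,
                     V-unit (λ p∣ → p≰a (prime∣!⇒≤ p-prime a p∣)) , m≤n⊔m a 1
      ... | yes p≤a = let lo′ , hi′ = /-halves lo hi in step a b p≤a lo′ hi′
        (go (a / p) (rs (m/n<m a p {{>-nonZero (≤-trans (>-nonZero⁻¹ p) p≤a)}} (prime≥2 p-prime))) (b / p) lo′ hi′)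
      step a b p≤a lo′ hi′ (β , v , Vb , Va , p^v≤) = b / p + β , ε + v , V-!′ b β Vb ,
        subst (V (a !)) eqn (V-!′ a (2 * β + v) Va) , ≤-trans bound (m≤m⊔n a 1)
        where
        ε = a / p ∸ 2 * (b / p)
        a≡ = m≡m%n+[m/n]*n a p
        open ≤-Reasoning
        1≤a/p : 1 ≤ a / p
        1≤a/p = n≢0⇒n>0 λ e → <⇒≱ (begin-strict
          a ≡⟨ a≡ ⟩
          a % p + a / p * p ≡⟨ cong (λ z → a % p + z * p) e ⟩
          a % p + 0 ≡⟨ +-identityʳ _ ⟩
          a % p <⟨ m%n<n a p ⟩
          p ∎) p≤a
        eqn : a / p + (2 * β + v) ≡ 2 * (b / p + β) + (ε + v)
        eqn = trans (cong (_+ (2 * β + v)) (sym (m+[n∸m]≡n lo′))) (arith (b / p) ε β v)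
          where
          arith : ∀ q e β v → 2 * q + e + (2 * β + v) ≡ 2 * (q + β) + (e + v)
          arith = solve-∀
        -- ⌊a/p⌋ is 2⌊b/p⌋ or one more, so passing from a/p to a adds at most one factor p to
        -- `p ^ v`, and p · ⌊a/p⌋ ≤ a absorbs it.
        ε≤1 : ε ≤ 1
        ε≤1 = m≤n+o⇒m∸n≤o (a / p) (2 * (b / p)) (subst (a / p ≤_) (+-comm 1 (2 * (b / p))) hi′)
        bound : p ^ (ε + v) ≤ a
        bound = begin
          p ^ (ε + v) ≡⟨ ^-distribˡ-+-* p ε v ⟩
          p ^ ε * p ^ v ≤⟨ *-mono-≤ (^-monoʳ-≤ p ε≤1) p^v≤ ⟩
          p ^ 1 * (a / p ⊔ 1) ≡⟨ cong₂ _*_ (*-identityʳ p) (m≥n⇒m⊔n≡m 1≤a/p) ⟩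
          p * (a / p) ≡⟨ *-comm p (a / p) ⟩
          a / p * p ≤⟨ m≤n+m _ (a % p) ⟩
          a % p + a / p * p ≡⟨ a≡ ⟨
          a ∎

  -- Products over primes.

  prime-free⇒≡1 : ∀ x → 1 ≤ x → (∀ {p} → Prime p → ¬ p ∣ x) → x ≡ 1
  prime-free⇒≡1 x 1≤x free with factorise x {{>-nonZero 1≤x}}
  ... | record { factors = [] ; isFactorisation = e } = e
  ... | record { factors = p ∷ ps ; isFactorisation = e ; factorsPrime = pp ∷ _ } =
    ⊥-elim (free pp (subst (p ∣_) (sym e) (∣m⇒∣m*n (product ps) ∣-refl)))

  -- ∏ f M is the product of f p over the primes p < M.
  ∏ : (ℕ → ℕ) → ℕ → ℕ
  ∏ f zero = 1
  ∏ f (suc M) with prime? M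
  ... | yes _ = f M * ∏ f M
  ... | no  _ = ∏ f M

  ∏-prime : ∀ f {M} → Prime M → ∏ f (suc M) ≡ f M * ∏ f M
  ∏-prime f {M} pM with prime? M
  ... | yes _ = refl
  ... | no ¬p = ⊥-elim (¬p pM)

  ∏-nonprime : ∀ f {M} → ¬ Prime M → ∏ f (suc M) ≡ ∏ f M
  ∏-nonprime f {M} ¬p with prime? M
  ... | yes pM = ⊥-elim (¬p pM)
  ... | no _ = refl

  ∏-suc-≤ : ∀ f M {c} → f M ≤ c → 1 ≤ c → ∏ f (suc M) ≤ c * ∏ f M
  ∏-suc-≤ f M {c} f≤ 1≤c with prime? M
  ... | yes _ = *-monoˡ-≤ (∏ f M) f≤
  ... | no  _ = m≤n*m (∏ f M) c {{>-nonZero 1≤c}}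

  ∏-mono : ∀ {f} → (∀ {p} → Prime p → 1 ≤ f p) → ∀ {M K} → M ≤ K → ∏ f M ≤ ∏ f K
  ∏-mono {f} 1≤f M≤K = go (≤⇒≤′ M≤K)
    where
    go : ∀ {M K} → M ≤′ K → ∏ f M ≤ ∏ f K
    go ≤′-refl = ≤-refl
    go (≤′-step {n = K} M≤K) with prime? K
    ... | yes pK = ≤-trans (go M≤K) (m≤n*m _ (f K) {{>-nonZero (1≤f pK)}})
    ... | no  _ = go M≤K

  ∏-* : ∀ f g M → ∏ (λ p → f p * g p) M ≡ ∏ f M * ∏ g M
  ∏-* f g zero = refl
  ∏-* f g (suc M) with prime? M
  ... | yes _ = trans (cong (f M * g M *_) (∏-* f g M)) (arith (f M) (g M) (∏ f M) (∏ g M))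
    where
    arith : ∀ a b c d → a * b * (c * d) ≡ a * c * (b * d)
    arith = solve-∀
  ... | no  _ = ∏-* f g M

  -- x is the product of its exact prime powers, and each is at most the corresponding factor; the
  -- induction strips the exact power of M.
  ≤-∏ : ∀ f M x → 1 ≤ x → (∀ p e → Prime p → p ^ e ∣ x → p ^ e ≤ f p) → (∀ {p} → Prime p → p ∣ x → p < M) → x ≤ ∏ f M
  ≤-∏ f zero x 1≤x _ small = ≤-reflexive (prime-free⇒≡1 x 1≤x λ pp p∣ → contradiction (small pp p∣) λ ())
  ≤-∏ f (suc M) x 1≤x bound small with prime? M
  ... | no ¬pM = ≤-∏ f M x 1≤x bound (λ {p} pp p∣ → ≤∧≢⇒< (s≤s⁻¹ (small pp p∣)) (λ { refl → ¬pM pp }))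
  ... | yes pM with Valuation.V-exists pM x 1≤x
  ...   | v , Valuation.exactly u refl p∤u = *-mono-≤ (bound M v pM (∣m⇒∣m*n u ∣-refl))
          (≤-∏ f M u 1≤u (λ p e pp d → bound p e pp (∣n⇒∣m*n (M ^ v) d))
            (λ {p} pp p∣ → ≤∧≢⇒< (s≤s⁻¹ (small pp (∣n⇒∣m*n (M ^ v) p∣))) (λ { refl → p∤u p∣ })))
    where
    1≤u : 1 ≤ u
    1≤u = n≢0⇒n>0 λ { refl → p∤u (M ∣0) }

  -- Neutral from s on. Together with `above` it lets bounds valid on different ranges of primes be
  -- multiplied within a single `∏`.
  cut : ℕ → (ℕ → ℕ) → ℕ → ℕ
  cut s f p with p <? s
  ... | yes _ = f p
  ... | no  _ = 1

  cut-yes : ∀ {s f p} → p < s → cut s f p ≡ f p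
  cut-yes {s} {f} {p} p<s with p <? s
  ... | yes _ = refl
  ... | no ¬p<s = ⊥-elim (¬p<s p<s)

  cut-≥1 : ∀ s f {p} → 1 ≤ f p → 1 ≤ cut s f p
  cut-≥1 s f {p} 1≤f with p <? s
  ... | yes _ = 1≤f
  ... | no  _ = ≤-refl

  ∏-cut : ∀ s {f} → (∀ {p} → Prime p → 1 ≤ f p) → ∀ M → ∏ (cut s f) M ≤ ∏ f s
  ∏-cut s {f} 1≤f M = ≤-trans (go M) (∏-mono 1≤f (m⊓n≤n M s))
    where
    go : ∀ M → ∏ (cut s f) M ≤ ∏ f (M ⊓ s)
    go zero = ≤-refl
    go (suc M) with M <? s
    ... | yes M<s rewrite m≤n⇒m⊓n≡m M<s with prime? M
    ...   | yes _ = *-mono-≤ (≤-reflexive (cut-yes M<s)) (subst (λ z → ∏ (cut s f) M ≤ ∏ f z) (m≤n⇒m⊓n≡m (<⇒≤ M<s)) (go M))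
    ...   | no  _ = subst (λ z → ∏ (cut s f) M ≤ ∏ f z) (m≤n⇒m⊓n≡m (<⇒≤ M<s)) (go M)
    go (suc M) | no M≮s = ≤-trans (∏-suc-≤ (cut s f) M (≤-reflexive one) ≤-refl)
        (≤-trans (≤-reflexive (*-identityˡ _)) (≤-trans (go M) (∏-mono 1≤f (⊓-monoˡ-≤ s (n≤1+n M)))))
      where
      one : cut s f M ≡ 1
      one with M <? s
      ... | yes M<s = ⊥-elim (M≮s M<s)
      ... | no _ = refl

  ∏-const : ∀ c → 1 ≤ c → ∀ M → ∏ (λ _ → c) M ≤ c ^ M
  ∏-const c 1≤c zero = ≤-refl
  ∏-const c 1≤c (suc M) = ≤-trans (∏-suc-≤ (λ _ → c) M ≤-refl 1≤c) (*-monoʳ-≤ c (∏-const c 1≤c M))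

  InRange : ℕ → ℕ → Set
  InRange n p = n < p × Prime p

  inRange? : ∀ n p → Dec (InRange n p)
  inRange? n p = (n <? p) ×-dec prime? p

  primesBetween : ℕ → ℕ → List ℕ
  primesBetween n M = filter (inRange? n) (downFrom M)

  primesBetween-unique : ∀ n M → Unique (primesBetween n M)
  primesBetween-unique n M = filter⁺ (inRange? n) (downFrom⁺ M)

  primesBetween-all : ∀ n M → All (λ p → n < p × Prime p × p < M) (primesBetween n M)
  primesBetween-all n M = All.tabulate λ p∈ →
    let p∈down , n<p , pp = ∈-filter⁻ (inRange? n) {xs = downFrom M} p∈ in n<p , pp , ∈-downFrom⁻ p∈down

  above : ℕ → ℕ → ℕ → ℕ
  above n c p with n <? p
  ... | yes _ = c
  ... | no  _ = 1

  above-yes : ∀ {n c p} → n < p → above n c p ≡ c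
  above-yes {n} {c} {p} n<p with n <? p
  ... | yes _ = refl
  ... | no ¬n<p = ⊥-elim (¬n<p n<p)

  above-no : ∀ {n c p} → ¬ n < p → above n c p ≡ 1
  above-no {n} {c} {p} n≮p with n <? p
  ... | yes n<p = ⊥-elim (n≮p n<p)
  ... | no _ = refl

  above-≥1 : ∀ n {c p} → 1 ≤ c → 1 ≤ above n c p
  above-≥1 n {c} {p} 1≤c with n <? p
  ... | yes _ = 1≤c
  ... | no  _ = ≤-refl

  primesBetween-accept : ∀ {n M} → n < M → Prime M → primesBetween n (suc M) ≡ M ∷ primesBetween n M
  primesBetween-accept {n} n<M pM = filter-accept (inRange? n) (n<M , pM)

  primesBetween-reject : ∀ {n M} → ¬ InRange n M → primesBetween n (suc M) ≡ primesBetween n M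
  primesBetween-reject {n} out = filter-reject (inRange? n) out

  ∏-above : ∀ n c → 1 ≤ c → ∀ M → ∏ (above n c) M ≤ c ^ length (primesBetween n M)
  ∏-above n c 1≤c zero = ≤-refl
  ∏-above n c 1≤c (suc M) = by (inRange? n M)
    where
    open ≤-Reasoning
    f = above n c
    by : Dec (InRange n M) → ∏ f (suc M) ≤ c ^ length (primesBetween n (suc M))
    by (yes (n<M , pM)) = begin
      ∏ f (suc M) ≡⟨ ∏-prime f pM ⟩
      f M * ∏ f M ≤⟨ *-mono-≤ (≤-reflexive (above-yes n<M)) (∏-above n c 1≤c M) ⟩
      c ^ suc (length (primesBetween n M)) ≡⟨ cong (λ ps → c ^ length ps) (primesBetween-accept n<M pM) ⟨
      c ^ length (primesBetween n (suc M)) ∎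
    by (no out) = subst (λ ps → ∏ f (suc M) ≤ c ^ length ps) (sym (primesBetween-reject out)) (≤-trans (same (prime? M)) (∏-above n c 1≤c M))
      where
      same : Dec (Prime M) → ∏ f (suc M) ≤ ∏ f M
      same (no ¬p) = ≤-reflexive (∏-nonprime f ¬p)
      same (yes pM) = ≤-trans (≤-reflexive (∏-prime f pM)) (≤-reflexive (trans (cong (_* ∏ f M) (one (n <? M))) (*-identityˡ _)))
        where
        one : Dec (n < M) → above n c M ≡ 1
        one (yes n<M) = ⊥-elim (out (n<M , pM))
        one (no n≮M) = above-no n≮M

  primorial : ℕ → ℕ
  primorial = ∏ (λ p → p)

  primorial-split : ∀ {n M} → n < M → primorial M ≤ primorial (suc n) * product (primesBetween n M)
  primorial-split {n} n<M = go (≤⇒≤′ n<M)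
    where
    go : ∀ {M} → suc n ≤′ M → primorial M ≤ primorial (suc n) * product (primesBetween n M)
    go ≤′-refl = m≤m*n _ _ {{productOfPrimes≢0 (All.map (λ q → proj₁ (proj₂ q)) (primesBetween-all n (suc n)))}}
    go (≤′-step {n = M} n<M) = by (prime? M)
      where
      open ≤-Reasoning
      arith : ∀ a b c → a * (b * c) ≡ b * (a * c)
      arith = solve-∀
      by : Dec (Prime M) → primorial (suc M) ≤ primorial (suc n) * product (primesBetween n (suc M))
      by (yes pM) = begin
        primorial (suc M) ≡⟨ ∏-prime (λ p → p) pM ⟩
        M * primorial M ≤⟨ *-monoʳ-≤ M (go n<M) ⟩
        M * (primorial (suc n) * product (primesBetween n M)) ≡⟨ arith M (primorial (suc n)) (product (primesBetween n M)) ⟩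
        primorial (suc n) * product (M ∷ primesBetween n M) ≡⟨ cong (λ ps → primorial (suc n) * product ps) (primesBetween-accept (≤′⇒≤ n<M) pM) ⟨
        primorial (suc n) * product (primesBetween n (suc M)) ∎
      by (no ¬p) = begin
        primorial (suc M) ≡⟨ ∏-nonprime (λ p → p) ¬p ⟩
        primorial M ≤⟨ go n<M ⟩
        primorial (suc n) * product (primesBetween n M) ≡⟨ cong (λ ps → primorial (suc n) * product ps) (primesBetween-reject {n} {M} (λ q → ¬p (proj₂ q))) ⟨
        primorial (suc n) * product (primesBetween n (suc M)) ∎

  -- Central binomial coefficients and the primorial.

  C-! : ∀ a b → ((a + b) C a) * (a ! * b !) ≡ (a + b) !
  C-! a b = begin
    ((a + b) C a) * (a ! * b !) ≡⟨ cong (λ z → ((a + b) C a) * (a ! * z !)) (sym (m+n∸m≡n a b)) ⟩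
    ((a + b) C a) * (a ! * (a + b ∸ a) !) ≡⟨ cong (_* (a ! * (a + b ∸ a) !)) (nCk≡n!/k![n-k]! (m≤m+n a b)) ⟩
    _ ≡⟨ m/n*n≡m {{a !* (a + b ∸ a) !≢0}} (k![n∸k]!∣n! (m≤m+n a b)) ⟩
    (a + b) ! ∎
    where open ≡-Reasoning

  private
    !-cancel : ∀ a b {x y} → x * (a ! * b !) ≡ y * (a ! * b !) → x ≡ y
    !-cancel a b {x} {y} = *-cancelʳ-≡ x y (a ! * b !) {{a !* b !≢0}}

  C-central-suc : ∀ n → suc n * ((suc n + suc n) C suc n) ≡ 2 * suc (n + n) * ((n + n) C n)
  C-central-suc n = !-cancel n n (*-cancelˡ-≡ _ _ (suc n) (begin
    suc n * (suc n * X * (n ! * n !)) ≡⟨ arith₁ (suc n) X (n !) ⟩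
    X * (suc n * n ! * (suc n * n !)) ≡⟨ C-! (suc n) (suc n) ⟩
    (suc n + suc n) ! ≡⟨ cong _! (cong suc (+-suc n n)) ⟩
    suc (suc (n + n)) * (suc (n + n) * (n + n) !) ≡⟨ cong (λ z → suc (suc (n + n)) * (suc (n + n) * z)) (C-! n n) ⟨
    suc (suc (n + n)) * (suc (n + n) * (Y * (n ! * n !))) ≡⟨ arith₂ n Y (n ! * n !) ⟩
    suc n * (2 * suc (n + n) * Y * (n ! * n !)) ∎))
    where
    open ≡-Reasoning
    X = (suc n + suc n) C suc n
    Y = (n + n) C n
    arith₁ : ∀ s x f → s * (s * x * (f * f)) ≡ x * (s * f * (s * f))
    arith₁ = solve-∀
    arith₂ : ∀ n y f → (2 + (n + n)) * ((1 + (n + n)) * (y * f)) ≡ (1 + n) * (2 * (1 + (n + n)) * y * f)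
    arith₂ = solve-∀

  4^≤central : ∀ n → 4 ^ suc n ≤ (suc n + suc n) * ((suc n + suc n) C suc n)
  4^≤central zero = ≤-reflexive refl
  4^≤central (suc n) = begin
    4 * 4 ^ suc n ≤⟨ *-monoʳ-≤ 4 (4^≤central n) ⟩
    4 * ((m + m) * ((m + m) C m)) ≤⟨ *-monoʳ-≤ 4 (*-monoˡ-≤ ((m + m) C m) (n≤1+n (m + m))) ⟩
    4 * (suc (m + m) * ((m + m) C m)) ≡⟨ arith₁ (suc (m + m)) ((m + m) C m) ⟩
    2 * (2 * suc (m + m) * ((m + m) C m)) ≡⟨ cong (2 *_) (C-central-suc m) ⟨
    2 * (suc m * ((suc m + suc m) C suc m)) ≡⟨ arith₂ (suc m) ((suc m + suc m) C suc m) ⟩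
    (suc m + suc m) * ((suc m + suc m) C suc m) ∎
    where
    open ≤-Reasoning
    m = suc n
    arith₁ : ∀ a b → 4 * (a * b) ≡ 2 * (2 * a * b)
    arith₁ = solve-∀
    arith₂ : ∀ a b → 2 * (a * b) ≡ (a + a) * b
    arith₂ = solve-∀

  C-odd-suc : ∀ m → suc (suc m) * ((suc m + suc (suc m)) C suc m) ≡ 2 * (3 + (m + m)) * ((m + suc m) C m)
  C-odd-suc m = !-cancel m (suc m) (*-cancelˡ-≡ _ _ (suc m) (begin
    suc m * (suc (suc m) * X * (m ! * suc m !)) ≡⟨ arith₁ (suc m) (suc (suc m)) X (m !) (suc m !) ⟩
    X * (suc m * m ! * (suc (suc m) * suc m !)) ≡⟨ C-! (suc m) (suc (suc m)) ⟩
    (suc m + suc (suc m)) ! ≡⟨ cong _! (cong suc (+-suc m (suc m))) ⟩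
    suc (suc (m + suc m)) * (suc (m + suc m) * (m + suc m) !) ≡⟨ cong (λ z → suc (suc (m + suc m)) * (suc (m + suc m) * z)) (C-! m (suc m)) ⟨
    suc (suc (m + suc m)) * (suc (m + suc m) * (Y * (m ! * suc m !))) ≡⟨ arith₂ m Y (m ! * suc m !) ⟩
    suc m * (2 * (3 + (m + m)) * Y * (m ! * suc m !)) ∎))
    where
    open ≡-Reasoning
    X = (suc m + suc (suc m)) C suc m
    Y = (m + suc m) C m
    arith₁ : ∀ s t x f g → s * (t * x * (f * g)) ≡ x * (s * f * (t * g))
    arith₁ = solve-∀
    arith₂ : ∀ n y f → (2 + (n + (1 + n))) * ((1 + (n + (1 + n))) * (y * f)) ≡ (1 + n) * (2 * (3 + (n + n)) * y * f)
    arith₂ = solve-∀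

  C-odd-≤ : ∀ m → (m + suc m) C m ≤ 4 ^ m
  C-odd-≤ zero = ≤-refl
  C-odd-≤ (suc m) = *-cancelˡ-≤ (suc (suc m)) (begin
    suc (suc m) * ((suc m + suc (suc m)) C suc m) ≡⟨ C-odd-suc m ⟩
    2 * (3 + (m + m)) * ((m + suc m) C m) ≤⟨ *-monoˡ-≤ ((m + suc m) C m) {2 * (3 + (m + m))} {4 * suc (suc m)} (subst₂ _≤_ (arith₁ m) (arith₂ m) (n≤m+n 2 _)) ⟩
    4 * suc (suc m) * ((m + suc m) C m) ≤⟨ *-monoʳ-≤ (4 * suc (suc m)) (C-odd-≤ m) ⟩
    4 * suc (suc m) * 4 ^ m ≡⟨ arith₃ (suc (suc m)) (4 ^ m) ⟩
    suc (suc m) * 4 ^ suc m ∎)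
    where
    open ≤-Reasoning
    n≤m+n : ∀ k n → n ≤ k + n
    n≤m+n k n = m≤n+m n k
    arith₁ : ∀ m → 6 + 4 * m ≡ 2 * (3 + (m + m))
    arith₁ = solve-∀
    arith₂ : ∀ m → 2 + (6 + 4 * m) ≡ 4 * (2 + m)
    arith₂ = solve-∀
    arith₃ : ∀ a b → 4 * a * b ≡ a * (4 * b)
    arith₃ = solve-∀

  even-or-odd : ∀ n → ∃ λ m → n ≡ m + m ⊎ n ≡ suc (m + m)
  even-or-odd zero = 0 , inj₁ refl
  even-or-odd (suc n) with even-or-odd n
  ... | m , inj₁ refl = m , inj₂ refl
  ... | m , inj₂ refl = suc m , inj₁ (cong suc (sym (+-suc m m)))

  -- Erdős' induction. An even n > 2 is not prime. For n = 2k + 1 the primes in (k + 1, 2k + 1]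
  -- divide C(2k + 1, k) ≤ 4^k, and the smaller ones contribute at most 4^(k + 1).
  primorial-≤ : ∀ n → primorial (suc n) ≤ 4 ^ n
  primorial-≤ n = go n (<-wellFounded n)
    where
    go : ∀ n → Acc _<_ n → primorial (suc n) ≤ 4 ^ n
    go n (acc rs) with even-or-odd n
    ... | zero , inj₁ refl = ≤-refl
    ... | suc zero , inj₁ refl = s≤s (s≤s z≤n)
    ... | suc (suc m) , inj₁ refl = begin
      primorial (suc k) ≡⟨ ∏-nonprime (λ p → p) not-prime ⟩
      primorial k ≤⟨ go (pred k) (rs ≤-refl) ⟩
      4 ^ pred k ≤⟨ ^-monoʳ-≤ 4 (n≤1+n (pred k)) ⟩
      4 ^ k ∎
      where
      open ≤-Reasoning
      k = suc (suc m) + suc (suc m)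
      not-prime : ¬ Prime k
      not-prime pk with prime∣prime⇒≡ prime[2] pk (divides (2 + m) (arith m))
        where
        arith : ∀ m → (2 + m) + (2 + m) ≡ (2 + m) * 2
        arith = solve-∀
      ... | e = contradiction (subst (4 ≤_) (sym e) (+-mono-≤ {2} {_} {2} (s≤s (s≤s z≤n)) (s≤s (s≤s z≤n)))) λ { (s≤s (s≤s ())) }
    ... | zero , inj₂ refl = s≤s z≤n
    ... | suc m , inj₂ refl = begin
      primorial (2 + (k + k)) ≤⟨ primorial-split {suc k} (s≤s (s≤s (m≤m+n k k))) ⟩
      primorial (suc (suc k)) * product between ≤⟨ *-mono-≤ (go (suc k) (rs (s≤s (m<m+n k (s≤s z≤n))))) product≤ ⟩
      4 ^ suc k * 4 ^ k ≡⟨ ^-distribˡ-+-* 4 (suc k) k ⟨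
      4 ^ suc (k + k) ∎
      where
      open ≤-Reasoning
      k = suc m
      between = primesBetween (suc k) (2 + (k + k))
      D = (k + suc k) C k
      1≤D : 1 ≤ D
      1≤D = n≢0⇒n>0 λ e → ≢-nonZero⁻¹ ((k + suc k) !) {{(k + suc k) !≢0}} (trans (sym (C-! k (suc k))) (cong (_* (k ! * suc k !)) e))
      divides-D : ∀ {p} → suc k < p × Prime p × p < 2 + (k + k) → p ∣ D
      divides-D {p} (k<p , pp , p<) with euclidsLemma D (k ! * suc k !) pp
        (subst (p ∣_) (sym (C-! k (suc k))) (m∣m! (≤-trans (s≤s z≤n) k<p) (subst (p ≤_) (sym (+-suc k k)) (s≤s⁻¹ p<))))
      ... | inj₁ p∣D = p∣D
      ... | inj₂ p∣ with euclidsLemma (k !) (suc k !) pp p∣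
      ...   | inj₁ p∣k = ⊥-elim (<⇒≱ k<p (m≤n⇒m≤1+n (prime∣!⇒≤ pp k p∣k)))
      ...   | inj₂ p∣k = ⊥-elim (<⇒≱ k<p (prime∣!⇒≤ pp (suc k) p∣k))
      product≤ : product between ≤ 4 ^ k
      product≤ = ≤-trans (∣⇒≤ {{>-nonZero 1≤D}} (product-primes-∣ (primesBetween-unique (suc k) (2 + (k + k)))
        (All.map (λ q → proj₁ (proj₂ q)) (primesBetween-all (suc k) (2 + (k + k))))
        (All.map divides-D (primesBetween-all (suc k) (2 + (k + k)))))) (C-odd-≤ k)

  -- Chebyshev's lower bound for the number of primes between n and 2n.

  module Bertrand (n s : ℕ) (3≤n : 3 ≤ n) (2n<s² : n + n < s * s) where

    B = (n + n) C n
    t = (n + n) / 3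

    -- Dominates the power of p in C(2n, n). That power is at most 2n always, at most p once p ≥ s
    -- since p² > 2n, and 1 for 2n/3 < p ≤ n. Hence 2n is charged for p < s and for p > n, and p for
    -- p ≤ 2n/3; overlapping charges only multiply.
    b : ℕ → ℕ
    b p = cut s (λ _ → n + n) p * (cut (suc t) (λ p → p) p * above n (n + n) p)

    1≤2n : 1 ≤ n + n
    1≤2n = ≤-trans (s≤s z≤n) (≤-trans 3≤n (m≤m+n n n))

    module _ {p} (p-prime : Prime p) where
      open Valuation p-prime
      1≤p : 1 ≤ p
      1≤p = ≤-trans (s≤s z≤n) (prime≥2 p-prime)

      b₁ = cut s (λ _ → n + n) p
      b₂ = cut (suc t) (λ p → p) p
      b₃ = above n (n + n) p

      1≤b₁ : 1 ≤ b₁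
      1≤b₁ = cut-≥1 s (λ _ → n + n) 1≤2n
      1≤b₂ : 1 ≤ b₂
      1≤b₂ = cut-≥1 (suc t) (λ p → p) 1≤p
      1≤b₃ : 1 ≤ b₃
      1≤b₃ = above-≥1 n 1≤2n

      b₁≤b : b₁ ≤ b p
      b₁≤b = m≤m*n b₁ (b₂ * b₃) {{>-nonZero (*-mono-≤ 1≤b₂ 1≤b₃)}}
      b₂≤b : b₂ ≤ b p
      b₂≤b = ≤-trans (m≤m*n b₂ b₃ {{>-nonZero 1≤b₃}}) (m≤n*m (b₂ * b₃) b₁ {{>-nonZero 1≤b₁}})
      b₃≤b : b₃ ≤ b p
      b₃≤b = ≤-trans (m≤n*m b₃ b₂ {{>-nonZero 1≤b₂}}) (m≤n*m (b₂ * b₃) b₁ {{>-nonZero 1≤b₁}})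

      B-valuation : ∃ λ v → V B v × (∀ {β w} → V (n !) β → V ((n + n) !) w → w ≡ v + (β + β))
      B-valuation with V-exists B (n≢0⇒n>0 λ e → ≢-nonZero⁻¹ ((n + n) !) {{(n + n) !≢0}}
        (trans (sym (C-! n n)) (cong (_* (n ! * n !)) e)))
      ... | v , VB = v , VB , λ {β} {w} Vn V2n → V-unique V2n (subst (λ z → V z (v + (β + β))) (C-! n n) (V-* VB (V-* Vn Vn)))

      p^v≤2n : ∀ {v} → V B v → p ^ v ≤ n + n
      p^v≤2n {v} VB with B-valuation | central (n + n) n (≤-reflexive (cong (n +_) (+-identityʳ n))) (m≤n⇒m≤1+n (≤-reflexive (cong (n +_) (sym (+-identityʳ n)))))
      ... | v′ , VB′ , rel | β , w , Vn , V2n , p^w≤ =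
        subst₂ (λ e z → p ^ e ≤ z) w≡v (m≥n⇒m⊔n≡m 1≤2n) p^w≤
        where
        w≡v : w ≡ v
        w≡v = trans (+-cancelˡ-≡ (2 * β) w v′ (trans (rel Vn V2n) (arith v′ β))) (V-unique VB′ VB)
          where
          arith : ∀ v β → v + (β + β) ≡ 2 * β + v
          arith = solve-∀

      -- A prime in (2n/3 , n] occurs twice in (2n)! and once in n!.
      vanishes : ∀ {v} → V B v → p ≤ n → n + n < 3 * p → v ≡ 0
      vanishes {v} VB p≤n 2n<3p with B-valuation
      ... | v′ , VB′ , rel = trans (V-unique VB VB′) (sym (+-cancelʳ-≡ 2 0 v′ (rel V1 V2)))
        where
        3≤p : 3 ≤ p
        3≤p = *-cancelˡ-< 3 2 p (≤-<-trans (+-mono-≤ 3≤n 3≤n) 2n<3p)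
        n<2p : n < p + p
        n<2p = ≰⇒> λ 2p≤n → <⇒≱ 2n<3p (≤-trans (≤-reflexive (arith p)) (+-mono-≤ 2p≤n p≤n))
          where
          arith : ∀ p → 3 * p ≡ p + p + p
          arith = solve-∀
        V1 : V (n !) 1
        V1 = subst (λ z → V (z !) 1) (trans (cong (_+ (n ∸ p)) (+-identityʳ p)) (m+[n∸m]≡n p≤n))
          (V-! 1 (n ∸ p) 0 (m<n+o⇒m∸n<o n p {{p≢0}} n<2p) (V-unit (prime∤1 p-prime)))
        V2 : V ((n + n) !) 2
        V2 = subst (λ z → V (z !) 2) (m+[n∸m]≡n (subst (_≤ n + n) (cong (p +_) (sym (+-identityʳ p))) (+-mono-≤ p≤n p≤n)))
          (V-! 2 (n + n ∸ 2 * p) 0 (m<n+o⇒m∸n<o (n + n) (2 * p) {{p≢0}} (subst (n + n <_) (arith p) 2n<3p))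
            (V-unit λ p∣2 → <⇒≱ 3≤p (∣⇒≤ p∣2)))
          where
          arith : ∀ p → 3 * p ≡ 2 * p + p
          arith = solve-∀

      p^e≤b : ∀ e → p ^ e ∣ B → p ^ e ≤ b p
      p^e≤b e p^e∣ with B-valuation
      ... | v , VB , _ = ≤-trans (^-monoʳ-≤ p (V-max {e = e} VB p^e∣)) (by (p <? s) (n <? p) (p ≤? t))
        where
        by : Dec (p < s) → Dec (n < p) → Dec (p ≤ t) → p ^ v ≤ b p
        by (yes p<s) _ _ = ≤-trans (p^v≤2n VB) (≤-trans (≤-reflexive (sym (cut-yes p<s))) b₁≤b)
        by (no _) (yes n<p) _ = ≤-trans (p^v≤2n VB) (≤-trans (≤-reflexive (sym (above-yes n<p))) b₃≤b)
        by (no p≮s) (no _) (yes p≤t) = ≤-trans (≤-trans (^-monoʳ-≤ p v≤1) (≤-reflexive (*-identityʳ p)))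
          (≤-trans (≤-reflexive (sym (cut-yes {f = λ p → p} (s≤s p≤t)))) b₂≤b)
          where
          v≤1 : v ≤ 1
          v≤1 = s≤s⁻¹ (^-cancelʳ-< p (≤-<-trans (p^v≤2n VB) (<-≤-trans 2n<s²
            (≤-trans (*-mono-≤ (≮⇒≥ p≮s) (≮⇒≥ p≮s)) (≤-reflexive (cong (p *_) (sym (*-identityʳ p))))))))
        by (no _) (no n≮p) (no p≰t) = ≤-trans (≤-reflexive (cong (p ^_) (vanishes VB (≮⇒≥ n≮p) 2n<3p)))
          (≤-trans 1≤b₂ b₂≤b)
          where
          2n<3p : n + n < 3 * p
          2n<3p = begin-strict
            n + n ≡⟨ m≡m%n+[m/n]*n (n + n) 3 ⟩
            (n + n) % 3 + t * 3 <⟨ +-monoˡ-< (t * 3) (m%n<n (n + n) 3) ⟩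
            suc t * 3 ≤⟨ *-monoˡ-≤ 3 (≰⇒> p≰t) ⟩
            p * 3 ≡⟨ *-comm p 3 ⟩
            3 * p ∎
            where open ≤-Reasoning

    -- Counts the primes with n < p ≤ 2n - 2. When i < y < i + 2 and n = i + 1, these satisfy y < p
    -- < 2y. The omitted numbers 2n - 1 and 2n reappear as the 2 in `2 + q`.
    q : ℕ
    q = length (primesBetween n (n + n ∸ 1))

    B≤ : B ≤ (n + n) ^ s * (4 ^ t * (n + n) ^ (2 + q))
    B≤ = begin
      B ≤⟨ ≤-∏ b (suc (n + n)) B 1≤B (λ p e pp → p^e≤b pp e) small ⟩
      ∏ b (suc (n + n)) ≡⟨ ∏-* f₁ (λ p → f₂ p * f₃ p) (suc (n + n)) ⟩
      ∏ f₁ (suc (n + n)) * ∏ (λ p → f₂ p * f₃ p) (suc (n + n))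
        ≡⟨ cong (∏ f₁ (suc (n + n)) *_) (∏-* f₂ f₃ (suc (n + n))) ⟩
      ∏ f₁ (suc (n + n)) * (∏ f₂ (suc (n + n)) * ∏ f₃ (suc (n + n)))
        ≤⟨ *-mono-≤ (≤-trans (∏-cut s (λ _ → 1≤2n) (suc (n + n))) (∏-const (n + n) 1≤2n s))
             (*-mono-≤ (≤-trans (∏-cut (suc t) (λ pp → ≤-trans (s≤s z≤n) (prime≥2 pp)) (suc (n + n))) (primorial-≤ t)) top) ⟩
      (n + n) ^ s * (4 ^ t * (n + n) ^ (2 + q)) ∎
      where
      open ≤-Reasoning
      f₁ = cut s (λ _ → n + n)
      f₂ = cut (suc t) (λ p → p)
      f₃ = above n (n + n)
      1≤B : 1 ≤ B
      1≤B = n≢0⇒n>0 λ e → ≢-nonZero⁻¹ ((n + n) !) {{(n + n) !≢0}}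
        (trans (sym (C-! n n)) (cong (_* (n ! * n !)) e))
      small : ∀ {p} → Prime p → p ∣ B → p < suc (n + n)
      small pp p∣ = s≤s (prime∣!⇒≤ pp (n + n) (subst (_ ∣_) (C-! n n) (∣m⇒∣m*n (n ! * n !) p∣)))
      f₃≤ : ∀ p → f₃ p ≤ n + n
      f₃≤ p with n <? p
      ... | yes _ = ≤-refl
      ... | no _  = 1≤2n
      M = n + n ∸ 1
      2n≡ : n + n ≡ suc M
      2n≡ = sym (m+[n∸m]≡n 1≤2n)
      top : ∏ f₃ (suc (n + n)) ≤ (n + n) ^ (2 + q)
      top = begin
        ∏ f₃ (suc (n + n)) ≤⟨ ∏-suc-≤ f₃ (n + n) (f₃≤ (n + n)) 1≤2n ⟩
        (n + n) * ∏ f₃ (n + n) ≡⟨ cong (λ z → (n + n) * ∏ f₃ z) 2n≡ ⟩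
        (n + n) * ∏ f₃ (suc M) ≤⟨ *-monoʳ-≤ (n + n) (∏-suc-≤ f₃ M (f₃≤ M) 1≤2n) ⟩
        (n + n) * ((n + n) * ∏ f₃ M) ≤⟨ *-monoʳ-≤ (n + n) (*-monoʳ-≤ (n + n) (∏-above n (n + n) 1≤2n M)) ⟩
        (n + n) ^ (2 + q) ∎

    -- Taking binary logarithms in 4^n ≤ 2n · C(2n, n) gives 2n ≤ μ (s + 3 + q) + 2 t. As 3 t ≤ 2n,
    -- tripling this leaves two of the three copies of 2n to be cancelled.
    2n≤ : ∀ {μ} → n + n ≤ 2 ^ μ → n + n ≤ 3 * μ * (s + 3 + q)
    2n≤ {μ} le = +-cancelʳ-≤ (2 * (n + n)) _ _ (begin
      n + n + 2 * (n + n) ≡⟨ arith₁ (n + n) ⟩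
      3 * (n + n) ≤⟨ *-monoʳ-≤ 3 exponents ⟩
      3 * (μ * (s + 3 + q) + 2 * t) ≡⟨ arith₂ (μ * (s + 3 + q)) t ⟩
      3 * (μ * (s + 3 + q)) + 2 * (t * 3) ≤⟨ +-monoʳ-≤ (3 * (μ * (s + 3 + q))) (*-monoʳ-≤ 2 t*3≤) ⟩
      3 * (μ * (s + 3 + q)) + 2 * (n + n) ≡⟨ cong (_+ 2 * (n + n)) (*-assoc 3 μ (s + 3 + q)) ⟨
      3 * μ * (s + 3 + q) + 2 * (n + n) ∎)
      where
      open ≤-Reasoning
      arith₁ : ∀ x → x + 2 * x ≡ 3 * x
      arith₁ = solve-∀
      arith₂ : ∀ x t → 3 * (x + 2 * t) ≡ 3 * x + 2 * (t * 3)
      arith₂ = solve-∀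
      t*3≤ : t * 3 ≤ n + n
      t*3≤ = ≤-trans (m≤n+m _ ((n + n) % 3)) (≤-reflexive (sym (m≡m%n+[m/n]*n (n + n) 3)))
      4^≤ : 4 ^ n ≤ (n + n) * B
      4^≤ = subst (λ z → 4 ^ z ≤ (z + z) * ((z + z) C z)) (suc-pred n {{>-nonZero (≤-trans (s≤s z≤n) 3≤n)}}) (4^≤central (pred n))
      exponents : n + n ≤ μ * (s + 3 + q) + 2 * t
      exponents = ^-cancelʳ-≤ 2 (s≤s (s≤s z≤n)) (begin
        2 ^ (n + n) ≡⟨ cong (λ z → 2 ^ (n + z)) (sym (+-identityʳ n)) ⟩
        2 ^ (2 * n) ≡⟨ ^-*-assoc 2 2 n ⟨
        4 ^ n ≤⟨ 4^≤ ⟩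
        (n + n) * B ≤⟨ *-monoʳ-≤ (n + n) B≤ ⟩
        (n + n) * ((n + n) ^ s * (4 ^ t * (n + n) ^ (2 + q))) ≡⟨ regroup ⟩
        (n + n) ^ (s + 3 + q) * 4 ^ t ≤⟨ *-monoˡ-≤ (4 ^ t) (^-monoˡ-≤ (s + 3 + q) le) ⟩
        (2 ^ μ) ^ (s + 3 + q) * 4 ^ t ≡⟨ cong₂ _*_ (^-*-assoc 2 μ (s + 3 + q)) (^-*-assoc 2 2 t) ⟩
        2 ^ (μ * (s + 3 + q)) * 2 ^ (2 * t) ≡⟨ ^-distribˡ-+-* 2 (μ * (s + 3 + q)) (2 * t) ⟨
        2 ^ (μ * (s + 3 + q) + 2 * t) ∎)
        where
        regroup : (n + n) * ((n + n) ^ s * (4 ^ t * (n + n) ^ (2 + q))) ≡ (n + n) ^ (s + 3 + q) * 4 ^ t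
        regroup = trans (assoc (n + n) ((n + n) ^ s) (4 ^ t) ((n + n) ^ (2 + q)))
          (cong (_* 4 ^ t) (trans (sym (^-distribˡ-+-* (n + n) (suc s) (2 + q))) (cong ((n + n) ^_) (shift s q))))
          where
          assoc : ∀ a b c d → a * (b * (c * d)) ≡ a * b * d * c
          assoc = solve-∀
          shift : ∀ s q → suc s + (2 + q) ≡ s + 3 + q
          shift = solve-∀

  15[2h+3]≤2^h : ∀ h → 15 * (2 * (9 + h) + 3) ≤ 2 ^ (9 + h)
  15[2h+3]≤2^h zero = ≤ᵇ⇒≤ 315 512 _
  15[2h+3]≤2^h (suc h) = begin
    15 * (2 * (9 + suc h) + 3) ≡⟨ arith h ⟩
    15 * (2 * (9 + h) + 3) + 30 ≤⟨ +-mono-≤ (15[2h+3]≤2^h h) (≤-trans (≤ᵇ⇒≤ 30 (2 ^ 9) _) (^-monoʳ-≤ 2 (m≤m+n 9 h))) ⟩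
    2 ^ (9 + h) + 2 ^ (9 + h) ≡⟨ cong (2 ^ (9 + h) +_) (sym (+-identityʳ _)) ⟩
    2 ^ suc (9 + h) ≡⟨ cong (2 ^_) (sym (+-suc 9 h)) ⟩
    2 ^ (9 + suc h) ∎
    where
    open ≤-Reasoning
    arith : ∀ h → 15 * (2 * (9 + (1 + h)) + 3) ≡ 15 * (2 * (9 + h) + 3) + 30
    arith = solve-∀

  -- s is a power of 2 of order √n with s² > 2n. The part 3 (2 + l) (s + 3) is then at most n, and
  -- one of the two copies of n survives. The condition l ≥ 18 gives h ≥ 9, from where 15 (2h + 3) ≤
  -- 2^h holds.
  many-primes : ∀ {n l} → 18 ≤ l → 2 ^ l ≤ n → n < 2 ^ suc l → n ≤ 6 * l * length (primesBetween n (n + n ∸ 1))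
  many-primes {n} {l} 18≤l 2^l≤n n<2^ = +-cancelˡ-≤ n _ _ (begin
    n + n ≤⟨ 2n≤ {2 + l} 2n≤2^ ⟩
    3 * (2 + l) * (s + 3 + q) ≡⟨ *-distribˡ-+ (3 * (2 + l)) (s + 3) q ⟩
    3 * (2 + l) * (s + 3) + 3 * (2 + l) * q ≤⟨ +-mono-≤ few (*-monoˡ-≤ q 3[2+l]≤) ⟩
    n + 6 * l * q ∎)
    where
    open ≤-Reasoning
    h = l / 2
    s = 2 ^ (2 + h)
    l≡ = m≡m%n+[m/n]*n l 2
    l≤ : l ≤ 2 * h + 1
    l≤ = begin
      l ≡⟨ l≡ ⟩
      l % 2 + h * 2 ≤⟨ +-monoˡ-≤ (h * 2) (s≤s⁻¹ (m%n<n l 2)) ⟩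
      1 + h * 2 ≡⟨ arith h ⟩
      2 * h + 1 ∎
      where
      arith : ∀ h → 1 + h * 2 ≡ 2 * h + 1
      arith = solve-∀
    2h≤l : h + h ≤ l
    2h≤l = ≤-trans (≤-reflexive (arith h)) (≤-trans (m≤n+m (h * 2) (l % 2)) (≤-reflexive (sym l≡)))
      where
      arith : ∀ h → h + h ≡ h * 2
      arith = solve-∀
    9≤h : 9 ≤ h
    9≤h = s≤s⁻¹ (*-cancelˡ-< 2 9 (suc h) (≤-trans (s≤s 18≤l) (≤-trans (s≤s l≤) (≤-reflexive (arith h)))))
      where
      arith : ∀ h → 1 + (2 * h + 1) ≡ 2 * (1 + h)
      arith = solve-∀
    3≤n : 3 ≤ n
    3≤n = ≤-trans (≤-trans (≤ᵇ⇒≤ 3 (2 ^ 18) _) (^-monoʳ-≤ 2 18≤l)) 2^l≤n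
    2n≤2^ : n + n ≤ 2 ^ (2 + l)
    2n≤2^ = ≤-trans (+-mono-≤ (<⇒≤ n<2^) (<⇒≤ n<2^)) (≤-reflexive (cong (2 ^ suc l +_) (sym (+-identityʳ _))))
    2n<s² : n + n < s * s
    2n<s² = begin-strict
      n + n <⟨ +-mono-< n<2^ n<2^ ⟩
      2 ^ suc l + 2 ^ suc l ≡⟨ cong (2 ^ suc l +_) (sym (+-identityʳ _)) ⟩
      2 ^ (2 + l) ≤⟨ ^-monoʳ-≤ 2 (≤-trans (+-monoʳ-≤ 2 l≤) (≤-trans (n≤1+n _) (≤-reflexive (arith h)))) ⟩
      2 ^ (2 + h + (2 + h)) ≡⟨ ^-distribˡ-+-* 2 (2 + h) (2 + h) ⟩
      s * s ∎
      where
      arith : ∀ h → 1 + (2 + (2 * h + 1)) ≡ 2 + h + (2 + h)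
      arith = solve-∀
    open Bertrand n s 3≤n 2n<s² using (2n≤; q)
    3[2+l]≤ : 3 * (2 + l) ≤ 6 * l
    3[2+l]≤ = ≤-trans (*-monoʳ-≤ 3 (+-monoˡ-≤ l (≤-trans (≤ᵇ⇒≤ 2 18 _) 18≤l))) (≤-reflexive (arith l))
      where
      arith : ∀ l → 3 * (l + l) ≡ 6 * l
      arith = solve-∀
    few : 3 * (2 + l) * (s + 3) ≤ n
    few = begin
      3 * (2 + l) * (s + 3) ≤⟨ *-mono-≤ (*-monoʳ-≤ 3 (≤-trans (+-monoʳ-≤ 2 l≤) (≤-reflexive (arith₁ h)))) s+3≤ ⟩
      3 * (2 * h + 3) * (5 * 2 ^ h) ≡⟨ arith₂ h (2 ^ h) ⟩
      15 * (2 * h + 3) * 2 ^ h ≤⟨ *-monoˡ-≤ (2 ^ h) (subst (λ z → 15 * (2 * z + 3) ≤ 2 ^ z) (m+[n∸m]≡n 9≤h) (15[2h+3]≤2^h (h ∸ 9))) ⟩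
      2 ^ h * 2 ^ h ≡⟨ ^-distribˡ-+-* 2 h h ⟨
      2 ^ (h + h) ≤⟨ ^-monoʳ-≤ 2 2h≤l ⟩
      2 ^ l ≤⟨ 2^l≤n ⟩
      n ∎
      where
      arith₁ : ∀ h → 2 + (2 * h + 1) ≡ 2 * h + 3
      arith₁ = solve-∀
      arith₂ : ∀ h u → 3 * (2 * h + 3) * (5 * u) ≡ 15 * (2 * h + 3) * u
      arith₂ = solve-∀
      s+3≤ : s + 3 ≤ 5 * 2 ^ h
      s+3≤ = begin
        s + 3 ≤⟨ +-monoʳ-≤ s (≤-trans (≤ᵇ⇒≤ 3 (2 ^ 9) _) (^-monoʳ-≤ 2 9≤h)) ⟩
        2 * (2 * 2 ^ h) + 2 ^ h ≡⟨ arith (2 ^ h) ⟩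
        5 * 2 ^ h ∎
        where
        arith : ∀ u → 2 * (2 * u) + u ≡ 5 * u
        arith = solve-∀

  -- The budget of primes: exponents and constants.

  *-^ : ∀ a b n → (a * b) ^ n ≡ a ^ n * b ^ n
  *-^ a b zero    = refl
  *-^ a b (suc n) = trans (cong (a * b *_) (*-^ a b n)) (arith a b (a ^ n) (b ^ n))
    where
    arith : ∀ a b c d → a * b * (c * d) ≡ a * c * (b * d)
    arith = solve-∀

  log₂ : ∀ n → 1 ≤ n → ∃ λ l → 2 ^ l ≤ n × n < 2 ^ suc l
  log₂ (suc zero)    _ = 0 , ≤-refl , ≤-refl
  log₂ (suc (suc n)) _ with log₂ (suc n) (s≤s z≤n)
  ... | l , lo , hi with m≤n⇒m<n∨m≡n hi
  ...   | inj₁ hi′ = l , m≤n⇒m≤1+n lo , hi′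
  ...   | inj₂ e   = suc l , ≤-reflexive (sym e) ,
          subst (_< 2 ^ suc (suc l)) (sym e) (^-monoʳ-< 2 ≤-refl {suc l} {suc (suc l)} ≤-refl)

  n<2^n : ∀ n → n < 2 ^ n
  n<2^n zero    = ≤-refl
  n<2^n (suc n) = ≤-trans (s≤s (n<2^n n)) (≤-trans (+-monoˡ-≤ (2 ^ n) (m^n>0 2 n)) (≤-reflexive (cong (2 ^ n +_) (sym (+-identityʳ _)))))

  n!≤n^n : ∀ n → n ! ≤ n ^ n
  n!≤n^n n = go n ≤-refl
    where
    go : ∀ k → k ≤ n → k ! ≤ n ^ k
    go zero    _   = ≤-refl
    go (suc k) k≤n = *-mono-≤ k≤n (go k (<⇒≤ k≤n))

  module _ (m n : ℕ) (1≤n : 1 ≤ n) where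
    private
      M X : ℕ
      M = 7 + m
      X = 2 * n
      1≤X : 1 ≤ X
      1≤X = ≤-trans 1≤n (m≤m+n n _)

    -- In M-th powers, L² costs X^(m + 1), l costs 2^M X^4, and E has to fit into X²; indeed (m + 1)
    -- + 4 + 2 = M. The two factors 2^M, one from X = 2n and one from l, turn E into 4 E.
    dense-enough : ∀ {E L l} → (4 * E) ^ M < X * X → L ^ (2 * M) ≤ X ^ suc m → l ^ M ≤ 2 ^ M * X ^ 4 → E * (L * L) * l < n
    dense-enough {E} {L} {l} E< L≤ l≤ = ≰⇒> λ n≤ → <-irrefl refl (begin-strict
      X ^ M ≡⟨ *-^ 2 n M ⟩
      2 ^ M * n ^ M ≤⟨ *-monoʳ-≤ (2 ^ M) (^-monoˡ-≤ M n≤) ⟩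
      2 ^ M * (E * (L * L) * l) ^ M ≡⟨ cong (2 ^ M *_) split ⟩
      2 ^ M * (E ^ M * L ^ (2 * M) * l ^ M) ≤⟨ *-monoʳ-≤ (2 ^ M) (*-mono-≤ (*-monoʳ-≤ (E ^ M) L≤) l≤) ⟩
      2 ^ M * (E ^ M * X ^ suc m * (2 ^ M * X ^ 4)) ≡⟨ arith (2 ^ M) (E ^ M) (X ^ suc m) (X ^ 4) ⟩
      2 ^ M * (2 ^ M * E ^ M) * (X ^ suc m * X ^ 4) ≡⟨ cong₂ _*_ base (sym (^-distribˡ-+-* X (suc m) 4)) ⟩
      (4 * E) ^ M * X ^ (suc m + 4) <⟨ *-monoˡ-< (X ^ (suc m + 4)) {{m^n≢0 X (suc m + 4) {{>-nonZero 1≤X}}}} E< ⟩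
      X * X * X ^ (suc m + 4) ≡⟨ *-assoc X X (X ^ (suc m + 4)) ⟩
      X ^ (2 + (suc m + 4)) ≡⟨ cong (X ^_) (exponent m) ⟩
      X ^ M ∎)
      where
      open ≤-Reasoning
      exponent : ∀ m → 2 + (1 + m + 4) ≡ 7 + m
      exponent = solve-∀
      arith : ∀ a e x y → a * (e * x * (a * y)) ≡ a * (a * e) * (x * y)
      arith = solve-∀
      base : 2 ^ M * (2 ^ M * E ^ M) ≡ (4 * E) ^ M
      base = trans (cong (2 ^ M *_) (sym (*-^ 2 E M))) (trans (sym (*-^ 2 (2 * E) M)) (cong (_^ M) (sym (*-assoc 2 2 E))))
      split : (E * (L * L) * l) ^ M ≡ E ^ M * L ^ (2 * M) * l ^ M
      split = trans (*-^ (E * (L * L)) l M) (cong (_* l ^ M) (trans (*-^ E (L * L) M)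
        (cong (E ^ M *_) (trans (cong (λ z → (L * z) ^ M) (sym (*-identityʳ L))) (^-*-assoc L 2 M)))))

    -- Transfers largeness from N to y: log₂ N ≥ 2^v and (log N)^M of order at most y^4 force log₂ y
    -- to be about v M / 4 or more.
    range-lower : ∀ {v l i h} → n ≡ suc i → 2 ^ v ≤ l → l ^ M ≤ 2 ^ M * (3 + i) ^ 4 → n < 2 ^ suc h → v * M ≤ M + 4 * (3 + h)
    range-lower {v} {l} {i} {h} refl 2^v≤l l≤ n< = ^-cancelʳ-≤ 2 ≤-refl (begin
      2 ^ (v * M) ≡⟨ ^-*-assoc 2 v M ⟨
      (2 ^ v) ^ M ≤⟨ ^-monoˡ-≤ M 2^v≤l ⟩
      l ^ M ≤⟨ l≤ ⟩
      2 ^ M * (3 + i) ^ 4 ≤⟨ *-monoʳ-≤ (2 ^ M) (^-monoˡ-≤ 4 (≤-trans 3+i≤ (*-monoʳ-≤ 4 (<⇒≤ n<)))) ⟩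
      2 ^ M * (4 * 2 ^ suc h) ^ 4 ≡⟨ cong (λ z → 2 ^ M * z ^ 4) (sym (^-distribˡ-+-* 2 2 (suc h))) ⟩
      2 ^ M * (2 ^ (3 + h)) ^ 4 ≡⟨ cong (2 ^ M *_) (trans (^-*-assoc 2 (3 + h) 4) (cong (2 ^_) (*-comm (3 + h) 4))) ⟩
      2 ^ M * 2 ^ (4 * (3 + h)) ≡⟨ ^-distribˡ-+-* 2 M (4 * (3 + h)) ⟨
      2 ^ (M + 4 * (3 + h)) ∎)
      where
      open ≤-Reasoning
      3+i≤ : 3 + i ≤ 4 * suc i
      3+i≤ = subst (3 + i ≤_) (arith i) (m≤m+n (3 + i) (1 + 3 * i))
        where
        arith : ∀ i → 3 + i + (1 + 3 * i) ≡ 4 * (1 + i)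
        arith = solve-∀

    small-power : ∀ {e h} → 2 ^ h ≤ n → suc (e * M) ≤ 2 * suc h → ∀ {x} → x ≤ 2 ^ e → x ^ M < X * X
    small-power {e} {h} 2^h≤n eM< {x} x≤ = begin-strict
      x ^ M ≤⟨ ^-monoˡ-≤ M x≤ ⟩
      (2 ^ e) ^ M ≡⟨ ^-*-assoc 2 e M ⟩
      2 ^ (e * M) <⟨ ^-monoʳ-< 2 ≤-refl eM< ⟩
      2 ^ (2 * suc h) ≡⟨ cong (2 ^_) (cong (suc h +_) (+-identityʳ (suc h))) ⟩
      2 ^ (suc h + suc h) ≡⟨ ^-distribˡ-+-* 2 (suc h) (suc h) ⟩
      2 ^ suc h * 2 ^ suc h ≤⟨ *-mono-≤ (*-monoʳ-≤ 2 2^h≤n) (*-monoʳ-≤ 2 2^h≤n) ⟩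
      X * X ∎
      where open ≤-Reasoning

  -- The number of obstructions met by one insertion: a - s itself, and c (a - s) - j g with c and j
  -- running through lists of length 2 L.
  badBound : ℕ → ℕ
  badBound L = suc ((L + L) * (L + L))

  -- 180 = 6 · 5 · 6: one 6 from n ≤ 6 h q, the 5 from `badBound L` ≤ 5 L², the other 6 from r h ≤ 6
  -- l. T is the number of insertions and K = k^T their cost in primes.
  enough-primes : ∀ {n h q T K L l r} → 1 ≤ h → 1 ≤ L → n ≤ 6 * h * q → r * h ≤ 6 * l → 180 * (T * K) * (L * L) * l < n →
    T * (K * (badBound L * r)) < q
  enough-primes {n} {h} {q} {T} {K} {L} {l} {r} 1≤h 1≤L n≤ rh≤ lt = *-cancelˡ-< (6 * h) (T * (K * (badBound L * r))) q scaled
    where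
    arith₁ : ∀ a T K b r → 6 * a * (T * (K * (b * r))) ≡ 6 * (T * K) * (b * (r * a))
    arith₁ = solve-∀
    arith₂ : ∀ a b l → 6 * a * (5 * b * (6 * l)) ≡ 180 * a * b * l
    arith₂ = solve-∀
    arith₃ : ∀ L → L * L + (L + L) * (L + L) ≡ 5 * (L * L)
    arith₃ = solve-∀
    bad≤ : badBound L ≤ 5 * (L * L)
    bad≤ = ≤-trans (+-monoˡ-≤ ((L + L) * (L + L)) (*-mono-≤ 1≤L 1≤L)) (≤-reflexive (arith₃ L))
    bounded : 6 * h * (T * (K * (badBound L * r))) ≤ 180 * (T * K) * (L * L) * l
    bounded = ≤-trans (≤-reflexive (arith₁ h T K (badBound L) r))
      (≤-trans (*-monoʳ-≤ (6 * (T * K)) (*-mono-≤ bad≤ rh≤)) (≤-reflexive (arith₂ (T * K) (L * L) l)))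
    scaled : 6 * h * (T * (K * (badBound L * r))) < 6 * h * q
    scaled = ≤-<-trans bounded (<-≤-trans lt n≤)

  -- 2 L N bounds every obstruction and is at most 2^(4 + 2 l), while n ≥ 2^h; so r = ⌊(4 + 2 l) /
  -- h⌋ prime divisors are the most an obstruction can have.
  divisor-bound : ∀ {N n L l h} .{{_ : NonZero h}} → 1 ≤ l → n ≤ N → N < 2 ^ suc l → L ≤ 2 * n → 2 ^ h ≤ n →
    ∃ λ r → r * h ≤ 6 * l × L * N + L * N < n ^ suc r
  divisor-bound {N} {n} {L} {l} {h} 1≤l n≤N N< L≤ 2^h≤n = r , rh≤ , (begin-strict
    L * N + L * N ≤⟨ +-mono-≤ LN≤ LN≤ ⟩
    2 ^ (3 + 2 * l) + 2 ^ (3 + 2 * l) ≡⟨ cong (2 ^ (3 + 2 * l) +_) (sym (+-identityʳ _)) ⟩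
    2 ^ (4 + 2 * l) <⟨ ^-monoʳ-< 2 ≤-refl 4+2l< ⟩
    2 ^ (h * suc r) ≡⟨ ^-*-assoc 2 h (suc r) ⟨
    (2 ^ h) ^ suc r ≤⟨ ^-monoˡ-≤ (suc r) 2^h≤n ⟩
    n ^ suc r ∎)
    where
    open ≤-Reasoning
    r : ℕ
    r = (4 + 2 * l) / h
    rh≤ : r * h ≤ 6 * l
    rh≤ = ≤-trans (m/n*n≤m (4 + 2 * l) h) (≤-trans (+-monoˡ-≤ (2 * l) (*-monoʳ-≤ 4 1≤l)) (≤-reflexive (arith l)))
      where
      arith : ∀ l → 4 * l + 2 * l ≡ 6 * l
      arith = solve-∀
    4+2l< : 4 + 2 * l < h * suc r
    4+2l< = begin-strict
      4 + 2 * l ≡⟨ m≡m%n+[m/n]*n (4 + 2 * l) h ⟩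
      (4 + 2 * l) % h + r * h <⟨ +-monoˡ-< (r * h) (m%n<n (4 + 2 * l) h) ⟩
      suc r * h ≡⟨ *-comm (suc r) h ⟩
      h * suc r ∎
    LN≤ : L * N ≤ 2 ^ (3 + 2 * l)
    LN≤ = begin
      L * N ≤⟨ *-mono-≤ (≤-trans L≤ (*-monoʳ-≤ 2 (≤-trans n≤N (<⇒≤ N<)))) (<⇒≤ N<) ⟩
      2 ^ (2 + l) * 2 ^ (1 + l) ≡⟨ ^-distribˡ-+-* 2 (2 + l) (1 + l) ⟨
      2 ^ (2 + l + (1 + l)) ≡⟨ cong (2 ^_) (arith l) ⟩
      2 ^ (3 + 2 * l) ∎
      where
      arith : ∀ l → 2 + l + (1 + l) ≡ 3 + 2 * l
      arith = solve-∀

  quadratic≤2^ : ∀ w → (6 + w) * suc (6 + w) + 4 ≤ 2 ^ (6 + w)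
  quadratic≤2^ zero = ≤ᵇ⇒≤ 46 64 _
  quadratic≤2^ (suc w) = begin
    (7 + w) * suc (7 + w) + 4 ≡⟨ arith w ⟩
    (6 + w) * suc (6 + w) + 4 + (14 + 2 * w) ≤⟨ +-monoʳ-≤ ((6 + w) * suc (6 + w) + 4) (subst (14 + 2 * w ≤_) (arith′ w) (m≤m+n _ _)) ⟩
    (6 + w) * suc (6 + w) + 4 + ((6 + w) * suc (6 + w) + 4) ≤⟨ +-mono-≤ (quadratic≤2^ w) (quadratic≤2^ w) ⟩
    2 ^ (6 + w) + 2 ^ (6 + w) ≡⟨ cong (2 ^ (6 + w) +_) (sym (+-identityʳ _)) ⟩
    2 ^ (7 + w) ∎
    where
    open ≤-Reasoning
    arith : ∀ w → (7 + w) * (8 + w) + 4 ≡ (6 + w) * (7 + w) + 4 + (14 + 2 * w)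
    arith = solve-∀
    arith′ : ∀ w → 14 + 2 * w + (32 + 11 * w + w * w) ≡ (6 + w) * (7 + w) + 4
    arith′ = solve-∀

  -- The case k = 1: with h = ⌊log₂ n⌋ there are only h + 4 insertions.
  few-steps : ∀ M .{{_ : NonZero M}} h → (10 + M) * M ≤ h → ∃ λ e → suc (e * M) ≤ 2 * suc h × 4 * (180 * (suc (1 * suc (2 + h)) * 1)) ≤ 2 ^ e
  few-steps M h big = w + w , eM≤ , (begin
    4 * (180 * (suc (1 * suc (2 + h)) * 1)) ≡⟨ arith₁ h ⟩
    720 * (h + 4) ≤⟨ *-mono-≤ 720≤ (+-monoˡ-≤ 4 h≤) ⟩
    2 ^ w * (w * suc w + 4) ≤⟨ *-monoʳ-≤ (2 ^ w) (subst (λ z → z * suc z + 4 ≤ 2 ^ z) (m+[n∸m]≡n {6} (≤-trans (m≤m+n 6 4) 10≤w)) (quadratic≤2^ (w ∸ 6))) ⟩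
    2 ^ w * 2 ^ w ≡⟨ ^-distribˡ-+-* 2 w w ⟨
    2 ^ (w + w) ∎)
    where
    open ≤-Reasoning
    w : ℕ
    w = h / M
    wM≤ : w * M ≤ h
    wM≤ = m/n*n≤m h M
    <wM : h < suc w * M
    <wM = begin-strict
      h ≡⟨ m≡m%n+[m/n]*n h M ⟩
      h % M + w * M <⟨ +-monoˡ-< (w * M) (m%n<n h M) ⟩
      suc w * M ∎
    10+M≤w : 10 + M ≤ w
    10+M≤w = s≤s⁻¹ (*-cancelʳ-< M (10 + M) (suc w) (≤-<-trans big <wM))
    10≤w : 10 ≤ w
    10≤w = ≤-trans (m≤m+n 10 M) 10+M≤w
    h≤ : h ≤ w * suc w
    h≤ = ≤-trans (<⇒≤ <wM) (≤-trans (*-monoʳ-≤ (suc w) (≤-trans (m≤n+m M 10) 10+M≤w)) (≤-reflexive (*-comm (suc w) w)))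
    720≤ : 720 ≤ 2 ^ w
    720≤ = ≤-trans (≤ᵇ⇒≤ 720 1024 _) (^-monoʳ-≤ 2 10≤w)
    arith₁ : ∀ h → 4 * (180 * (suc (1 * suc (2 + h)) * 1)) ≡ 720 * (h + 4)
    arith₁ = solve-∀
    eM≤ : suc ((w + w) * M) ≤ 2 * suc h
    eM≤ = begin
      suc ((w + w) * M) ≡⟨ cong suc (arith₂ w M) ⟩
      suc (2 * (w * M)) ≤⟨ s≤s (*-monoʳ-≤ 2 wM≤) ⟩
      suc (2 * h) ≤⟨ n≤1+n _ ⟩
      suc (suc (2 * h)) ≡⟨ *-suc 2 h ⟨
      2 * suc h ∎
      where
      arith₂ : ∀ w M → (w + w) * M ≡ 2 * (w * M)
      arith₂ = solve-∀

  -- The parameters for at least two classes.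

  module ManyClasses (k κ M : ℕ) (2≤k : 2 ≤ k) (1≤κ : 1 ≤ κ) (k≤ : k ≤ 2 ^ (2 * κ)) (7≤M : 7 ≤ M) where

    -- `κ` stands for ⌊log₂ k⌋ and `M` is of order 1/ε, so P is of order k log k / ε. The
    -- enlargement factor B of the clustering is 2^β.
    P β : ℕ
    P = κ * k * M
    β = 6 * P

    14≤P : 14 ≤ P
    14≤P = *-mono-≤ (*-mono-≤ 1≤κ 2≤k) 7≤M

    instance
      β≢0 : NonZero β
      β≢0 = >-nonZero (*-mono-≤ {1} {6} (s≤s z≤n) (≤-trans (s≤s z≤n) 14≤P))

    M≤P : M ≤ P
    M≤P = m≤n*m M (κ * k) {{>-nonZero (*-mono-≤ 1≤κ (≤-trans (s≤s z≤n) 2≤k))}}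

    -- The exponent t with B^t ≥ 2^(2 + h) ≥ 2 n ≥ L, beyond which no width can grow.
    rounds : ℕ → ℕ
    rounds h = suc ((2 + h) / β)

    bt≥ : ∀ h → 2 + h ≤ β * rounds h
    bt≥ h = ≤-trans (≤-reflexive (m≡m%n+[m/n]*n (2 + h) β))
      (≤-trans (+-monoˡ-≤ ((2 + h) / β * β) (<⇒≤ (m%n<n (2 + h) β))) (≤-reflexive (*-comm (rounds h) β)))

    bt≤ : ∀ h → β * rounds h ≤ β + (2 + h)
    bt≤ h = ≤-trans (≤-reflexive (*-comm β (rounds h))) (+-monoʳ-≤ β (m/n*n≤m (2 + h) β))

    -- Ten bits cover the constant 720, and T (1 + 2 κ) bits cover T k^T since T < 2^T and k ≤ 2^(2
    -- κ). The dominant part of 2 e M is 6 T κ M, about 6 P t = β t and so about h; this dictates β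
    -- = 6 P.
    few-steps-many : ∀ h → 17 * P ≤ h → let T = suc (k * suc (rounds h)) in
      ∃ λ e → suc (e * M) ≤ 2 * suc h × 4 * (180 * (T * k ^ T)) ≤ 2 ^ e
    few-steps-many h big = 10 + T * (1 + 2 * κ) , eM≤ , (begin
      4 * (180 * (T * k ^ T)) ≡⟨ arith₁ (T * k ^ T) ⟩
      720 * (T * k ^ T) ≤⟨ *-mono-≤ (≤ᵇ⇒≤ 720 1024 _) (*-mono-≤ (<⇒≤ (n<2^n T)) (^-monoˡ-≤ T k≤)) ⟩
      1024 * (2 ^ T * (2 ^ (2 * κ)) ^ T) ≡⟨ cong (λ z → 1024 * (2 ^ T * z)) (^-*-assoc 2 (2 * κ) T) ⟩
      1024 * (2 ^ T * 2 ^ (2 * κ * T)) ≡⟨ cong (1024 *_) (^-distribˡ-+-* 2 T (2 * κ * T)) ⟨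
      2 ^ 10 * 2 ^ (T + 2 * κ * T) ≡⟨ ^-distribˡ-+-* 2 10 (T + 2 * κ * T) ⟨
      2 ^ (10 + (T + 2 * κ * T)) ≡⟨ cong (λ z → 2 ^ (10 + z)) (arith₂ T κ) ⟩
      2 ^ (10 + T * (1 + 2 * κ)) ∎)
      where
      open ≤-Reasoning
      t T : ℕ
      t = rounds h
      T = suc (k * suc t)
      arith₁ : ∀ x → 4 * (180 * x) ≡ 720 * x
      arith₁ = solve-∀
      arith₂ : ∀ T κ → T + 2 * κ * T ≡ T * (1 + 2 * κ)
      arith₂ = solve-∀
      TκM≤ : T * (κ * M) ≤ 2 * P + P * t
      TκM≤ = begin
        T * (κ * M) ≡⟨ arith k t κ M ⟩
        1 * (κ * M) + (κ * k * M + κ * k * M * t) ≤⟨ +-monoˡ-≤ _ (*-monoˡ-≤ (κ * M) (≤-trans (s≤s z≤n) 2≤k)) ⟩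
        k * (κ * M) + (P + P * t) ≡⟨ arith′ k κ M t ⟩
        2 * P + P * t ∎
        where
        arith : ∀ k t κ M → (1 + k * (1 + t)) * (κ * M) ≡ 1 * (κ * M) + (κ * k * M + κ * k * M * t)
        arith = solve-∀
        arith′ : ∀ k κ M t → k * (κ * M) + (κ * k * M + κ * k * M * t) ≡ 2 * (κ * k * M) + κ * k * M * t
        arith′ = solve-∀
      eM≤ : suc ((10 + T * (1 + 2 * κ)) * M) ≤ 2 * suc h
      eM≤ = *-cancelˡ-≤ 2 (begin
        2 * suc ((10 + T * (1 + 2 * κ)) * M) ≤⟨ *-monoʳ-≤ 2 (s≤s (*-monoˡ-≤ M (+-monoʳ-≤ 10 (*-monoʳ-≤ T (≤-trans (+-monoˡ-≤ (2 * κ) 1≤κ) (≤-reflexive (arith₃ κ))))))) ⟩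
        2 * suc ((10 + T * (3 * κ)) * M) ≡⟨ arith₄ T κ M ⟩
        2 + 20 * M + 6 * (T * (κ * M)) ≤⟨ +-mono-≤ (+-monoʳ-≤ 2 (*-monoʳ-≤ 20 M≤P)) (*-monoʳ-≤ 6 TκM≤) ⟩
        2 + 20 * P + 6 * (2 * P + P * t) ≡⟨ arith₅ P t ⟩
        2 + 32 * P + β * t ≤⟨ +-monoʳ-≤ (2 + 32 * P) (bt≤ h) ⟩
        2 + 32 * P + (β + (2 + h)) ≡⟨ arith₆ P h ⟩
        38 * P + (4 + h) ≤⟨ +-monoˡ-≤ (4 + h) (≤-trans (*-monoˡ-≤ P (≤ᵇ⇒≤ 38 51 _)) (≤-trans (≤-reflexive (*-assoc 3 17 P)) (*-monoʳ-≤ 3 big))) ⟩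
        3 * h + (4 + h) ≡⟨ arith₇ h ⟩
        2 * (2 * suc h) ∎)
        where
        arith₃ : ∀ κ → κ + 2 * κ ≡ 3 * κ
        arith₃ = solve-∀
        arith₄ : ∀ T κ M → 2 * suc ((10 + T * (3 * κ)) * M) ≡ 2 + 20 * M + 6 * (T * (κ * M))
        arith₄ = solve-∀
        arith₅ : ∀ P t → 2 + 20 * P + 6 * (2 * P + P * t) ≡ 2 + 32 * P + 6 * P * t
        arith₅ = solve-∀
        arith₆ : ∀ P h → 2 + 32 * P + (6 * P + (2 + h)) ≡ 38 * P + (4 + h)
        arith₆ = solve-∀
        arith₇ : ∀ h → 3 * h + (4 + h) ≡ 2 * (2 * suc h)
        arith₇ = solve-∀

    -- 70 = 4 · 17 + 2, where the extra 2 P absorbs M + 12.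
    range-≥ : ∀ h → 70 * (κ * k) * M ≤ M + 4 * (3 + h) → 17 * P ≤ h
    range-≥ h le = *-cancelˡ-≤ 4 (+-cancelˡ-≤ (2 * P) _ _ (begin
      2 * P + 4 * (17 * P) ≡⟨ arith₁ P ⟩
      70 * P ≡⟨ *-assoc 70 (κ * k) M ⟨
      70 * (κ * k) * M ≤⟨ le ⟩
      M + 4 * (3 + h) ≡⟨ arith₂ M h ⟩
      M + 12 + 4 * h ≤⟨ +-monoˡ-≤ (4 * h) (+-mono-≤ M≤P (≤-trans (≤ᵇ⇒≤ 12 14 _) 14≤P)) ⟩
      P + P + 4 * h ≡⟨ cong (λ z → P + z + 4 * h) (sym (+-identityʳ P)) ⟩
      2 * P + 4 * h ∎))
      where
      open ≤-Reasoning
      arith₁ : ∀ P → 2 * P + 4 * (17 * P) ≡ 70 * P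
      arith₁ = solve-∀
      arith₂ : ∀ M h → M + 4 * (3 + h) ≡ M + 12 + 4 * h
      arith₂ = solve-∀

    -- Serves two purposes: 4 B · B! is below 2^(2^(12 P)), and in the trivial case N is below
    -- 2^(2^(70 κ k)), where 70 κ k ≤ 10 P because M ≥ 7.
    U : ℕ
    U = 20 * P

    factor-≤ : 2 * (2 * (2 ^ β * (2 ^ β) !)) ≤ 2 ^ (2 ^ U ∸ 1)
    factor-≤ = begin
      2 * (2 * (2 ^ β * (2 ^ β) !)) ≤⟨ *-monoʳ-≤ 2 (*-monoʳ-≤ 2 (*-monoʳ-≤ (2 ^ β) (n!≤n^n (2 ^ β)))) ⟩
      2 * (2 * (2 ^ β * (2 ^ β) ^ (2 ^ β))) ≡⟨ cong (λ z → 2 * (2 * (2 ^ β * z))) (^-*-assoc 2 β (2 ^ β)) ⟩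
      2 * (2 * (2 ^ β * 2 ^ (β * 2 ^ β))) ≡⟨ cong (λ z → 2 * (2 * z)) (^-distribˡ-+-* 2 β (β * 2 ^ β)) ⟨
      2 ^ (2 + (β + β * 2 ^ β)) ≤⟨ ^-monoʳ-≤ 2 exponent ⟩
      2 ^ (2 ^ U ∸ 1) ∎
      where
      open ≤-Reasoning
      14≤b : 14 ≤ β
      14≤b = ≤-trans 14≤P (m≤n*m P 6)
      3+b≤ : 3 + β ≤ 2 ^ β
      3+b≤ = subst (λ z → 3 + z ≤ 2 ^ z) (m+[n∸m]≡n {3} (≤-trans (≤ᵇ⇒≤ 3 14 _) 14≤b)) (go (β ∸ 3))
        where
        go : ∀ c → 3 + (3 + c) ≤ 2 ^ (3 + c)
        go zero = ≤ᵇ⇒≤ 6 8 _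
        go (suc c) = ≤-trans (s≤s (go c)) (≤-trans (+-monoˡ-≤ (2 ^ (3 + c)) (m^n>0 2 (3 + c))) (≤-reflexive (cong (2 ^ (3 + c) +_) (sym (+-identityʳ _)))))
      exponent : 2 + (β + β * 2 ^ β) ≤ 2 ^ U ∸ 1
      exponent = ∸-monoˡ-≤ 1 (begin
        3 + (β + β * 2 ^ β) ≤⟨ +-monoˡ-≤ (β * 2 ^ β) 3+b≤ ⟩
        suc β * 2 ^ β ≤⟨ *-monoˡ-≤ (2 ^ β) (n<2^n β) ⟩
        2 ^ β * 2 ^ β ≡⟨ ^-distribˡ-+-* 2 β β ⟨
        2 ^ (β + β) ≤⟨ ^-monoʳ-≤ 2 (≤-trans (≤-reflexive (arith P)) (*-monoˡ-≤ P (≤ᵇ⇒≤ 12 20 _))) ⟩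
        2 ^ U ∎)
        where
        arith : ∀ P → 6 * P + 6 * P ≡ 12 * P
        arith = solve-∀

    half-factor : ℕ
    half-factor = 2 ^ (2 ^ U ∸ 2)

    4≤2^U : 4 ≤ 2 ^ U
    4≤2^U = ^-monoʳ-≤ 2 {2} {U} (≤-trans (≤-trans (≤ᵇ⇒≤ 2 14 _) 14≤P) (m≤n*m P 20))

    2*half-factor : 2 * half-factor ≡ 2 ^ (2 ^ U ∸ 1)
    2*half-factor = cong (2 ^_) (sym (+-∸-assoc 1 {2 ^ U} {2} (≤-trans (≤ᵇ⇒≤ 2 4 _) 4≤2^U)))

    trivial-cover : ∀ {N l} → l < 2 ^ (70 * (κ * k)) → N < 2 ^ suc l → suc N ≤ half-factor * 2
    trivial-cover {N} {l} l< N< = begin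
      suc N ≤⟨ N< ⟩
      2 ^ suc l ≤⟨ ^-monoʳ-≤ 2 l< ⟩
      2 ^ (2 ^ (70 * (κ * k))) ≤⟨ ^-monoʳ-≤ 2 (∸-monoˡ-≤ 1 (begin
        suc (2 ^ (70 * (κ * k))) ≤⟨ ^-monoʳ-< 2 ≤-refl v<U ⟩
        2 ^ U ∎)) ⟩
      2 ^ (2 ^ U ∸ 1) ≡⟨ 2*half-factor ⟨
      2 * half-factor ≡⟨ *-comm 2 half-factor ⟩
      half-factor * 2 ∎
      where
      open ≤-Reasoning
      v<U : 70 * (κ * k) < U
      v<U = begin-strict
        70 * (κ * k) ≡⟨ arith₁ (κ * k) ⟩
        10 * (κ * k * 7) ≤⟨ *-monoʳ-≤ 10 (*-monoʳ-≤ (κ * k) 7≤M) ⟩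
        10 * P <⟨ *-monoˡ-< P {{>-nonZero (≤-trans (s≤s z≤n) 14≤P)}} (≤ᵇ⇒≤ 11 20 _) ⟩
        20 * P ∎
        where
        arith₁ : ∀ x → 70 * x ≡ 10 * (x * 7)
        arith₁ = solve-∀

    -- 8 · 20 = 160 < 161. The 8 = 2 · 4 comes from log k ≥ κ / 2 and 1/ε ≥ M / 4.
    constant-≥ : 8 * U < 161 * k * κ * M
    constant-≥ = begin-strict
      8 * (20 * P) ≡⟨ *-assoc 8 20 P ⟨
      160 * P <⟨ *-monoˡ-< P {{>-nonZero (≤-trans (s≤s z≤n) 14≤P)}} (n<1+n 160) ⟩
      161 * P ≡⟨ arith k κ M ⟩
      161 * k * κ * M ∎
      where
      open ≤-Reasoning
      arith : ∀ k κ M → 161 * (κ * k * M) ≡ 161 * k * κ * M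
      arith = solve-∀

  range-≥-initial : ∀ M h → 1 ≤ M → (60 + 4 * M) * M ≤ M + 4 * (3 + h) → (10 + M) * M ≤ h
  range-≥-initial M h 1≤M le = *-cancelˡ-≤ 4 (+-cancelˡ-≤ (M + 12) _ _ (begin
    M + 12 + 4 * ((10 + M) * M) ≤⟨ +-monoˡ-≤ _ (+-monoʳ-≤ M (*-monoʳ-≤ 12 1≤M)) ⟩
    M + 12 * M + 4 * ((10 + M) * M) ≤⟨ m≤m+n _ (7 * M) ⟩
    M + 12 * M + 4 * ((10 + M) * M) + 7 * M ≡⟨ arith₁ M ⟩
    (60 + 4 * M) * M ≤⟨ le ⟩
    M + 4 * (3 + h) ≡⟨ arith₂ M h ⟩
    M + 12 + 4 * h ∎))
    where
    open ≤-Reasoning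
    arith₁ : ∀ M → M + 12 * M + 4 * ((10 + M) * M) + 7 * M ≡ (60 + 4 * M) * M
    arith₁ = solve-∀
    arith₂ : ∀ M h → M + 4 * (3 + h) ≡ M + 12 + 4 * h
    arith₂ = solve-∀

-- Classes of points and their growth under insertion.

open import Algebra.Bundles using (AbelianGroup)
import Algebra.Definitions.RawMonoid as RawMonoidDefs
open import Data.Empty using (⊥; ⊥-elim)
open import Data.Fin.Base as Fin using (Fin; suc; zero; toℕ)
import Data.Fin.Properties as Fin
open import Data.Integer.Base as ℤ using (ℤ; +_; ∣_∣)
open import Data.Integer.Divisibility.Signed as ℤ∣ using (∣ᵤ⇒∣; ∣⇒∣ᵤ)
import Data.Integer.Properties as ℤ
import Data.Integer.Tactic.RingSolver as ℤSolver
open import Data.List.Base as List using (List; []; _∷_; _++_; length; map; upTo; cartesianProduct; filter; deduplicate)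
open import Data.List.Membership.Propositional using () renaming (_∈_ to _∈ₗ_)
open import Data.List.Membership.Propositional.Properties using (∈-map⁺; ∈-++⁺ˡ; ∈-++⁺ʳ; ∈-upTo⁺; ∈-cartesianProduct⁺; ∈-filter⁻)
open import Data.List.Properties using (length-map; length-++; length-upTo; length-deduplicate)
open import Data.List.Relation.Unary.All as All using (All; []; _∷_)
import Data.List.Relation.Unary.All.Properties as All
open import Data.List.Relation.Unary.Any as Any using (Any; here; there; any?)
import Data.List.Relation.Unary.Any.Properties as Any
open import Data.List.Relation.Unary.Unique.Propositional using (Unique)
open import Data.List.Relation.Unary.Unique.Propositional.Properties using (filter⁺)
open import Data.Nat.Base
open import Data.Nat.Coprimality using (coprime-divisor; gcd≡1⇒coprime)
open import Data.Nat.Divisibility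
open import Data.Nat.GCD
open import Data.Nat.Primality
open import Data.Nat.Properties
import Data.Nat.Tactic.RingSolver as ℕSolver
open import Data.Product.Base using (∃; ∃₂; _×_; _,_; proj₁; proj₂; Σ)
open import Data.Sum.Base using (_⊎_; inj₁; inj₂)
open import Data.Unit.Base using (⊤; tt)
open import Defs
open import Function.Base using (_∘_)
open import Relation.Binary.PropositionalEquality
open import Relation.Nullary.Decidable using (Dec; yes; no; ¬?; _×-dec_)
open import Relation.Nullary.Negation using (¬_)
open import Relation.Unary using (Decidable)
open Arithmetic

-- What is known of a class of points lying in one progression modulo
-- many primes: `line s g w` means that the class is contained in
-- s + g [-w , w], with both g and w forced by the points seen so far.
data Class : Set where
  empty  : Class
  single : (s : ℕ) → Class
  line   : (s g w : ℕ) → Class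

infix 6 _⊝_
_⊝_ : ℕ → ℕ → ℤ
a ⊝ s = + a ℤ.- + s

-- With G = gcd (g, x), the old range g [-w, w] is G [-(w g / G), w g / G] and the new point sits at
-- distance (x / G) G; the new width is the larger of the two multiples.
insert : Class → ℕ → Class
insert empty        a = single a
insert (single s)   a = line s ∣ a ⊝ s ∣ 1
insert (line s g w) a = line s (gcd g x) (w * quotient (gcd[m,n]∣m g x) ⊔ quotient (gcd[m,n]∣n g x))
  where x = ∣ a ⊝ s ∣

-- The points whose insertion does not necessarily enlarge w by a factor B.
Covered : (B D : ℕ) → Class → ℕ → Set
Covered B D empty        a = ⊥
Covered B D (single s)   a = a ≡ s
Covered B D (line s g w) a = g ∣ D * ∣ a ⊝ s ∣ × ∣ a ⊝ s ∣ ≤ B * (g * w)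

covered? : ∀ B D c → Decidable (Covered B D c)
covered? B D empty        a = no λ ()
covered? B D (single s)   a = a ≟ s
covered? B D (line s g w) a = (g ∣? _) ×-dec (_ ≤? _)

Bounded : ℕ → Class → Set
Bounded N empty        = ⊤
Bounded N (single s)   = s ≤ N
Bounded N (line s g w) = s ≤ N × 1 ≤ g × g ≤ N × 1 ≤ w

-- Arranged so that every insertion of an uncovered point raises the level by one. The first two
-- insertions only create the base point and the gap, with w = 1 = B^0; from then on w grows by the
-- factor B.
Level : ℕ → Class → ℕ → Set
Level B empty        l = l ≡ 0
Level B (single s)   l = l ≡ 1
Level B (line s g w) l = ∃ λ t → l ≡ 2 + t × B ^ t ≤ w

-- g w is the reach of a line and never decreases. For a single class this keeps the whole span
-- between the extreme points covered while g shrinks.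
data _⊑_ : Class → Class → Set where
  nonline : ∀ {c c′} → (∀ s g w → c ≢ line s g w) → c ⊑ c′
  line    : ∀ {s g w g′ w′} → g * w ≤ g′ * w′ → line s g w ⊑ line s g′ w′

⊑-refl : ∀ {c} → c ⊑ c
⊑-refl {empty}      = nonline λ _ _ _ ()
⊑-refl {single s}   = nonline λ _ _ _ ()
⊑-refl {line s g w} = line ≤-refl

⊑-trans : ∀ {a b c} → a ⊑ b → b ⊑ c → a ⊑ c
⊑-trans (nonline f) _ = nonline f
⊑-trans (line e) (nonline f) = ⊥-elim (f _ _ _ refl)
⊑-trans (line e) (line f) = line (≤-trans e f)

∣⊝∣≤ : ∀ {a s N} → a ≤ N → s ≤ N → ∣ a ⊝ s ∣ ≤ N
∣⊝∣≤ {a} {s} a≤N s≤N = ≤-trans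
  (subst (λ z → ∣ z ∣ ≤ a ⊔ s) (sym (ℤ.m-n≡m⊖n a s)) (ℤ.∣m⊝n∣≤m⊔n a s)) (⊔-lub a≤N s≤N)

⊝≡0⇒≡ : ∀ {a s} → ∣ a ⊝ s ∣ ≡ 0 → a ≡ s
⊝≡0⇒≡ {a} {s} e = ℤ.+-injective (ℤ.i-j≡0⇒i≡j (+ a) (+ s) (ℤ.∣i∣≡0⇒i≡0 e))

module _ {g x : ℕ} (1≤g : 1 ≤ g) where
  private
    G = gcd g x
    g₁ = quotient (gcd[m,n]∣m g x)
    a₁ = quotient (gcd[m,n]∣n g x)
    instance
      g≢0 : NonZero g
      g≢0 = >-nonZero 1≤g

  gcd-nonZero : NonZero G
  gcd-nonZero = ≢-nonZero (gcd[m,n]≢0 g x (inj₁ (≢-nonZero⁻¹ g)))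

  gcd-left : g ≡ g₁ * G
  gcd-left = _∣_.equality (gcd[m,n]∣m g x)

  gcd-right : x ≡ a₁ * G
  gcd-right = _∣_.equality (gcd[m,n]∣n g x)

  quotient-nonZero : NonZero g₁
  quotient-nonZero = ≢-nonZero λ e → ≢-nonZero⁻¹ g (trans gcd-left (cong (_* G) e))

  quotients-coprime : ∀ {c} → g₁ ∣ a₁ * c → g₁ ∣ c
  quotients-coprime = coprime-divisor (gcd≡1⇒coprime (*-cancelʳ-≡ _ 1 G {{gcd-nonZero}} (begin
    gcd g₁ a₁ * G ≡⟨ *-comm (gcd g₁ a₁) G ⟩
    G * gcd g₁ a₁ ≡⟨ c*gcd[m,n]≡gcd[cm,cn] G g₁ a₁ ⟩
    gcd (G * g₁) (G * a₁) ≡⟨ cong₂ gcd (trans (*-comm G g₁) (sym gcd-left)) (trans (*-comm G a₁) (sym gcd-right)) ⟩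
    G ≡⟨ *-identityˡ G ⟨
    1 * G ∎)))
    where open ≡-Reasoning

insert-bounded : ∀ {N c a B D} → a ≤ N → Bounded N c → ¬ Covered B D c a → Bounded N (insert c a)
insert-bounded {c = empty} a≤N _ _ = a≤N
insert-bounded {c = single s} {a} a≤N s≤N ¬cov =
  s≤N , n≢0⇒n>0 (λ e → ¬cov (⊝≡0⇒≡ e)) , ∣⊝∣≤ {a} {s} a≤N s≤N , ≤-refl
insert-bounded {c = line s g w} {a} a≤N (s≤N , 1≤g , g≤N , 1≤w) _ =
  s≤N , >-nonZero⁻¹ _ {{gcd-nonZero 1≤g}} , ≤-trans (∣⇒≤ {{>-nonZero 1≤g}} (gcd[m,n]∣m g ∣ a ⊝ s ∣)) g≤N ,
  ≤-trans (*-mono-≤ 1≤w (>-nonZero⁻¹ _ {{quotient-nonZero {x = ∣ a ⊝ s ∣} 1≤g}})) (m≤m⊔n _ _)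

insert-⊑ : ∀ {N} c a → Bounded N c → c ⊑ insert c a
insert-⊑ empty a _ = nonline λ _ _ _ ()
insert-⊑ (single s) a _ = nonline λ _ _ _ ()
insert-⊑ (line s g w) a (_ , 1≤g , _) = line (begin
  g * w ≡⟨ cong (_* w) (gcd-left 1≤g) ⟩
  g₁ * G * w ≡⟨ arith g₁ G w ⟩
  G * (w * g₁) ≤⟨ *-monoʳ-≤ G (m≤m⊔n (w * g₁) _) ⟩
  G * (w * g₁ ⊔ _) ∎)
  where
  open ≤-Reasoning
  G = gcd g ∣ a ⊝ s ∣
  g₁ = quotient (gcd[m,n]∣m g ∣ a ⊝ s ∣)
  arith : ∀ u v w → u * v * w ≡ v * (w * u)
  arith = ℕSolver.solve-∀

module _ {B D} (B-divides : ∀ d → 1 ≤ d → d < B → d ∣ D) where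

  -- Let g₁ = g / G and a₁ = x / G. If g₁ < B then g₁ divides D, so g = g₁ G divides D x; thus
  -- failing the divisibility means g₁ ≥ B. If the distance fails instead, a₁ G = x > B g w ≥ B w G.
  -- Either way the new width is at least B w.
  insert-level : ∀ {N c a l} → Bounded N c → Level B c l → ¬ Covered B D c a → Level B (insert c a) (suc l)
  insert-level {c = empty}    _ refl _ = refl
  insert-level {c = single s} _ refl _ = 0 , refl , ≤-refl
  insert-level {c = line s g w} {a} (_ , 1≤g , _ , 1≤w) (t , refl , B^t≤w) ¬cov =
    suc t , refl , ≤-trans (*-monoʳ-≤ B B^t≤w) Bw≤
    where
    x = ∣ a ⊝ s ∣
    G = gcd g x
    g₁ = quotient (gcd[m,n]∣m g x)
    a₁ = quotient (gcd[m,n]∣n g x)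
    open ≤-Reasoning
    rearrange : ∀ B w G → B * w * G ≡ B * (G * w)
    rearrange = ℕSolver.solve-∀
    Bw≤ : B * w ≤ w * g₁ ⊔ a₁
    Bw≤ with g ∣? D * x
    ... | yes g∣ with B * w ≤? a₁
    ...   | yes le = ≤-trans le (m≤n⊔m _ _)
    ...   | no  nle = ⊥-elim (¬cov (g∣ , (begin
      x ≡⟨ gcd-right 1≤g ⟩
      a₁ * G ≤⟨ *-monoˡ-≤ G (<⇒≤ (≰⇒> nle)) ⟩
      B * w * G ≡⟨ rearrange B w G ⟩
      B * (G * w) ≤⟨ *-monoʳ-≤ B (*-monoˡ-≤ w (∣⇒≤ {{>-nonZero 1≤g}} (gcd[m,n]∣m g x))) ⟩
      B * (g * w) ∎)))
    Bw≤ | no ¬g∣ with B ≤? g₁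
    ...   | yes le = begin
      B * w ≡⟨ *-comm B w ⟩
      w * B ≤⟨ *-monoʳ-≤ w le ⟩
      w * g₁ ≤⟨ m≤m⊔n _ _ ⟩
      _ ∎
    ...   | no nle = ⊥-elim (¬g∣ (subst₂ _∣_ (sym (gcd-left 1≤g))
        (trans (*-assoc D a₁ G) (cong (D *_) (sym (gcd-right 1≤g))))
        (*-monoˡ-∣ G (∣m⇒∣m*n a₁ (B-divides g₁ (>-nonZero⁻¹ g₁ {{quotient-nonZero 1≤g}}) (≰⇒> nle))))))

-- Obstructions and bad primes.

ints : ℕ → List ℤ
ints L = map +_ (upTo L) ++ map (λ n → ℤ.- (+ n)) (upTo L)

length-ints : ∀ L → length (ints L) ≡ L + L
length-ints L = trans (length-++ (map +_ (upTo L)))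
  (cong₂ _+_ (trans (length-map +_ (upTo L)) (length-upTo L))
             (trans (length-map (λ n → ℤ.- (+ n)) (upTo L)) (length-upTo L)))

∈-ints : ∀ {L} j → ∣ j ∣ < L → j ∈ₗ ints L
∈-ints {L} (+ n) lt = ∈-++⁺ˡ (∈-map⁺ +_ (∈-upTo⁺ lt))
∈-ints {L} ℤ.-[1+ n ] lt = ∈-++⁺ʳ (map +_ (upTo L)) (∈-map⁺ (λ n → ℤ.- (+ n)) (∈-upTo⁺ lt))

obstructions : ℕ → ℤ → ℕ → List ℤ
obstructions L x g = x ∷ map (λ cj → proj₁ cj ℤ.* x ℤ.- proj₂ cj ℤ.* + g) (cartesianProduct (ints L) (ints L))

length-cartesianProduct : {A B : Set} (xs : List A) (ys : List B) →
  length (cartesianProduct xs ys) ≡ length xs * length ys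
length-cartesianProduct []       ys = refl
length-cartesianProduct (x ∷ xs) ys = trans (length-++ (map (x ,_) ys))
  (cong₂ _+_ (length-map (x ,_) ys) (length-cartesianProduct xs ys))

length-obstructions : ∀ L x g → length (obstructions L x g) ≡ badBound L
length-obstructions L x g = cong suc (trans (length-map _ (cartesianProduct (ints L) (ints L)))
  (trans (length-cartesianProduct (ints L) (ints L)) (cong₂ _*_ (length-ints L) (length-ints L))))

obstructionsAt : ℕ → Class → ℕ → List ℤ
obstructionsAt L empty        a = []
obstructionsAt L (single s)   a = obstructions L (a ⊝ s) 0
obstructionsAt L (line s g w) a = obstructions L (a ⊝ s) g

length-obstructionsAt : ∀ L c a → length (obstructionsAt L c a) ≤ badBound L
length-obstructionsAt L empty        a = z≤n
length-obstructionsAt L (single s)   a = ≤-reflexive (length-obstructions L (a ⊝ s) 0)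
length-obstructionsAt L (line s g w) a = ≤-reflexive (length-obstructions L (a ⊝ s) g)

-- The bound |X| < M belongs to the definition, so that each entry of the list has few such primes
-- whatever its size. Where an obstruction is used, its size is checked separately.
Divides : ℕ → ℤ → ℕ → Set
Divides M X p = ∣ X ∣ ≢ 0 × ∣ X ∣ < M × p ∣ ∣ X ∣

divides? : ∀ M X p → Dec (Divides M X p)
divides? M X p = ¬? (∣ X ∣ ≟ 0) ×-dec ((∣ X ∣ <? M) ×-dec (p ∣? ∣ X ∣))

-- Outside these primes, congruences between small multiples are equalities.
Bad : (M L : ℕ) → Class → ℕ → ℕ → Set
Bad M L c a p = Any (λ X → Divides M X p) (obstructionsAt L c a)

bad? : ∀ M L c a p → Dec (Bad M L c a p)
bad? M L c a p = any? (λ X → divides? M X p) (obstructionsAt L c a)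

count-bad : ∀ {n Q r} → Unique Q → All Prime Q → All (n ≤_) Q → ∀ L c a →
            count (bad? (n ^ suc r) L c a) Q ≤ badBound L * r
count-bad {n} {Q} {r} u primes n≤ L c a =
  ≤-trans (count-any-≤ (divides? (n ^ suc r)) (obstructionsAt L c a) Q each)
          (*-monoˡ-≤ r (length-obstructionsAt L c a))
  where
  each : ∀ X → count (divides? (n ^ suc r) X) Q ≤ r
  each X = by (∣ X ∣ ≟ 0) (∣ X ∣ <? n ^ suc r)
    where
    by : Dec (∣ X ∣ ≡ 0) → Dec (∣ X ∣ < n ^ suc r) → count (divides? (n ^ suc r) X) Q ≤ r
    by (yes e) _       = ≤-trans (≤-reflexive (count-none (divides? (n ^ suc r) X) (λ _ d → proj₁ d e) Q)) z≤n
    by (no _)  (no e)  = ≤-trans (≤-reflexive (count-none (divides? (n ^ suc r) X) (λ _ d → e (proj₁ (proj₂ d))) Q)) z≤n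
    by (no ≢0) (yes lt) = ≤-trans
      (count-mono (divides? (n ^ suc r) X) (_∣? ∣ X ∣) (λ d → proj₂ (proj₂ d)) Q)
      (count-primes-∣ ∣ X ∣ u primes n≤ {{≢-nonZero ≢0}} lt)

good⇒≡0 : ∀ M L c a {p} X → ¬ Bad M L c a p → X ∈ₗ obstructionsAt L c a → ∣ X ∣ < M → p ∣ ∣ X ∣ → ∣ X ∣ ≡ 0
good⇒≡0 M L c a X good X∈ lt p∣ with ∣ X ∣ ≟ 0
... | yes e = e
... | no ≢0 = ⊥-elim (good (Any.map (λ { refl → ≢0 , lt , p∣ }) X∈))

∣-combination : ∀ {p x g d} c j → + p ℤ∣.∣ x ℤ.- j ℤ.* d → + p ℤ∣.∣ + g ℤ.- c ℤ.* d →
                p ∣ ∣ c ℤ.* x ℤ.- j ℤ.* + g ∣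
∣-combination {p} {x} {g} {d} c j p∣x-jd p∣g-cd = ∣⇒∣ᵤ (subst (+ p ℤ∣.∣_) (eq c x j d (+ g))
  (ℤ∣.∣m∣n⇒∣m-n (ℤ∣.∣n⇒∣m*n c p∣x-jd) (ℤ∣.∣n⇒∣m*n j p∣g-cd)))
  where
  eq : ∀ c x j d g → c ℤ.* (x ℤ.- j ℤ.* d) ℤ.- j ℤ.* (g ℤ.- c ℤ.* d) ≡ c ℤ.* x ℤ.- j ℤ.* g
  eq = ℤSolver.solve-∀

-- Passing from g to gcd (g , x) divides the multiplier c by g / gcd (g , x).
descend : ∀ {p L w g G g₁ a₁ c j d x} → Prime p → L ≤ p → 1 ≤ w → ∣ c ∣ ≢ 0 → ∣ c ∣ * w < L → ∣ j ∣ < L →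
  c ℤ.* x ≡ j ℤ.* + g → g ≡ g₁ * G → ∣ x ∣ ≡ a₁ * G → NonZero G → NonZero g₁ →
  (∀ {e} → g₁ ∣ a₁ * e → g₁ ∣ e) → + p ℤ∣.∣ + g ℤ.- c ℤ.* d →
  ∃ λ c′ → ∣ c′ ∣ ≢ 0 × ∣ c′ ∣ * (w * g₁ ⊔ a₁) < L × + p ℤ∣.∣ + G ℤ.- c′ ℤ.* d
descend {p} {L} {w} {g} {G} {g₁} {a₁} {c} {j} {d} {x} p-prime L≤p 1≤w c≢0 cw<L j<L cx≡jg g≡ x≡ G≢0 g₁≢0
  coprime p∣g-cd = with-quotient (∣ᵤ⇒∣ g₁∣c)
  where
  -- This is c x = j g with G cancelled. Coprimality of g₁ and a₁ makes g₁ a divisor of c, and for c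
  -- = c′ g₁ it then reads |c′| a₁ = |j| < L, which bounds the second candidate for the new width.
  absolute : a₁ * ∣ c ∣ ≡ ∣ j ∣ * g₁
  absolute = *-cancelʳ-≡ _ _ G {{G≢0}} (begin
    a₁ * ∣ c ∣ * G ≡⟨ eq a₁ ∣ c ∣ G ⟩
    ∣ c ∣ * (a₁ * G) ≡⟨ cong (∣ c ∣ *_) x≡ ⟨
    ∣ c ∣ * ∣ x ∣ ≡⟨ ℤ.abs-* c x ⟨
    ∣ c ℤ.* x ∣ ≡⟨ cong ∣_∣ cx≡jg ⟩
    ∣ j ℤ.* + g ∣ ≡⟨ ℤ.abs-* j (+ g) ⟩
    ∣ j ∣ * g ≡⟨ cong (∣ j ∣ *_) g≡ ⟩
    ∣ j ∣ * (g₁ * G) ≡⟨ *-assoc ∣ j ∣ g₁ G ⟨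
    ∣ j ∣ * g₁ * G ∎)
    where
    open ≡-Reasoning
    eq : ∀ a b c → a * b * c ≡ b * (a * c)
    eq = ℕSolver.solve-∀
  g₁∣c : g₁ ∣ ∣ c ∣
  g₁∣c = coprime (divides ∣ j ∣ absolute)
  p∤g₁ : ¬ p ∣ g₁
  p∤g₁ p∣ = <-irrefl refl (begin-strict
    p ≤⟨ ∣⇒≤ {{g₁≢0}} p∣ ⟩
    g₁ ≤⟨ ∣⇒≤ {{≢-nonZero c≢0}} g₁∣c ⟩
    ∣ c ∣ ≤⟨ m≤m*n ∣ c ∣ w {{>-nonZero 1≤w}} ⟩
    ∣ c ∣ * w <⟨ cw<L ⟩
    L ≤⟨ L≤p ⟩
    p ∎)
    where open ≤-Reasoning
  with-quotient : + g₁ ℤ∣.∣ c →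
    ∃ λ c′ → ∣ c′ ∣ ≢ 0 × ∣ c′ ∣ * (w * g₁ ⊔ a₁) < L × + p ℤ∣.∣ + G ℤ.- c′ ℤ.* d
  with-quotient (ℤ∣.divides c′ c≡) = c′ , c′≢0 , c′w′<L , p∣G-c′d
    where
    ∣c∣≡ : ∣ c ∣ ≡ ∣ c′ ∣ * g₁
    ∣c∣≡ = trans (cong ∣_∣ c≡) (ℤ.abs-* c′ (+ g₁))
    c′≢0 : ∣ c′ ∣ ≢ 0
    c′≢0 e = c≢0 (trans ∣c∣≡ (cong (_* g₁) e))
    ∣c′∣a₁ : ∣ c′ ∣ * a₁ ≡ ∣ j ∣
    ∣c′∣a₁ = *-cancelʳ-≡ _ _ g₁ {{g₁≢0}} (trans (trans (eq ∣ c′ ∣ a₁ g₁) (cong (a₁ *_) (sym ∣c∣≡))) absolute)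
      where
      eq : ∀ a b c → a * b * c ≡ b * (a * c)
      eq = ℕSolver.solve-∀
    c′w′<L : ∣ c′ ∣ * (w * g₁ ⊔ a₁) < L
    c′w′<L = subst (_< L) (sym (*-distribˡ-⊔ ∣ c′ ∣ (w * g₁) a₁)) (⊔-pres-<m
      (subst (_< L) (trans (cong (_* w) ∣c∣≡) (eq ∣ c′ ∣ g₁ w)) cw<L) (subst (_< L) (sym ∣c′∣a₁) j<L))
      where
      eq : ∀ a b c → a * b * c ≡ a * (c * b)
      eq = ℕSolver.solve-∀
    factored : + g ℤ.- c ℤ.* d ≡ + g₁ ℤ.* (+ G ℤ.- c′ ℤ.* d)
    factored = begin
      + g ℤ.- c ℤ.* d ≡⟨ cong₂ (λ u v → u ℤ.- v ℤ.* d) (trans (cong +_ g≡) (ℤ.pos-* g₁ G)) c≡ ⟩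
      + g₁ ℤ.* + G ℤ.- c′ ℤ.* + g₁ ℤ.* d ≡⟨ eq (+ g₁) (+ G) c′ d ⟩
      + g₁ ℤ.* (+ G ℤ.- c′ ℤ.* d) ∎
      where
      open ≡-Reasoning
      eq : ∀ u v c d → u ℤ.* v ℤ.- c ℤ.* u ℤ.* d ≡ u ℤ.* (v ℤ.- c ℤ.* d)
      eq = ℤSolver.solve-∀
    from-factor : (p ∣ g₁) ⊎ (p ∣ (∣ + G ℤ.- c′ ℤ.* d ∣)) → + p ℤ∣.∣ + G ℤ.- c′ ℤ.* d
    from-factor (inj₁ p∣g₁) = ⊥-elim (p∤g₁ p∣g₁)
    from-factor (inj₂ p∣′)  = ∣ᵤ⇒∣ p∣′
    p∣G-c′d : + p ℤ∣.∣ + G ℤ.- c′ ℤ.* d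
    p∣G-c′d = from-factor (euclidsLemma g₁ ∣ + G ℤ.- c′ ℤ.* d ∣ p-prime
      (subst (p ∣_) (ℤ.abs-* (+ g₁) (+ G ℤ.- c′ ℤ.* d)) (∣⇒∣ᵤ (subst (+ p ℤ∣.∣_) factored p∣g-cd))))

-- S p i a says that a lies in the i-th progression modulo p, and δ p i is
-- the common difference of that progression.
module Sieve
  (k L N M : ℕ) (S : ℕ → Fin k → ℕ → Set) (δ : ℕ → Fin k → ℤ)
  where

  Aligned : ℕ → Set
  Aligned p = ∀ i a b → S p i a → S p i b → ∃ λ j → ∣ j ∣ < L × + p ℤ∣.∣ (a ⊝ b) ℤ.- j ℤ.* δ p i

  -- Modulo p, the gap g is a multiple c of δ, with c w within the
  -- length of the progression.
  Fits : ℕ → Fin k → Class → Set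
  Fits p i empty        = ⊤
  Fits p i (single s)   = S p i s
  Fits p i (line s g w) = S p i s × ∃ λ c → ∣ c ∣ ≢ 0 × ∣ c ∣ * w < L × + p ℤ∣.∣ + g ℤ.- c ℤ.* δ p i

  module _ {p : ℕ} (p-prime : Prime p) (L≤p : L ≤ p) (aligned : Aligned p) (LN<M : L * N + L * N < M) where

    private
      fits-single : ∀ {i s a B D} → a ≤ N → s ≤ N → S p i s → S p i a → ¬ Covered B D (single s) a →
                    ¬ Bad M L (single s) a p → Fits p i (insert (single s) a)
      fits-single {i} {s} {a} a≤N s≤N Ss Sa a≢s good with aligned i a s Sa Ss
      ... | j , j<L , p∣ = Ss , c , c≢0 , c<L , p∣g
        where
        x = a ⊝ s
        x<M : ∣ x ∣ < M
        x<M = ≤-<-trans (begin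
          ∣ x ∣ ≤⟨ ∣⊝∣≤ {a} {s} a≤N s≤N ⟩
          N ≡⟨ *-identityˡ N ⟨
          1 * N ≤⟨ *-monoˡ-≤ N (≤-<-trans z≤n j<L) ⟩
          L * N ≤⟨ m≤m+n _ _ ⟩
          L * N + L * N ∎) LN<M
          where open ≤-Reasoning
        -- If j = 0 then p divides a - s, which is itself an obstruction; so a = s, contrary to a
        -- not being covered.
        j≢0 : ∣ j ∣ ≢ 0
        j≢0 e = a≢s (⊝≡0⇒≡ (good⇒≡0 M L (single s) a x good (here refl) x<M (∣⇒∣ᵤ
          (subst (+ p ℤ∣.∣_) (trans (cong (λ z → x ℤ.- z ℤ.* δ p i) (ℤ.∣i∣≡0⇒i≡0 {j} e)) (eq x (δ p i))) p∣))))
          where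
          eq : ∀ x d → x ℤ.- + 0 ℤ.* d ≡ x
          eq = ℤSolver.solve-∀
        -- The gap is the absolute value of a - s, so its multiplier is j or - j.
        signed : ∃ λ c → ∣ c ∣ ≡ ∣ j ∣ × + p ℤ∣.∣ + ∣ x ∣ ℤ.- c ℤ.* δ p i
        signed with ℤ.+∣i∣≡i⊎+∣i∣≡-i x
        ... | inj₁ e = j , refl , subst (λ z → + p ℤ∣.∣ z ℤ.- j ℤ.* δ p i) (sym e) p∣
        ... | inj₂ e = ℤ.- j , ℤ.∣-i∣≡∣i∣ j , subst (+ p ℤ∣.∣_)
              (trans (eq x j (δ p i)) (cong (λ z → z ℤ.- (ℤ.- j) ℤ.* δ p i) (sym e))) (ℤ∣.∣m⇒∣-m p∣)
          where
          eq : ∀ x j d → ℤ.- (x ℤ.- j ℤ.* d) ≡ ℤ.- x ℤ.- (ℤ.- j) ℤ.* d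
          eq = ℤSolver.solve-∀
        c = proj₁ signed
        c≡j = proj₁ (proj₂ signed)
        p∣g = proj₂ (proj₂ signed)
        c≢0 : ∣ c ∣ ≢ 0
        c≢0 e = j≢0 (trans (sym c≡j) e)
        c<L : ∣ c ∣ * 1 < L
        c<L = subst (_< L) (trans (sym c≡j) (sym (*-identityʳ ∣ c ∣))) j<L

      fits-line : ∀ {i s g w a} → a ≤ N → Bounded N (line s g w) → Fits p i (line s g w) → S p i a →
                  ¬ Bad M L (line s g w) a p → Fits p i (insert (line s g w) a)
      fits-line {i} {s} {g} {w} {a} a≤N (s≤N , 1≤g , g≤N , 1≤w) (Ss , c , c≢0 , cw<L , p∣g-cd) Sa good
        with aligned i a s Sa Ss
      ... | j , j<L , p∣x-jd = Ss ,
        descend {c = c} {j} {d} {x} p-prime L≤p 1≤w c≢0 cw<L j<L cx≡jg (gcd-left 1≤g) (gcd-right 1≤g)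
          (gcd-nonZero {x = ∣ a ⊝ s ∣} 1≤g) (quotient-nonZero {x = ∣ a ⊝ s ∣} 1≤g)
          (quotients-coprime {x = ∣ a ⊝ s ∣} 1≤g) p∣g-cd
        where
        d = δ p i
        x = a ⊝ s
        X = c ℤ.* x ℤ.- j ℤ.* + g
        c<L : ∣ c ∣ < L
        c<L = ≤-<-trans (m≤m*n ∣ c ∣ w {{>-nonZero 1≤w}}) cw<L
        X<M : ∣ X ∣ < M
        X<M = ≤-<-trans (≤-trans (ℤ.∣i-j∣≤∣i∣+∣j∣ (c ℤ.* x) (j ℤ.* + g))
          (+-mono-≤ (subst (_≤ L * N) (sym (ℤ.abs-* c x)) (*-mono-≤ (<⇒≤ c<L) (∣⊝∣≤ {a} {s} a≤N s≤N)))
                    (subst (_≤ L * N) (sym (ℤ.abs-* j (+ g))) (*-mono-≤ (<⇒≤ j<L) g≤N)))) LN<M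
        cx≡jg : c ℤ.* x ≡ j ℤ.* + g
        cx≡jg = ℤ.i-j≡0⇒i≡j _ _ (ℤ.∣i∣≡0⇒i≡0 (good⇒≡0 M L (line s g w) a X good
          (there (∈-map⁺ (λ cj → proj₁ cj ℤ.* x ℤ.- proj₂ cj ℤ.* + g)
            (∈-cartesianProduct⁺ (∈-ints c c<L) (∈-ints j j<L)))) X<M (∣-combination {x = x} {g} {d} c j p∣x-jd p∣g-cd)))

    insert-fits : ∀ {i c a B D} → a ≤ N → Bounded N c → Fits p i c → S p i a → ¬ Covered B D c a →
                  ¬ Bad M L c a p → Fits p i (insert c a)
    insert-fits {c = empty}      a≤N _   _  Sa _   _    = Sa
    insert-fits {c = single s} {B = B} {D} a≤N s≤N Ss Sa a≢s good = fits-single {B = B} {D} a≤N s≤N Ss Sa a≢s good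
    insert-fits {c = line s g w} a≤N bd  ft Sa _   good = fits-line a≤N bd ft Sa good

-- The clustering process.

Sum : ∀ {n} → (Fin n → ℕ) → ℕ
Sum {zero}  f = 0
Sum {suc n} f = f zero + Sum (f ∘ suc)

Sum-≤ : ∀ {n} (f : Fin n → ℕ) {c} → (∀ i → f i ≤ c) → Sum f ≤ n * c
Sum-≤ {zero}  f f≤ = z≤n
Sum-≤ {suc n} f f≤ = +-mono-≤ (f≤ zero) (Sum-≤ (f ∘ suc) (f≤ ∘ suc))

Sum-increment : ∀ {n} (f g : Fin n → ℕ) i → g i ≡ suc (f i) → (∀ j → j ≢ i → g j ≡ f j) → Sum g ≡ suc (Sum f)
Sum-increment {suc n} f g zero gi gj = cong₂ _+_ gi (same (f ∘ suc) (g ∘ suc) (λ j → gj (suc j) λ ()))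
  where
  same : ∀ {n} (f g : Fin n → ℕ) → (∀ j → g j ≡ f j) → Sum g ≡ Sum f
  same {zero}  f g e = refl
  same {suc n} f g e = cong₂ _+_ (e zero) (same (f ∘ suc) (g ∘ suc) (e ∘ suc))
Sum-increment {suc n} f g (suc i) gi gj = trans
  (cong₂ _+_ (gj zero λ ()) (Sum-increment (f ∘ suc) (g ∘ suc) i gi (λ j j≢ → gj (suc j) (j≢ ∘ Fin.suc-injective))))
  (+-suc _ _)

-- How many primes suffice to carry out t insertions among k classes, if at
-- most b primes are bad for each of them.
cost : (k b t : ℕ) → ℕ
cost k b zero    = 0
cost k b (suc t) = k * (cost k b t + b)

cost-≤ : ∀ k b t → 1 ≤ k → cost k b t ≤ t * (k ^ t * b)
cost-≤ k b zero    _   = z≤n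
cost-≤ k b (suc t) 1≤k = begin
  k * (cost k b t + b) ≤⟨ *-monoʳ-≤ k (+-monoˡ-≤ b (cost-≤ k b t 1≤k)) ⟩
  k * (t * (k ^ t * b) + b) ≡⟨ arith k t (k ^ t) b ⟩
  k * b + t * (k * k ^ t * b) ≤⟨ +-monoˡ-≤ _ (*-monoˡ-≤ b (m≤m*n k (k ^ t) {{m^n≢0 k t {{>-nonZero 1≤k}}}})) ⟩
  suc t * (k ^ suc t * b) ∎
  where
  open ≤-Reasoning
  arith : ∀ k t u b → k * (t * (u * b) + b) ≡ k * b + t * (k * u * b)
  arith = ℕSolver.solve-∀

module Cluster
  (k L N n r : ℕ) (S : ℕ → Fin k → ℕ → Set) (S? : ∀ p i a → Dec (S p i a)) (δ : ℕ → Fin k → ℤ)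
  (A : ℕ → Set) (A? : Decidable A) (A≤N : ∀ {a} → A a → a ≤ N)
  (B D t : ℕ) (B-divides : ∀ d → 1 ≤ d → d < B → d ∣ D) (2≤B : 2 ≤ B) (L≤B^t : L ≤ B ^ t)
  (LN< : L * N + L * N < n ^ suc r) (L≤n : L ≤ n)
  where

  open Sieve k L N (n ^ suc r) S δ

  record Usable (Q : List ℕ) : Set where
    field
      unique  : Unique Q
      primes  : All Prime Q
      large   : All (n ≤_) Q
      aligned : All Aligned Q
      hits    : ∀ {a} → A a → All (λ p → ∃ λ i → S p i a) Q
  open Usable

  usable-filter : ∀ {Q} {P : ℕ → Set} (P? : Decidable P) → Usable Q → Usable (filter P? Q)
  usable-filter P? u = record
    { unique  = filter⁺ P? (unique u)
    ; primes  = All.filter⁺ P? (primes u)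
    ; large   = All.filter⁺ P? (large u)
    ; aligned = All.filter⁺ P? (aligned u)
    ; hits    = λ Aa → All.filter⁺ P? (hits u Aa)
    }

  record State (Q : List ℕ) (σ : Fin k → Class) (l : Fin k → ℕ) : Set where
    field
      bounded : ∀ i → Bounded N (σ i)
      fits    : ∀ i → All (λ p → Fits p i (σ i)) Q
      level   : ∀ i → Level B (σ i) (l i)
  open State

  Short : Class → Set
  Short c = ∀ {s g w} → c ≡ line s g w → w < L

  record Result (σ : Fin k → Class) : Set where
    field
      final   : Fin k → Class
      extends : ∀ i → σ i ⊑ final i
      valid   : ∀ i → Bounded N (final i)
      short   : ∀ i → Short (final i)
      covers  : ∀ {a} → A a → ∃ λ i → Covered B D (final i) a

  -- A single fitting prime is enough: its multiplier c is nonzero, so w ≤ |c| w < L.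
  short-fits : ∀ {p i c} → Bounded N c → Fits p i c → Short c
  short-fits (_ , _ , _ , 1≤w) (_ , c , c≢0 , cw<L , _) {w = w} refl =
    ≤-<-trans (m≤n*m w ∣ c ∣ {{≢-nonZero c≢0}}) cw<L

  -- B^u ≤ w < L ≤ B^t forces u < t, so the level 2 + u is at most 1 + t.
  level-≤ : ∀ {c l} → Level B c l → Short c → l ≤ suc t
  level-≤ {empty}      refl _ = z≤n
  level-≤ {single s}   refl _ = s≤s z≤n
  level-≤ {line s g w} (u , refl , B^u≤w) w<L =
    s≤s (≰⇒> λ t≤u → <-irrefl refl (<-≤-trans (w<L refl)
      (≤-trans L≤B^t (≤-trans (^-monoʳ-≤ B {{>-nonZero (≤-trans (s≤s z≤n) 2≤B)}} t≤u) B^u≤w))))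

  insertAt : Fin k → ℕ → (Fin k → Class) → Fin k → Class
  insertAt i a σ j with j Fin.≟ i
  ... | yes _ = insert (σ j) a
  ... | no  _ = σ j

  insertAt-updates : ∀ i a σ → insertAt i a σ i ≡ insert (σ i) a
  insertAt-updates i a σ with i Fin.≟ i
  ... | yes _ = refl
  ... | no ¬e = ⊥-elim (¬e refl)

  bump : Fin k → (Fin k → ℕ) → Fin k → ℕ
  bump i l j with j Fin.≟ i
  ... | yes _ = suc (l j)
  ... | no  _ = l j

  Sum-bump : ∀ i l → Sum (bump i l) ≡ suc (Sum l)
  Sum-bump i l = Sum-increment l (bump i l) i at off
    where
    at : bump i l i ≡ suc (l i)
    at with i Fin.≟ i
    ... | yes _ = refl
    ... | no ¬e = ⊥-elim (¬e refl)
    off : ∀ j → j ≢ i → bump i l j ≡ l j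
    off j j≢i with j Fin.≟ i
    ... | yes e = ⊥-elim (j≢i e)
    ... | no _  = refl

  -- An insertion lowers the fuel and raises the total level by one, so the sum is preserved. Levels
  -- total at most k (t + 1), so the fuel cannot be exhausted.
  Budget : ℕ → (Fin k → ℕ) → Set
  Budget fuel l = suc (k * suc t) ≤ fuel + Sum l

  badCount : ℕ
  badCount = badBound L * r

  Uncovered : (Fin k → Class) → ℕ → Set
  Uncovered σ a = A a × (∀ i → ¬ Covered B D (σ i) a)

  uncovered? : ∀ σ → Decidable (Uncovered σ)
  uncovered? σ a = A? a ×-dec Fin.all? (λ i → ¬? (covered? B D (σ i) a))

  module Step {Q : List ℕ} {σ : Fin k → Class} {l : Fin k → ℕ} {a : ℕ}
    (u : Usable Q) (st : State Q σ l) (unc : Uncovered σ a) (i : Fin k) where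

    coloured : List ℕ
    coloured = filter (λ p → S? p i a) Q

    good : List ℕ
    good = filter (λ p → ¬? (bad? (n ^ suc r) L (σ i) a p)) coloured

    usable : Usable good
    usable = usable-filter (λ p → ¬? (bad? (n ^ suc r) L (σ i) a p)) (usable-filter (λ p → S? p i a) u)

    many : ∀ {c} → c + badCount < length coloured → c < length good
    many = count¬-> (bad? (n ^ suc r) L (σ i) a) coloured
      (count-bad (filter⁺ (λ p → S? p i a) (unique u)) (All.filter⁺ (λ p → S? p i a) (primes u))
        (All.filter⁺ (λ p → S? p i a) (large u)) L (σ i) a)

    state : State good (insertAt i a σ) (bump i l)
    state = record { bounded = bd ; fits = ft ; level = lv }
      where
      a≤N : a ≤ N
      a≤N = A≤N (proj₁ unc)
      bd : ∀ j → Bounded N (insertAt i a σ j)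
      bd j with j Fin.≟ i
      ... | yes _ = insert-bounded {c = σ j} {a} {B} {D} a≤N (bounded st j) (proj₂ unc j)
      ... | no  _ = bounded st j
      lv : ∀ j → Level B (insertAt i a σ j) (bump i l j)
      lv j with j Fin.≟ i
      ... | yes _ = insert-level {B} {D} B-divides {N} {σ j} {a} (bounded st j) (level st j) (proj₂ unc j)
      ... | no  _ = level st j
      ft : ∀ j → All (λ p → Fits p j (insertAt i a σ j)) good
      ft j with j Fin.≟ i
      ... | no _ = All.filter⁺ (λ p → ¬? (bad? (n ^ suc r) L (σ i) a p)) (All.filter⁺ (λ p → S? p i a) (fits st j))
      ... | yes refl = All.tabulate λ {p} p∈ →
        let p∈coloured , p-good = ∈-filter⁻ (λ p → ¬? (bad? (n ^ suc r) L (σ i) a p)) {xs = coloured} p∈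
            p∈Q , Sa = ∈-filter⁻ (λ p → S? p i a) {xs = Q} p∈coloured
        in insert-fits (All.lookup (primes u) p∈Q) (≤-trans L≤n (All.lookup (large u) p∈Q)) (All.lookup (aligned u) p∈Q) LN<
             {c = σ i} {a} {B} {D} a≤N (bounded st i) (All.lookup (fits st i) p∈Q) Sa (proj₂ unc i) p-good

  extends-insertAt : ∀ i a σ → (∀ j → Bounded N (σ j)) → ∀ j → σ j ⊑ insertAt i a σ j
  extends-insertAt i a σ bd j with j Fin.≟ i
  ... | yes _ = insert-⊑ (σ j) a (bd j)
  ... | no  _ = ⊑-refl

  -- Induction on the fuel. The pigeonhole principle picks the class that hits the new point at the
  -- most primes; of these the bad ones are discarded. The strict inequality in the number of primes
  -- leaves one prime at the end, which is what shows the final widths to be below L and the levels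
  -- to be bounded.
  cluster : ∀ fuel {Q σ l} → Usable Q → State Q σ l → Budget fuel l → cost k badCount fuel < length Q → Result σ
  cluster fuel {Q} {σ} {l} u st budget enough with anyUpTo? (uncovered? σ) (suc N)
  ... | no none = record
    { final = σ ; extends = λ _ → ⊑-refl ; valid = bounded st ; short = short-σ enough (fits st) ; covers = cov }
    where
    short-σ : ∀ {Q c} → c < length Q → (∀ i → All (λ p → Fits p i (σ i)) Q) → ∀ i → Short (σ i)
    short-σ {_ ∷ _} _ ft i = short-fits (bounded st i) (All.head (ft i))
    cov : ∀ {a} → A a → ∃ λ i → Covered B D (σ i) a
    cov {a} Aa with Fin.any? (λ i → covered? B D (σ i) a)
    ... | yes c = c
    ... | no ¬c = ⊥-elim (none (a , s≤s (A≤N Aa) , Aa , λ i c → ¬c (i , c)))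
  cluster zero {Q} {σ} {l} u st budget enough | yes _ =
    ⊥-elim (<-irrefl refl (≤-trans budget (Sum-≤ l (λ i → level-≤ (level st i) (short-σ enough (fits st) i)))))
    where
    short-σ : ∀ {Q c} → c < length Q → (∀ i → All (λ p → Fits p i (σ i)) Q) → ∀ i → Short (σ i)
    short-σ {_ ∷ _} _ ft i = short-fits (bounded st i) (All.head (ft i))
  cluster (suc fuel) {Q} {σ} {l} u st budget enough | yes (a , _ , unc)
    with pigeonhole-cover k (λ i p → S? p i a) (cost k badCount fuel + badCount) Q (hits u (proj₁ unc)) enough
  ... | i , lt = record
    { final = final ; extends = λ j → ⊑-trans (extends-insertAt i a σ (bounded st) j) (extends j)
    ; valid = valid ; short = short ; covers = covers }
    where
    open Step u st unc i
    open Result (cluster fuel usable state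
      (subst (suc (k * suc t) ≤_) (trans (sym (+-suc fuel (Sum l))) (cong (λ z → fuel + z) (sym (Sum-bump i l)))) budget)
      (many lt))

-- Progressions modulo p.

difference : ∀ {p} → AP (ℤ/ p) → ℤ
difference ∅            = + 0
difference (prog u d m) = d

module Modular {p : ℕ} (p-prime : Prime p) where
  open Residues p using (_≡ₚ_; _≟ₚ_; abelianGroup)
  open AbelianGroup abelianGroup using (rawMonoid) renaming (sym to ≡ₚ-sym; trans to ≡ₚ-trans)
  open RawMonoidDefs rawMonoid using () renaming (_×_ to _·_)

  ·≡* : ∀ j d → j · d ≡ + j ℤ.* d
  ·≡* zero    d = sym (ℤ.*-zeroˡ d)
  ·≡* (suc j) d = trans (cong (λ z → d ℤ.+ z) (·≡* j d)) (eq (+ j) d)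
    where
    eq : ∀ j d → d ℤ.+ j ℤ.* d ≡ (+ 1 ℤ.+ j) ℤ.* d
    eq = ℤSolver.solve-∀

  term : ℤ → ℤ → ℕ → ℤ
  term u d j = u ℤ.+ j · d

  terms-≢ : ∀ {u d i j} → ¬ p ∣ ∣ d ∣ → i < j → j < p → ¬ term u d i ≡ₚ term u d j
  terms-≢ {u} {d} {i} {j} p∤d i<j j<p e
    with euclidsLemma (j ∸ i) ∣ d ∣ p-prime (subst (p ∣_) abs (∣⇒∣ᵤ e))
    where
    eq : ∀ u d i e → (u ℤ.+ i ℤ.* d) ℤ.- (u ℤ.+ (e ℤ.+ i) ℤ.* d) ≡ ℤ.- (e ℤ.* d)
    eq = ℤSolver.solve-∀
    abs : ∣ term u d i ℤ.- term u d j ∣ ≡ (j ∸ i) * ∣ d ∣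
    abs = begin
      ∣ term u d i ℤ.- term u d j ∣
        ≡⟨ cong₂ (λ a b → ∣ (u ℤ.+ a) ℤ.- (u ℤ.+ b) ∣) (·≡* i d) (·≡* j d) ⟩
      ∣ (u ℤ.+ + i ℤ.* d) ℤ.- (u ℤ.+ + j ℤ.* d) ∣
        ≡⟨ cong (λ z → ∣ (u ℤ.+ + i ℤ.* d) ℤ.- (u ℤ.+ + z ℤ.* d) ∣) (m∸n+n≡m (<⇒≤ i<j)) ⟨
      ∣ (u ℤ.+ + i ℤ.* d) ℤ.- (u ℤ.+ (+ (j ∸ i) ℤ.+ + i) ℤ.* d) ∣
        ≡⟨ cong ∣_∣ (eq u d (+ i) (+ (j ∸ i))) ⟩
      ∣ ℤ.- (+ (j ∸ i) ℤ.* d) ∣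
        ≡⟨ ℤ.∣-i∣≡∣i∣ (+ (j ∸ i) ℤ.* d) ⟩
      ∣ + (j ∸ i) ℤ.* d ∣
        ≡⟨ ℤ.abs-* (+ (j ∸ i)) d ⟩
      (j ∸ i) * ∣ d ∣ ∎
      where open ≡-Reasoning
  ... | inj₁ p∣ = <-irrefl refl (<-≤-trans (≤-<-trans (m∸n≤m j i) j<p)
        (∣⇒≤ {{>-nonZero (m<n⇒0<n∸m i<j)}} p∣))
  ... | inj₂ p∣ = p∤d p∣

  -- The first L + 1 ≤ p terms are already distinct.
  length-> : ∀ {u d m L} → ¬ p ∣ ∣ d ∣ → L < p → L ≤ m → ¬ lengthℤ/ p (prog u d m) ≤ L
  length-> {u} {d} {m} {L} p∤d L<p L≤m short = collide (Fin.pigeonhole (s≤s short) index)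
    where
    distinct : List ℤ
    distinct = deduplicate _≟ₚ_ (map (term u d) (upTo (suc m)))
    member : (i : Fin (suc L)) → Any (term u d (toℕ i) ≡ₚ_) distinct
    member i = Any.deduplicate⁺ _≟ₚ_
      (λ {x} {y} y≡x w≡x → ≡ₚ-trans {term u d (toℕ i)} {x} {y} w≡x (≡ₚ-sym {y} {x} y≡x))
      (Any.map⁺ (Any.applyUpTo⁺ (λ z → z) (AbelianGroup.refl abelianGroup {term u d (toℕ i)})
        (s≤s (≤-trans (Fin.toℕ≤pred[n] i) L≤m))))
    index : Fin (suc L) → Fin (length distinct)
    index i = Any.index (member i)
    at-index : ∀ i → term u d (toℕ i) ≡ₚ List.lookup distinct (index i)
    at-index i = Any.lookup-index (member i)
    collide : (∃₂ λ i j → i Fin.< j × index i ≡ index j) → ⊥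
    collide (i , j , i<j , e) = terms-≢ {u} {d} p∤d i<j (≤-<-trans (Fin.toℕ≤pred[n] j) L<p)
      (≡ₚ-trans {term u d (toℕ i)} {List.lookup distinct (index i)} {term u d (toℕ j)} (at-index i)
        (≡ₚ-sym {term u d (toℕ j)} {List.lookup distinct (index i)}
          (subst (λ z → term u d (toℕ j) ≡ₚ List.lookup distinct z) (sym e) (at-index j))))

  -- Length counts distinct residues, so m itself need not be small. If p divides d, all terms agree
  -- and j = 0 serves. Otherwise the terms up to index L would be L + 1 distinct ones, so every
  -- index is below L.
  coordinate : ∀ {u d m L x} → L < p → lengthℤ/ p (prog u d m) ≤ L → x ∈ℤ/[ p ] prog u d m →
               ∃ λ j → j < L × + p ℤ∣.∣ x ℤ.- (u ℤ.+ + j ℤ.* d)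
  coordinate {u} {d} {m} {L} {x} L<p short x∈
    with Any.applyUpTo⁻ (λ z → z) {suc m} (Any.map⁻ {f = term u d} {xs = upTo (suc m)} x∈) | p ∣? ∣ d ∣
  ... | i , i≤m , x≡ | yes p∣d = 0 , ≤-trans (s≤s z≤n) short ,
    subst (+ p ℤ∣.∣_) (eq x u (+ i) d)
      (ℤ∣.∣m∣n⇒∣m+n (subst (λ z → + p ℤ∣.∣ x ℤ.- (u ℤ.+ z)) (·≡* i d) x≡) (ℤ∣.∣n⇒∣m*n (+ i) (∣ᵤ⇒∣ p∣d)))
    where
    eq : ∀ x u i d → x ℤ.- (u ℤ.+ i ℤ.* d) ℤ.+ i ℤ.* d ≡ x ℤ.- (u ℤ.+ + 0 ℤ.* d)
    eq = ℤSolver.solve-∀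
  ... | i , i≤m , x≡ | no p∤d with i <? L
  ...   | yes i<L = i , i<L , subst (λ z → + p ℤ∣.∣ x ℤ.- (u ℤ.+ z)) (·≡* i d) x≡
  ...   | no  i≮L = ⊥-elim (length-> {u} {d} {m} p∤d L<p (≤-trans (≮⇒≥ i≮L) (s≤s⁻¹ i≤m)) short)

  differences-aligned : ∀ {P L x y} → L < p → lengthℤ/ p P ≤ L → x ∈ℤ/[ p ] P → y ∈ℤ/[ p ] P →
    ∃ λ j → ∣ j ∣ < L × + p ℤ∣.∣ (x ℤ.- y) ℤ.- j ℤ.* difference P
  differences-aligned {∅} _ _ () _
  differences-aligned {prog u d m} {L} {x} {y} L<p short x∈ y∈
    with coordinate {u} {d} {m} {L} {x} L<p short x∈ | coordinate {u} {d} {m} {L} {y} L<p short y∈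
  ... | i , i<L , ei | j , j<L , ej = i ⊝ j ,
    ≤-<-trans (subst (λ z → ∣ z ∣ ≤ i ⊔ j) (sym (ℤ.m-n≡m⊖n i j)) (ℤ.∣m⊝n∣≤m⊔n i j)) (⊔-pres-<m i<L j<L) ,
    subst (+ p ℤ∣.∣_) (eq x y u (+ i) (+ j) d) (ℤ∣.∣m∣n⇒∣m-n ei ej)
    where
    eq : ∀ x y u i j d → (x ℤ.- (u ℤ.+ i ℤ.* d)) ℤ.- (y ℤ.- (u ℤ.+ j ℤ.* d)) ≡ (x ℤ.- y) ℤ.- (i ℤ.- j) ℤ.* d
    eq = ℤSolver.solve-∀


-- Progressions of integers and the hulls of classes.

·≡*-ℤ : ∀ j d → RawMonoidDefs._×_ (AbelianGroup.rawMonoid ℤ⁺) j d ≡ + j ℤ.* d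
·≡*-ℤ zero    d = sym (ℤ.*-zeroˡ d)
·≡*-ℤ (suc j) d = trans (cong (λ z → d ℤ.+ z) (·≡*-ℤ j d)) (eq (+ j) d)
  where
  eq : ∀ j d → d ℤ.+ j ℤ.* d ≡ (+ 1 ℤ.+ j) ℤ.* d
  eq = ℤSolver.solve-∀

∈-prog : ∀ u d {x m} j → j ≤ m → x ≡ u ℤ.+ + j ℤ.* d → x ∈ℤ prog u d m
∈-prog u d j j≤m refl = Any.map⁺ (Any.applyUpTo⁺ (λ z → z) (cong (λ z → u ℤ.+ z) (sym (·≡*-ℤ j d))) (s≤s j≤m))

length-prog-≤ : ∀ u d m → lengthℤ (prog u d m) ≤ suc m
length-prog-≤ u d m = ≤-trans (length-deduplicate ℤ._≟_ (Progression.terms ℤ⁺ (prog u d m)))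
  (≤-reflexive (trans (length-map (λ j → u ℤ.+ RawMonoidDefs._×_ (AbelianGroup.rawMonoid ℤ⁺) j d) (upTo (suc m)))
    (length-upTo (suc m))))

∈-segment : ∀ {a s g w} → s ≤ a → g ∣ a ∸ s → a ∸ s ≤ g * w → .{{NonZero g}} → + a ∈ℤ prog (+ s) (+ g) w
∈-segment {a} {s} {g} {w} s≤a (divides e eq) ≤gw = ∈-prog (+ s) (+ g) e
  (*-cancelʳ-≤ e w g (subst₂ _≤_ eq (*-comm g w) ≤gw))
  (begin
    + a ≡⟨ cong +_ (m+[n∸m]≡n s≤a) ⟨
    + (s + (a ∸ s)) ≡⟨ cong (λ z → + (s + z)) eq ⟩
    + s ℤ.+ + (e * g) ≡⟨ cong (λ z → + s ℤ.+ z) (ℤ.pos-* e g) ⟩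
    + s ℤ.+ + e ℤ.* + g ∎)
  where open ≡-Reasoning

-- g ∣ D x holds exactly when h = g / gcd (g, D) divides x, and |x| ≤ B g w ≤ B D w h because g ≤ h
-- D. So all covered points are within W steps of h on either side of s.
hull : (B D : ℕ) → Class → AP ℤ⁺
hull B D empty        = ∅
hull B D (single s)   = prog (+ s) (+ 0) 0
hull B D (line s g w) = prog (+ s ℤ.- + W ℤ.* + h) (+ h) (2 * W)
  where
  h = quotient (gcd[m,n]∣m g D)
  W = B * D * w

length-hull : ∀ {B D L} c → 1 ≤ B → 1 ≤ D → 1 ≤ L → (∀ {s g w} → c ≡ line s g w → w < L) →
              lengthℤ (hull B D c) ≤ 2 * (B * D * L)
length-hull empty _ _ _ _ = z≤n
length-hull {B} {D} {L} (single s) 1≤B 1≤D 1≤L _ =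
  ≤-trans (length-prog-≤ (+ s) (+ 0) 0) (≤-trans (*-mono-≤ (*-mono-≤ 1≤B 1≤D) 1≤L) (m≤m+n _ _))
length-hull {B} {D} {L} (line s g w) 1≤B 1≤D _ w<L = begin
  _ ≤⟨ length-prog-≤ (+ s ℤ.- + (B * D * w) ℤ.* + h) (+ h) (2 * (B * D * w)) ⟩
  1 + 2 * (B * D * w) ≤⟨ +-monoˡ-≤ (2 * (B * D * w)) {1} {2 * (B * D)} (≤-trans (*-mono-≤ 1≤B 1≤D) (m≤m+n _ _)) ⟩
  2 * (B * D) + 2 * (B * D * w) ≡⟨ eq (B * D) w ⟩
  2 * (B * D * suc w) ≤⟨ *-monoʳ-≤ 2 (*-monoʳ-≤ (B * D) (w<L refl)) ⟩
  2 * (B * D * L) ∎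
  where
  open ≤-Reasoning
  h = quotient (gcd[m,n]∣m g D)
  eq : ∀ u w → 2 * u + 2 * (u * w) ≡ 2 * (u * (1 + w))
  eq = ℕSolver.solve-∀

∈-two-sided : ∀ {x e W h} → ∣ x ∣ ≡ e * h → e ≤ W → ∀ s → s ℤ.+ x ∈ℤ prog (s ℤ.- + W ℤ.* + h) (+ h) (2 * W)
∈-two-sided {x} {e} {W} {h} x≡ e≤W s with ℤ.+∣i∣≡i⊎+∣i∣≡-i x
... | inj₁ +x = ∈-prog (s ℤ.- + W ℤ.* + h) (+ h) (W + e) (≤-trans (+-monoʳ-≤ W e≤W) (≤-reflexive (cong (λ z → W + z) (sym (+-identityʳ W)))))
  (trans (cong (λ z → s ℤ.+ z) (trans (sym +x) (trans (cong +_ x≡) (ℤ.pos-* e h)))) (eq s (+ e) (+ h) (+ W)))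
  where
  eq : ∀ s e h W → s ℤ.+ e ℤ.* h ≡ s ℤ.- W ℤ.* h ℤ.+ (W ℤ.+ e) ℤ.* h
  eq = ℤSolver.solve-∀
... | inj₂ -x = ∈-prog (s ℤ.- + W ℤ.* + h) (+ h) (W ∸ e) (≤-trans (m∸n≤m W e) (m≤m+n W _))
  (begin
    s ℤ.+ x ≡⟨ cong (λ z → s ℤ.+ z) (trans (sym (ℤ.neg-involutive x)) (cong ℤ.-_ (sym -x))) ⟩
    s ℤ.- + ∣ x ∣ ≡⟨ cong (λ z → s ℤ.- z) (trans (cong +_ x≡) (ℤ.pos-* e h)) ⟩
    s ℤ.- + e ℤ.* + h ≡⟨ eq s (+ e) (+ h) (+ (W ∸ e)) ⟩
    s ℤ.- (+ (W ∸ e) ℤ.+ + e) ℤ.* + h ℤ.+ + (W ∸ e) ℤ.* + h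
      ≡⟨ cong (λ z → s ℤ.- + z ℤ.* + h ℤ.+ + (W ∸ e) ℤ.* + h) (m∸n+n≡m e≤W) ⟩
    s ℤ.- + W ℤ.* + h ℤ.+ + (W ∸ e) ℤ.* + h ∎)
  where
  open ≡-Reasoning
  eq : ∀ s e h V → s ℤ.- e ℤ.* h ≡ s ℤ.- (V ℤ.+ e) ℤ.* h ℤ.+ V ℤ.* h
  eq = ℤSolver.solve-∀

covered⇒∈hull : ∀ {N B D a} c → 1 ≤ D → Bounded N c → Covered B D c a → + a ∈ℤ hull B D c
covered⇒∈hull (single s) _ _ refl = ∈-prog (+ s) (+ 0) 0 z≤n (sym (ℤ.+-identityʳ (+ s)))
covered⇒∈hull {N} {B} {D} {a} (line s g w) 1≤D (_ , 1≤g , _ , _) (g∣ , x≤) =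
  subst (_∈ℤ hull B D (line s g w)) (eq (+ s) (+ a))
    (∈-two-sided {a ⊝ s} {quotient h∣x} {B * D * w} {h} (_∣_.equality h∣x) e≤ (+ s))
  where
  eq : ∀ s a → s ℤ.+ (a ℤ.- s) ≡ a
  eq = ℤSolver.solve-∀
  x = ∣ a ⊝ s ∣
  h = quotient (gcd[m,n]∣m g D)
  D′ = quotient (gcd[m,n]∣n g D)
  G = gcd g D
  instance
    G≢0 : NonZero G
    G≢0 = gcd-nonZero 1≤g
    h≢0 : NonZero h
    h≢0 = quotient-nonZero {x = D} 1≤g
  h∣x : h ∣ x
  h∣x = quotients-coprime {x = D} 1≤g (*-cancelʳ-∣ G (subst₂ _∣_ (gcd-left {x = D} 1≤g)
    (trans (cong (_* x) (gcd-right {x = D} 1≤g)) (comm D′ G x)) g∣))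
    where
    comm : ∀ a b c → a * b * c ≡ a * c * b
    comm = ℕSolver.solve-∀
  e≤ : quotient h∣x ≤ B * D * w
  e≤ = *-cancelʳ-≤ _ _ h (begin
    quotient h∣x * h ≡⟨ _∣_.equality h∣x ⟨
    x ≤⟨ x≤ ⟩
    B * (g * w) ≡⟨ cong (λ z → B * (z * w)) (gcd-left {x = D} 1≤g) ⟩
    B * (h * G * w) ≤⟨ *-monoʳ-≤ B (*-monoˡ-≤ w (*-monoʳ-≤ h (∣⇒≤ {{>-nonZero 1≤D}} (gcd[m,n]∣n g D)))) ⟩
    B * (h * D * w) ≡⟨ arith B h D w ⟩
    B * D * w * h ∎)
    where
    open ≤-Reasoning
    arith : ∀ a b c d → a * (b * c * d) ≡ a * c * d * b
    arith = ℕSolver.solve-∀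

≤⇒∣! : ∀ B d → 1 ≤ d → d < B → d ∣ B !
≤⇒∣! B (suc d) _ d<B = ∣-trans (∣m⇒∣m*n (d !) ∣-refl) (m≤n⇒m!∣n! (<⇒≤ d<B))

∣⊝∣≡∸ : ∀ {a s} → s ≤ a → ∣ a ⊝ s ∣ ≡ a ∸ s
∣⊝∣≡∸ {a} {s} s≤a = cong ∣_∣ (trans (ℤ.m-n≡m⊖n a s) (ℤ.⊖-≥ s≤a))

extremes : {A : ℕ → Set} → Decidable A → ∀ N →
  (∀ {a} → a ≤ N → ¬ A a) ⊎ (∃₂ λ s t → (A s × s ≤ N) × (A t × t ≤ N) × (∀ {a} → a ≤ N → A a → s ≤ a × a ≤ t))
extremes {A} A? zero with A? 0
... | yes A0 = inj₂ (0 , 0 , (A0 , z≤n) , (A0 , z≤n) , λ { z≤n _ → z≤n , z≤n })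
... | no ¬A0 = inj₁ λ { z≤n A0 → ¬A0 A0 }
extremes {A} A? (suc N) with A? (suc N) | extremes A? N
... | no ¬A | inj₁ none = inj₁ new
  where
  new : ∀ {a} → a ≤ suc N → ¬ A a
  new a≤ Aa with m≤n⇒m<n∨m≡n a≤
  ... | inj₁ a<  = none (s≤s⁻¹ a<) Aa
  ... | inj₂ refl = ¬A Aa
... | yes As | inj₁ none = inj₂ (suc N , suc N , (As , ≤-refl) , (As , ≤-refl) , new)
  where
  new : ∀ {a} → a ≤ suc N → A a → suc N ≤ a × a ≤ suc N
  new a≤ Aa with m≤n⇒m<n∨m≡n a≤
  ... | inj₁ a<  = ⊥-elim (none (s≤s⁻¹ a<) Aa)
  ... | inj₂ refl = ≤-refl , ≤-refl
... | no ¬A | inj₂ (s , t , (As , s≤) , (At , t≤) , between) =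
  inj₂ (s , t , (As , m≤n⇒m≤1+n s≤) , (At , m≤n⇒m≤1+n t≤) , new)
  where
  new : ∀ {a} → a ≤ suc N → A a → s ≤ a × a ≤ t
  new a≤ Aa with m≤n⇒m<n∨m≡n a≤
  ... | inj₁ a<  = between (s≤s⁻¹ a<) Aa
  ... | inj₂ refl = ⊥-elim (¬A Aa)
... | yes A′ | inj₂ (s , t , (As , s≤) , (At , t≤) , between) =
  inj₂ (s , suc N , (As , m≤n⇒m≤1+n s≤) , (A′ , ≤-refl) , new)
  where
  new : ∀ {a} → a ≤ suc N → A a → s ≤ a × a ≤ suc N
  new a≤ Aa with m≤n⇒m<n∨m≡n a≤
  ... | inj₁ a<  = proj₁ (between (s≤s⁻¹ a<) Aa) , a≤
  ... | inj₂ refl = m≤n⇒m≤1+n s≤ , ≤-refl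

-- Covering the points that survive finitely many primes.

module Survivors
  (k N L n r t : ℕ) (R : (p : ℕ) → Fin k → AP (ℤ/ p)) (Q : List ℕ)
  (unique : Unique Q) (primes : All (λ p → n < p × Prime p) Q)
  (short : All (λ p → ∀ i → lengthℤ/ p (R p i) ≤ L) Q)
  (1≤L : 1 ≤ L) (L≤n : L ≤ n) (LN< : L * N + L * N < n ^ suc r)
  where

  InClass : ℕ → Fin k → ℕ → Set
  InClass p i a = + a ∈ℤ/[ p ] R p i

  inClass? : ∀ p i a → Dec (InClass p i a)
  inClass? p i a = any? (λ z → Residues._≟ₚ_ p (+ a) z) (Progression.terms (ℤ/ p) (R p i))

  -- Weaker than `Sifted`, but decidable: the primes come from a finite list, and no comparison with
  -- the real y is left. The search for uncovered points relies on this.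
  Survives : ℕ → Set
  Survives a = a ≤ N × All (λ p → ∃ λ i → InClass p i a) Q

  survives? : Decidable Survives
  survives? a = (a ≤? N) ×-dec All.all? (λ p → Fin.any? (λ i → inClass? p i a)) Q

  step : ℕ → Fin k → ℤ
  step p i = difference {p} (R p i)

  steps : ℕ
  steps = suc (k * suc t)

  badPrimes : ℕ
  badPrimes = badBound L * r

  Enough : Set
  Enough = steps * (k ^ steps * badPrimes) < length Q

  module Run (B D : ℕ) (B-divides : ∀ d → 1 ≤ d → d < B → d ∣ D) (2≤B : 2 ≤ B) (L≤B^t : L ≤ B ^ t)
    (1≤k : 1 ≤ k) (enough : Enough) where

    open Cluster k L N n r InClass inClass? step Survives survives? proj₁ B D t B-divides 2≤B L≤B^t LN< L≤n

    usable-all : Usable Q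
    usable-all = record
      { unique  = unique
      ; primes  = All.map proj₂ primes
      ; large   = All.map (λ q → <⇒≤ (proj₁ q)) primes
      ; aligned = All.zipWith (λ { {p} ((n<p , p-prime) , sh) i a b Sa Sb →
          Modular.differences-aligned p-prime {R p i} {L} {+ a} {+ b} (≤-<-trans L≤n n<p) (sh i) Sa Sb }) (primes , short)
      ; hits    = proj₂
      }

    affordable : cost k badPrimes steps < length Q
    affordable = ≤-<-trans (cost-≤ k badPrimes steps 1≤k) enough

    cover-by-hulls : 1 ≤ D → Σ (Fin k → AP ℤ⁺) λ P →
      (∀ i → lengthℤ (P i) ≤ 2 * (B * D * L)) × (∀ a → Survives a → ∃ λ i → + a ∈ℤ P i)
    cover-by-hulls 1≤D =
      (λ i → hull B D (final i)) , (λ i → length-hull (final i) (≤-trans (s≤s z≤n) 2≤B) 1≤D 1≤L (short′ i)) ,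
      λ a Aa → let i , cov = covers Aa in i , covered⇒∈hull (final i) 1≤D (valid i) cov
      where
      result : Result (λ _ → empty)
      result = cluster steps {Q} {λ _ → empty} {λ _ → 0} usable-all
        (record { bounded = λ _ → tt ; fits = λ _ → All.tabulate (λ _ → tt) ; level = λ _ → refl })
        (m≤m+n steps _) affordable
      open Result result renaming (short to short′)

    -- With a single class, starting from the least and the greatest point
    -- fixes the range, so that only the gap may still shrink.
    cover-by-segment : ∀ i₀ → (∀ i → i ≡ i₀) → D ≡ 1 → Σ (Fin k → AP ℤ⁺) λ P →
      (∀ i → lengthℤ (P i) ≤ L) × (∀ a → Survives a → ∃ λ i → + a ∈ℤ P i)
    cover-by-segment i₀ only D≡1 with extremes survives? N
    ... | inj₁ none = (λ _ → ∅) , (λ _ → z≤n) , λ a Aa → ⊥-elim (none (proj₁ Aa) Aa)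
    ... | inj₂ (s , m , (As , s≤N) , (Am , m≤N) , between) with m ≟ s
    ...   | yes refl = (λ _ → prog (+ s) (+ 0) 0) , (λ _ → ≤-trans (length-prog-≤ (+ s) (+ 0) 0) 1≤L) ,
      λ a Aa → i₀ , ∈-prog (+ s) (+ 0) 0 z≤n (cong +_ (trans (a≡s a Aa) (sym (+-identityʳ s))))
      where
      a≡s : ∀ a → Survives a → a ≡ s
      a≡s a Aa = let s≤a , a≤s = between (proj₁ Aa) Aa in ≤-antisym a≤s s≤a
    ...   | no m≢s = finish (pigeonhole-cover k (λ i p → inClass? p i m) (cost k badPrimes (k * suc t) + badPrimes) Q (proj₂ Am) affordable)
      where
      in₀ : ∀ {p} → (∃ λ i → InClass p i s) → ∀ i → InClass p i s
      in₀ (j , Sj) i = subst (λ i → InClass _ i s) (trans (only j) (sym (only i))) Sj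
      initial : State Q (λ _ → single s) (λ _ → 1)
      initial = record
        { bounded = λ _ → s≤N
        ; fits    = λ i → All.map (λ h → in₀ h i) (proj₂ As)
        ; level   = λ _ → refl
        }
      finish : (∃ λ i → cost k badPrimes (k * suc t) + badPrimes < count (λ p → inClass? p i m) Q) →
        Σ (Fin k → AP ℤ⁺) λ P → (∀ i → lengthℤ (P i) ≤ L) × (∀ a → Survives a → ∃ λ i → + a ∈ℤ P i)
      finish (i , lt) = conclude (final i) refl (subst (_⊑ final i) (insertAt-updates i m (λ _ → single s)) (extends i)) (valid i) (short′ i) (λ a Aa → let j , c = covers Aa in
          subst (λ j → Covered B D (final j) a) (trans (only j) (sym (only i))) c)
        where
        module S = Step usable-all initial (Am , λ _ → m≢s) i
        result : Result (insertAt i m (λ _ → single s))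
        result = cluster (k * suc t) S.usable S.state
          (≤-trans (s≤s (m≤m+n (k * suc t) _)) (≤-reflexive (trans (sym (+-suc (k * suc t) (Sum {k} (λ _ → 1)))) (cong (λ z → k * suc t + z) (sym (Sum-bump i (λ _ → 1)))))))
          (S.many lt)
        open Result result renaming (short to short′)
        -- D = 1 makes g divide every a - s, and `⊑` from the line with gap m - s and width 1 gives
        -- g w ≥ m - s. So w + 1 ≤ L terms starting at s reach all survivors, without any
        -- enlargement.
        conclude : ∀ c → final i ≡ c → line s ∣ m ⊝ s ∣ 1 ⊑ c → Bounded N c → Short c → (∀ a → Survives a → Covered B D c a) →
          Σ (Fin k → AP ℤ⁺) λ P → (∀ i → lengthℤ (P i) ≤ L) × (∀ a → Survives a → ∃ λ i → + a ∈ℤ P i)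
        conclude c _ (nonline f) _ _ _ = ⊥-elim (f _ _ _ refl)
        conclude (line s g w) _ (line g₀≤) (_ , 1≤g , _ , _) w<L cov =
          (λ _ → prog (+ s) (+ g) w) , (λ _ → ≤-trans (length-prog-≤ (+ s) (+ g) w) (w<L refl)) ,
          λ a Aa → i , ∈-segment {a} {s} {g} {w} (proj₁ (between (proj₁ Aa) Aa))
            (subst (g ∣_) (trans (cong (_* ∣ a ⊝ s ∣) D≡1) (trans (+-identityʳ _) (∣⊝∣≡∸ (proj₁ (between (proj₁ Aa) Aa))))) (proj₁ (cov a Aa)))
            (≤-trans (∸-monoˡ-≤ s (proj₂ (between (proj₁ Aa) Aa)))
              (≤-trans (≤-reflexive (trans (sym (∣⊝∣≡∸ (proj₁ (between m≤N Am)))) (sym (*-identityʳ _)))) g₀≤))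
            {{>-nonZero 1≤g}}

-- From the real hypotheses to the covering.

open import Data.Product.Base using (∃-syntax)
open import Data.Rational.Base as ℚ using (ℚ; ½; 0ℚ)
open RealAnalysis
open RawMonoidDefs ℚ.+-0-rawMonoid using () renaming (_×_ to _·_)

<2⇒∣1 : ∀ d → 1 ≤ d → d < 2 → d ∣ 1
<2⇒∣1 (suc zero)    _ _               = ∣-refl
<2⇒∣1 (suc (suc d)) _ (s≤s (s≤s ()))

-- The largest actual length replaces the integer part of p^(1/2 - ε), which is not computable from
-- a cut. Being one of the lengths, or 1, it inherits whatever they all satisfy; the value 1 guards
-- against progressions that are all empty.
maximum-Fin : ∀ {k} (Ψ : ℕ → Set) (f : Fin k → ℕ) → Ψ 1 → (∀ i → Ψ (f i)) → ∃ λ L → 1 ≤ L × Ψ L × (∀ i → f i ≤ L)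
maximum-Fin {zero}  Ψ f Ψ1 Ψf = 1 , ≤-refl , Ψ1 , λ ()
maximum-Fin {suc k} Ψ f Ψ1 Ψf with maximum-Fin Ψ (λ i → f (suc i)) Ψ1 (λ i → Ψf (suc i))
... | L , 1≤L , ΨL , f≤L with ≤-total (f zero) L
...   | inj₁ f₀≤L = L , 1≤L , ΨL , λ { zero → f₀≤L ; (suc i) → f≤L i }
...   | inj₂ L≤f₀ = f zero , ≤-trans 1≤L L≤f₀ , Ψf zero , λ { zero → ≤-refl ; (suc i) → ≤-trans (f≤L i) L≤f₀ }

maximum-List : ∀ {k} (Ψ : ℕ → Set) (f : ℕ → Fin k → ℕ) ps → Ψ 1 → All (λ p → ∀ i → Ψ (f p i)) ps →
  ∃ λ L → 1 ≤ L × Ψ L × All (λ p → ∀ i → f p i ≤ L) ps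
maximum-List Ψ f []       Ψ1 []         = 1 , ≤-refl , Ψ1 , []
maximum-List Ψ f (p ∷ ps) Ψ1 (Ψp ∷ Ψps) with maximum-List Ψ f ps Ψ1 Ψps | maximum-Fin Ψ (f p) Ψ1 Ψp
... | L , 1≤L , ΨL , f≤L | L′ , 1≤L′ , ΨL′ , f≤L′ with ≤-total L L′
...   | inj₁ L≤L′ = L′ , 1≤L′ , ΨL′ , f≤L′ ∷ All.map (λ le i → ≤-trans (le i) L≤L′) f≤L
...   | inj₂ L′≤L = L , 1≤L , ΨL , (λ i → ≤-trans (f≤L′ i) L′≤L) ∷ f≤L

factor : ℝ⁺ → (k : ℕ) → .{{NonZero k}} → ℝ
factor ε k = exp (exp (val (fromℕ⁺ 161) *ℝ (fromℕ k *ℝ log (fromℕ⁺ k)) *ℝ ε ⁻¹))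

Cover : ℝ⁺ → (k : ℕ) → .{{NonZero k}} → (N : ℕ) (y : ℝ⁺) → ((p : ℕ) → Fin k → AP (ℤ/ p)) → Set
Cover ε k N y R = Σ (Fin k → AP ℤ⁺) λ P →
  (∀ i → fromℕ (lengthℤ (P i)) ≤ℝ factor ε k *ℝ y ^ℝ (½ℝ -ℝ val ε)) × (∀ n → Sifted N (val y) R n → ∃ λ i → + n ∈ℤ P i)

-- v = 60 + 4 M turns N > 2^(2^v) into h ≥ (10 + M) M by `range-≥-initial`. It depends on ε alone,
-- through M, and not on k.
threshold : ℕ → ℕ
threshold m = 60 + 4 * (7 + m)

module Sifting
  (ε : ℝ⁺) (ε<½ : val ε <ℝ ½ℝ) (m : ℕ) (a b : ℚ) (εa : Below (val ε) a) (εb : Above (val ε) b)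
  (3≤ : ⟦ 3 ⟧ ℚ.≤ (7 + m) · a) (≤4 : (7 + m) · b ℚ.≤ ⟦ 4 ⟧)
  (k : ℕ) (k≢0 : NonZero k) (N : ℕ) (N≢1 : NonTrivial N) (v : ℕ) (v≡ : v ≡ threshold m) (N> : 2 ^ (2 ^ v) < N)
  (y : ℝ⁺) (logN≤y : (log⁺ N {{N≢1}} ^ℝ (ε ⁻¹)) ≤ℝ val y) (y≤N : val y ≤ℝ fromℕ N)
  (R : (p : ℕ) → Fin k → AP (ℤ/ p))
  (short-R : ∀ p (p-prime : Prime p) → p ∈[ val y ,2×] → ∀ i →
    fromℕ (lengthℤ/ p (R p i)) ≤ℝ (fromℕ⁺ p {{prime⇒nonZero p-prime}} ^ℝ (½ℝ -ℝ val ε)))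
  where

  M : ℕ
  M = 7 + m

  θ Y : ℝ
  θ = ½ℝ -ℝ val ε
  Y = y ^ℝ θ

  1≤N : 1 ≤ N
  1≤N = ≤-trans (s≤s z≤n) N>

  module _ (l : ℕ) (2^l≤N : 2 ^ l ≤ N) (N<2^ : N < 2 ^ suc l)
    (i : ℕ) (yi : Below (val y) ⟦ i ⟧) (y2+i : Above (val y) ⟦ 2 + i ⟧)
    (h : ℕ) (2^h≤n : 2 ^ h ≤ suc i) (n<2^ : suc i < 2 ^ suc h)
    where

    n : ℕ
    n = suc i

    2^v≤l : 2 ^ v ≤ l
    2^v≤l = s≤s⁻¹ (^-cancelʳ-< 2 {2 ^ v} {suc l} (<-trans N> N<2^))

    1≤l : 1 ≤ l
    1≤l = ≤-trans (m^n>0 2 v) 2^v≤l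

    l^M≤ : l ^ M ≤ 2 ^ M * (3 + i) ^ 4
    l^M≤ = log-power-lower ε y {b} (6 + m) εb ≤4 N {{N≢1}} l 2^l≤N logN≤y i y2+i

    h-range : v * M ≤ M + 4 * (3 + h)
    h-range = range-lower m n (s≤s z≤n) {v} {l} {i} {h} refl 2^v≤l l^M≤ n<2^

    h-large : (10 + M) * M ≤ h
    h-large = range-≥-initial M h (m≤m+n 1 (6 + m)) (≤-trans (≤-reflexive (cong (_* M) (sym v≡))) h-range)

    18≤h : 18 ≤ h
    18≤h = ≤-trans (≤-trans (≤ᵇ⇒≤ 18 119 _) (*-mono-≤ {17} {10 + M} {7} {M} (s≤s (s≤s (s≤s (s≤s (s≤s (s≤s (s≤s (s≤s (s≤s (s≤s (m≤m+n 7 m))))))))))) (m≤m+n 7 m))) h-large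

    4≤n : 4 ≤ n
    4≤n = ≤-trans (^-monoʳ-≤ 2 {2} {h} (≤-trans (≤ᵇ⇒≤ 2 18 _) 18≤h)) 2^h≤n

    2≤i : 2 ≤ i
    2≤i = ≤-trans (n≤1+n 2) (s≤s⁻¹ 4≤n)

    n≤N : n ≤ N
    n≤N = natural-<-fromℕ {val y} yi y≤N

    log-y>0 : Below (log y) 0ℚ
    log-y>0 = natural-log-positive y 2≤i yi

    θ>0 : Below θ 0ℚ
    θ>0 = exponent-positive ε ε<½

    1≼Y : ⟦ 1 ⟧ ≼ Y
    1≼Y = 1≼power {θ} y θ>0 log-y>0

    Q : List ℕ
    Q = primesBetween n (n + n ∸ 1)

    n≤6hQ : n ≤ 6 * h * length Q
    n≤6hQ = many-primes 18≤h 2^h≤n n<2^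

    ≤2i : ∀ {p} → p < n + n ∸ 1 → p ≤ 2 * i
    ≤2i {p} p< = subst (p ≤_) (cong (λ z → i + z) (sym (+-identityʳ i))) (s≤s⁻¹ (subst (p <_) (+-suc i i) p<))

    in-range : ∀ {p} → n < p → p < n + n ∸ 1 → p ∈[ val y ,2×]
    in-range {p} n<p p< = ≤-natural {val y} {2 + i} {p} y2+i n<p , natural-≤-2* {val y} {i} {p} (≤-trans (n≤1+n 1) 2≤i) yi (≤2i p<)

    -- The two consequences of a length being at most p^(1/2 - ε): the first enters the final bound,
    -- the second the count of primes.
    Admissible : ℕ → Set
    Admissible x = ½ ℚ.* ⟦ x ⟧ ≼ Y × x ^ (2 * M) ≤ (2 * n) ^ suc m

    admissible-1 : Admissible 1
    admissible-1 = ≼-mono {Y} (ℚ.*≤* (ℤ.+≤+ (≤ᵇ⇒≤ 1 2 _))) 1≼Y ,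
      subst (_≤ (2 * n) ^ suc m) (sym (^-zeroˡ (2 * M))) (m^n>0 (2 * n) (suc m))

    admissible-length : All (λ p → ∀ j → Admissible (lengthℤ/ p (R p j))) Q
    admissible-length = All.map (λ { {p} (n<p , p-prime , p<) j →
      power-double {θ} p {{prime⇒nonZero p-prime}} y (prime≥2 p-prime) θ>0 (exponent-below-1 ε) log-y>0
        (natural-≤-2*-above {val y} {i} {p} yi (≤2i p<)) (lengthℤ/ p (R p j)) (short-R p p-prime (in-range n<p p<) j) ,
      ≤-trans (length-power ε m εa 3≤ p {{prime⇒nonZero p-prime}} (prime≥2 p-prime) (lengthℤ/ p (R p j))
          (short-R p p-prime (in-range n<p p<) j))
        (^-monoˡ-≤ (suc m) (≤-trans (≤2i p<) (*-monoʳ-≤ 2 (n≤1+n i)))) }) (primesBetween-all n (n + n ∸ 1))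

    module _ (L : ℕ) (1≤L : 1 ≤ L) (L≼Y : ½ ℚ.* ⟦ L ⟧ ≼ Y) (L^≤ : L ^ (2 * M) ≤ (2 * n) ^ suc m)
      (short : All (λ p → ∀ j → lengthℤ/ p (R p j) ≤ L) Q) where

      L≤n : L ≤ n
      L≤n = ≮⇒≥ λ n<L → <⇒≱ (^-monoˡ-< (2 * M) n<L) (begin
        L ^ (2 * M) ≤⟨ L^≤ ⟩
        (2 * n) ^ suc m ≤⟨ ^-monoˡ-≤ (suc m) (*-monoˡ-≤ n (≤-trans (≤ᵇ⇒≤ 2 4 _) 4≤n)) ⟩
        (n * n) ^ suc m ≡⟨ cong (λ z → (n * z) ^ suc m) (*-identityʳ n) ⟨
        (n ^ 2) ^ suc m ≡⟨ ^-*-assoc n 2 (suc m) ⟩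
        n ^ (2 * suc m) ≤⟨ ^-monoʳ-≤ n (*-monoʳ-≤ 2 (+-monoˡ-≤ m (≤ᵇ⇒≤ 1 7 _))) ⟩
        n ^ (2 * M) ∎)
        where open ≤-Reasoning

      L≤2n : L ≤ 2 * n
      L≤2n = ≤-trans L≤n (m≤m+n n _)

      2n≤2^ : 2 * n ≤ 2 ^ (2 + h)
      2n≤2^ = *-monoʳ-≤ 2 (<⇒≤ n<2^)

      1≤h : 1 ≤ h
      1≤h = ≤-trans (≤ᵇ⇒≤ 1 18 _) 18≤h

      l^M≤′ : l ^ M ≤ 2 ^ M * (2 * n) ^ 4
      l^M≤′ = ≤-trans l^M≤ (*-monoʳ-≤ (2 ^ M) (^-monoˡ-≤ 4 3+i≤2n))
        where
        3+i≤2n : 3 + i ≤ 2 * n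
        3+i≤2n = ≤-trans (≤-trans (≤-reflexive (+-comm 3 i)) (+-mono-≤ (n≤1+n i) (≤-trans (≤ᵇ⇒≤ 3 4 _) 4≤n))) (≤-reflexive (cong (λ z → n + z) (sym (+-identityʳ n))))

      survives : ∀ {x} → Sifted N (val y) R x → x ≤ N × All (λ p → ∃ λ j → + x ∈ℤ/[ p ] R p j) Q
      survives (x≤N , hit) = x≤N , All.map (λ { {p} (n<p , p-prime , p<) → hit p p-prime (in-range n<p p<) }) (primesBetween-all n (n + n ∸ 1))

      divisors : ∃ λ r → r * h ≤ 6 * l × L * N + L * N < n ^ suc r
      divisors = divisor-bound {N} {n} {L} {l} {h} {{>-nonZero 1≤h}} 1≤l n≤N N<2^ L≤2n 2^h≤n

      enough : ∀ T e → suc (e * M) ≤ 2 * suc h → 4 * (180 * (T * k ^ T)) ≤ 2 ^ e → T * (k ^ T * (badBound L * proj₁ divisors)) < length Q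
      enough T e eM≤ E≤ = enough-primes {n} {h} {length Q} {T} {k ^ T} {L} {l} {proj₁ divisors} 1≤h 1≤L n≤6hQ (proj₁ (proj₂ divisors))
        (dense-enough m n (s≤s z≤n) {180 * (T * k ^ T)} {L} {l} (small-power m n (s≤s z≤n) {e} {h} 2^h≤n eM≤ E≤) L^≤ l^M≤′)

      module Covers (t : ℕ) = Survivors k N L n (proj₁ divisors) t R Q
        (primesBetween-unique n (n + n ∸ 1)) (All.map (λ q → proj₁ q , proj₁ (proj₂ q)) (primesBetween-all n (n + n ∸ 1)))
        short 1≤L L≤n (proj₂ (proj₂ divisors))

      E : ℝ
      E = factor ε k {{k≢0}}

      one-class : k ≡ 1 → Cover ε k {{k≢0}} N y R
      one-class k≡1 = conclude (Fin-only k≡1) (few-steps M h h-large)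
        where
        Fin-only : ∀ {k} → k ≡ 1 → Σ (Fin k) λ i₀ → ∀ i → i ≡ i₀
        Fin-only refl = zero , λ { zero → refl }
        t : ℕ
        -- With B = 2 this is enough for L ≤ 2 n ≤ B^t.
        t = 2 + h
        conclude : (Σ (Fin k) λ i₀ → ∀ i → i ≡ i₀) →
          (∃ λ e → suc (e * M) ≤ 2 * suc h × 4 * (180 * (suc (1 * suc t) * 1)) ≤ 2 ^ e) → Cover ε k {{k≢0}} N y R
        conclude (i₀ , only) (e , eM≤ , E≤) = finish (cover-by-segment i₀ only refl)
          where
          E≤′ : 4 * (180 * (suc (k * suc t) * k ^ suc (k * suc t))) ≤ 2 ^ e
          E≤′ = subst (λ z → 4 * (180 * (suc (z * suc t) * z ^ suc (z * suc t))) ≤ 2 ^ e) (sym k≡1)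
            (subst (λ z → 4 * (180 * (suc (1 * suc t) * z)) ≤ 2 ^ e) (sym (^-zeroˡ (suc (1 * suc t)))) E≤)
          open Covers.Run t 2 1 <2⇒∣1 ≤-refl
            (≤-trans L≤2n 2n≤2^) (>-nonZero⁻¹ k {{k≢0}}) (enough (suc (k * suc t)) e eM≤ E≤′)
          finish : (Σ (Fin k → AP ℤ⁺) λ P → (∀ i → lengthℤ (P i) ≤ L) ×
            (∀ a → a ≤ N × All (λ p → ∃ λ j → + a ∈ℤ/[ p ] R p j) Q → ∃ λ i → + a ∈ℤ P i)) → Cover ε k {{k≢0}} N y R
          finish (P , len , cov) = P , (λ j → product-bound {E} {Y} {lengthℤ (P j)} {1} {L} ≤-refl 1≤L
            (≤-trans (len j) (≤-reflexive (sym (*-identityˡ L)))) (double-exp-≥2 ε 160 k {{k≢0}}) L≼Y) ,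
            λ x sifted → cov x (survives sifted)

      many-classes : 2 ≤ k → Cover ε k {{k≢0}} N y R
      many-classes 2≤k = with-log (log₂ k (≤-trans (n≤1+n 1) 2≤k))
        where
        with-log : (∃ λ κ → 2 ^ κ ≤ k × k < 2 ^ suc κ) → Cover ε k {{k≢0}} N y R
        with-log (zero , _ , k<2) = ⊥-elim (<⇒≱ k<2 2≤k)
        with-log (κ@(suc κ-1) , 2^κ≤k , k<2^) = by-size (2 ^ (70 * (κ * k)) ≤? l)
          where
          open ManyClasses k κ M 2≤k (s≤s z≤n)
            (≤-trans (<⇒≤ k<2^) (^-monoʳ-≤ 2 (≤-trans (+-monoˡ-≤ κ {1} {κ} (s≤s z≤n)) (≤-reflexive (cong (λ z → κ + z) (sym (+-identityʳ κ)))))))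
            (m≤m+n 7 m)
          U≡ : suc (pred U) ≡ U
          U≡ = suc-pred U {{>-nonZero (≤-trans (≤-trans (≤ᵇ⇒≤ 1 14 _) 14≤P) (m≤n*m P 20))}}
          big : ⟦ 2 ^ (2 ^ U ∸ 1) ⟧ ≼ E
          big = subst (λ u → ⟦ 2 ^ (2 ^ u ∸ 1) ⟧ ≼ E) U≡ (double-exp-lower ε {b} M εb ≤4 160 k κ (pred U) {{k≢0}} (s≤s z≤n) 2^κ≤k
            (subst (λ u → 8 * u < 161 * k * κ * M) (sym U≡) constant-≥))
          by-size : Dec (2 ^ (70 * (κ * k)) ≤ l) → Cover ε k {{k≢0}} N y R
          -- The whole interval [0, N] is short enough: N + 1 ≤ 2 · `half-factor`. Since only y^(1/2
          -- - ε) ≥ 1 is used, the length parameter of `product-bound` is 2, half of which is 1.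
          by-size (no l≱) = (λ _ → prog (+ 0) (+ 1) N) ,
            (λ _ → product-bound {E} {Y} {lengthℤ (prog (+ 0) (+ 1) N)} {half-factor} {2} (m^n>0 2 (2 ^ U ∸ 2)) (s≤s z≤n)
              (≤-trans (length-prog-≤ (+ 0) (+ 1) N) (trivial-cover (≰⇒> l≱) N<2^))
              (subst (λ z → ⟦ z ⟧ ≼ E) (sym 2*half-factor) big) 1≼Y) ,
            λ x sifted → first , ∈-segment {x} {0} {1} {N} z≤n (1∣ x) (≤-trans (proj₁ sifted) (≤-reflexive (sym (*-identityˡ N))))
            where
            first : Fin k
            first = Fin.fromℕ< (≤-trans (n≤1+n 1) 2≤k)
          by-size (yes 2^v≤l′) = conclude (few-steps-many h (range-≥ h (range-lower m n (s≤s z≤n) {70 * (κ * k)} {l} {i} {h} refl 2^v≤l′ l^M≤ n<2^)))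
            where
            t : ℕ
            t = rounds h
            conclude : (∃ λ e → suc (e * M) ≤ 2 * suc h × 4 * (180 * (suc (k * suc t) * k ^ suc (k * suc t))) ≤ 2 ^ e) → Cover ε k {{k≢0}} N y R
            conclude (e , eM≤ , E≤) = finish (cover-by-hulls (1≤n! (2 ^ β)))
              where
              open Covers.Run t (2 ^ β) ((2 ^ β) !) (≤⇒∣! (2 ^ β)) (^-monoʳ-≤ 2 (>-nonZero⁻¹ β {{β≢0}}))
                (≤-trans L≤2n (≤-trans 2n≤2^ (≤-trans (^-monoʳ-≤ 2 (bt≥ h)) (≤-reflexive (sym (^-*-assoc 2 β t))))))
                (≤-trans (n≤1+n 1) 2≤k) (enough (suc (k * suc t)) e eM≤ E≤)
              finish : (Σ (Fin k → AP ℤ⁺) λ P → (∀ i → lengthℤ (P i) ≤ 2 * (2 ^ β * (2 ^ β) ! * L)) ×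
                (∀ a → a ≤ N × All (λ p → ∃ λ j → + a ∈ℤ/[ p ] R p j) Q → ∃ λ i → + a ∈ℤ P i)) → Cover ε k {{k≢0}} N y R
              finish (P , len , cov) = P , (λ j → product-bound {E} {Y} {lengthℤ (P j)} {2 * (2 ^ β * (2 ^ β) !)} {L}
                (*-mono-≤ {1} {2} (s≤s z≤n) (*-mono-≤ (m^n>0 2 β) (1≤n! (2 ^ β)))) 1≤L
                (≤-trans (len j) (≤-reflexive (sym (*-assoc 2 (2 ^ β * (2 ^ β) !) L)))) (⟦⟧≼-mono {E} factor-≤ big) L≼Y) ,
                λ x sifted → cov x (survives sifted)

      cover : Cover ε k {{k≢0}} N y R
      cover = by (k ≟ 1)
        where
        by : Dec (k ≡ 1) → Cover ε k {{k≢0}} N y R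
        by (yes k≡1) = one-class k≡1
        by (no  k≢1) = many-classes (≤∧≢⇒< (>-nonZero⁻¹ k {{k≢0}}) λ e → k≢1 (sym e))

  sift : Cover ε k {{k≢0}} N y R
  sift = go (log₂ N 1≤N) (between-naturals y)
    where
    go : (∃ λ l → 2 ^ l ≤ N × N < 2 ^ suc l) → (∃[ i ] Below (val y) ⟦ i ⟧ × Above (val y) ⟦ 2 + i ⟧) → Cover ε k {{k≢0}} N y R
    go (l , 2^l≤N , N<2^) (i , yi , y2+i) = go₁ (log₂ (suc i) (s≤s z≤n))
      where
      go₁ : (∃ λ h → 2 ^ h ≤ suc i × suc i < 2 ^ suc h) → Cover ε k {{k≢0}} N y R
      go₁ (h , 2^h≤n , n<2^) = go₂ (maximum-List (Admissible l 2^l≤N N<2^ i yi y2+i h 2^h≤n n<2^) (λ p j → lengthℤ/ p (R p j))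
          (Q l 2^l≤N N<2^ i yi y2+i h 2^h≤n n<2^) (admissible-1 l 2^l≤N N<2^ i yi y2+i h 2^h≤n n<2^)
          (admissible-length l 2^l≤N N<2^ i yi y2+i h 2^h≤n n<2^))
        where
        go₂ : (∃ λ L → 1 ≤ L × (½ ℚ.* ⟦ L ⟧ ≼ Y × L ^ (2 * M) ≤ (2 * suc i) ^ suc m) × All (λ p → ∀ j → lengthℤ/ p (R p j) ≤ L)
                (Q l 2^l≤N N<2^ i yi y2+i h 2^h≤n n<2^)) → Cover ε k {{k≢0}} N y R
        go₂ (L , 1≤L , (L≼Y , L^≤) , short) = cover l 2^l≤N N<2^ i yi y2+i h 2^h≤n n<2^ L 1≤L L≼Y L^≤ short

Theorem : ℝ⁺ → Set₁
Theorem ε = Σ ℕ λ N₀ →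
  (k : ℕ) .{{_ : NonZero k}} (N : ℕ) .{{_ : NonTrivial N}} → N₀ < N →
  (y : ℝ⁺) → log⁺ N ^ℝ (ε ⁻¹) ≤ℝ val y → val y ≤ℝ fromℕ N →
  (R : (p : ℕ) → Fin k → AP (ℤ/ p)) →
  (∀ p (p-prime : Prime p) → p ∈[ val y ,2×] → ∀ i →
    fromℕ (lengthℤ/ p (R p i)) ≤ℝ fromℕ⁺ p {{prime⇒nonZero p-prime}} ^ℝ (½ℝ -ℝ val ε)) →
  Cover ε k N y R

sieve : ∀ ε → val ε <ℝ ½ℝ → Theorem ε
sieve ε ε<½ = go (approximate-ε ε ε<½)
  where
  go : (∃[ m ] ∃₂ λ a b → Below (val ε) a × Above (val ε) b × ⟦ 3 ⟧ ℚ.≤ (7 + m) · a × (7 + m) · b ℚ.≤ ⟦ 4 ⟧) → Theorem ε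
  go (m , a , b , εa , εb , 3≤ , ≤4) = with-threshold (threshold m) refl
    where
    -- v is generalised so that 2 ^ v is never evaluated.
    with-threshold : ∀ v → v ≡ threshold m → Theorem ε
    with-threshold v v≡ = 2 ^ (2 ^ v) , λ k N N> y logN≤y y≤N R short →
      Sifting.sift ε ε<½ m a b εa εb 3≤ ≤4 k (≢-nonZero (≢-nonZero⁻¹ k)) N (n>1⇒nonTrivial (nonTrivial⇒n>1 N)) v v≡ N> y logN≤y y≤N R short

theorem1p6 : Σ ℝ⁺ λ C →
    (ε : ℝ⁺) → val ε <ℝ ½ℝ →
    Σ ℕ λ N₀ →
    (k : ℕ) .{{_ : NonZero k}} (N : ℕ) .{{_ : NonTrivial N}} → N₀ < N →
    (y : ℝ⁺) → log⁺ N ^ℝ (ε ⁻¹) ≤ℝ val y → val y ≤ℝ fromℕ N →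
    (R : (p : ℕ) → Fin k → AP (ℤ/ p)) →
    (∀ p (p-prime : Prime p) → p ∈[ val y ,2×] → ∀ i →
    fromℕ (lengthℤ/ p (R p i)) ≤ℝ
    fromℕ⁺ p {{prime⇒nonZero p-prime}} ^ℝ (½ℝ -ℝ val ε)) →
    Σ (Fin k → AP ℤ⁺) λ P →
    (∀ i → fromℕ (lengthℤ (P i)) ≤ℝ
    exp (exp (val C *ℝ (fromℕ k *ℝ log (fromℕ⁺ k)) *ℝ ε ⁻¹)) *ℝ y ^ℝ (½ℝ -ℝ val ε))
    × (∀ n → Sifted N (val y) R n → ∃ λ i → + n ∈ℤ P i)
theorem1p6 = fromℕ⁺ 161 , sieve
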